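{- Let $S^n\subset\mathbb{R}^{n+1}$ be the Euclidean unit sphere. There exists a constant $C\ge 1$ such that for every $\alpha\in S^n$ there exist infinitely many rationals $\frac{\mathbf{p}}{q}\in S^n$ such that $$\left\|\alpha-\frac{\mathbf{p}}{q}\right\|<\frac{C}{q}.$$
   Context: $\|\cdot\|$ denotes the supremum norm on $\mathbb{R}^{n+1}$. Rational points on the sphere, i.e. points of $S^n\cap\mathbb{Q}^{n+1}$, are represented as $\frac{\mathbf{p}}{q}$ with $q\in\mathbb{N}$, $\mathbf{p}\in\mathbb{Z}^{n+1}$ and $(\mathbf{p},q)$ primitive.
   Formalization: The formal theorem assumes α is not a rational point (not all coordinates rational): at a rational α=p₀/q₀ on the sphere, any other rational point p/q is at Euclidean distance at least √(2/(q₀q)), so only finitely many primitive p/q satisfy the bound and the claim fails there. -}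

module Defs where

open import Data.Integer.Base as ℤ using (ℤ; +_)
import Data.Integer.Divisibility as ℤ∣
open import Data.List.Base using (List)
open import Data.List.Membership.Propositional using (_∉_)
open import Data.Nat.Base as ℕ using (ℕ; suc)
import Data.Nat.Properties as ℕₚ
open import Data.Product.Base using (Σ; ∃; _×_; _,_; proj₁; proj₂)
open import Data.Rational.Base as ℚ using (ℚ; 0ℚ; 1ℚ; ½)
import Data.Rational.Properties as ℚₚ
open import Data.Rational.Solver using (module +-*-Solver)
open import Data.Sum.Base using (inj₁; inj₂)
open import Data.Vec.Base using (Vec; lookup)
open import Data.Vec.Functional using (Vector; foldr; map; zipWith)
open import Relation.Binary.PropositionalEquality
  using (_≡_; refl; sym; cong; cong₂; subst)
open import Relation.Nullary.Negation.Core using (¬_)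
open import Relation.Unary using (Pred)
open import Level using (0ℓ)

------------------------------------------------------------------------
-- Real numbers: Cauchy sequences of rationals, equal when their
-- difference tends to 0.

IsCauchy : (ℕ → ℚ) → Set
IsCauchy x = ∀ ε → 0ℚ ℚ.< ε →
  ∃ λ N → ∀ m n → N ℕ.≤ m → N ℕ.≤ n → ℚ.∣ x m ℚ.- x n ∣ ℚ.< ε

record ℝ : Set where
  constructor mkℝ
  field
    seq    : ℕ → ℚ
    cauchy : IsCauchy seq

open ℝ public

infix 4 _≈_ _<_ _≤_

_≈_ : ℝ → ℝ → Set
x ≈ y = ∀ ε → 0ℚ ℚ.< ε →
  ∃ λ N → ∀ n → N ℕ.≤ n → ℚ.∣ seq x n ℚ.- seq y n ∣ ℚ.< ε

-- The gap ε must not depend on n: a termwise strict inequality would only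
-- give x ≤ y in the limit.
_<_ : ℝ → ℝ → Set
x < y = ∃ λ ε → 0ℚ ℚ.< ε ×
  ∃ λ N → ∀ n → N ℕ.≤ n → seq x n ℚ.+ ε ℚ.< seq y n

_≤_ : ℝ → ℝ → Set
x ≤ y = ¬ (y < x)

fromℚ : ℚ → ℝ
fromℚ r = mkℝ (λ _ → r) λ ε 0<ε →
  0 , λ _ _ _ _ → subst (λ d → ℚ.∣ d ∣ ℚ.< ε) (sym (ℚₚ.+-inverseʳ r)) 0<ε

-- Termwise operations preserve the Cauchy property as soon as they are
-- eventually Lipschitz along the given sequences.

EventuallyLipschitz : (ℚ → ℚ → ℚ) → ℚ → (ℕ → ℚ) → (ℕ → ℚ) → Set
EventuallyLipschitz f K x y = ∃ λ N → ∀ m n → N ℕ.≤ m → N ℕ.≤ n →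
  ℚ.∣ f (x m) (y m) ℚ.- f (x n) (y n) ∣
    ℚ.≤ K ℚ.* (ℚ.∣ x m ℚ.- x n ∣ ℚ.+ ℚ.∣ y m ℚ.- y n ∣)

module _ (f : ℚ → ℚ → ℚ) (K : ℚ) .{{_ : ℚ.Positive K}} where

  private instance
    K≢0 : ℚ.NonZero K
    K≢0 = ℚₚ.pos⇒nonZero K

  private
    δ : ℚ → ℚ
    δ ε = (½ ℚ.* (ℚ.1/ K)) ℚ.* ε

    0<δ : ∀ {ε} → 0ℚ ℚ.< ε → 0ℚ ℚ.< δ ε
    0<δ {ε} 0<ε = ℚₚ.positive⁻¹ (δ ε)
      {{ℚₚ.pos*pos⇒pos (½ ℚ.* (ℚ.1/ K))
          {{ℚₚ.pos*pos⇒pos ½ (ℚ.1/ K) {{ℚₚ.1/pos⇒pos K}}}}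
          ε {{ℚ.positive 0<ε}}}}

    K*2δ : ∀ ε → K ℚ.* (δ ε ℚ.+ δ ε) ≡ ε
    K*2δ ε = begin
      K ℚ.* (δ ε ℚ.+ δ ε)      ≡⟨ regroup K (ℚ.1/ K) ε ⟩
      (K ℚ.* (ℚ.1/ K)) ℚ.* ε   ≡⟨ cong (ℚ._* ε) (ℚₚ.*-inverseʳ K) ⟩
      1ℚ ℚ.* ε                 ≡⟨ ℚₚ.*-identityˡ ε ⟩
      ε                        ∎
      where
      open Relation.Binary.PropositionalEquality.≡-Reasoning
      open +-*-Solver
      regroup : ∀ k i e →
        k ℚ.* (((½ ℚ.* i) ℚ.* e) ℚ.+ ((½ ℚ.* i) ℚ.* e)) ≡ (k ℚ.* i) ℚ.* e
      regroup = solve 3 (λ k i e →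
        k :* (((con ½ :* i) :* e) :+ ((con ½ :* i) :* e)) := (k :* i) :* e) refl

  cauchy₂ : ∀ x y → IsCauchy x → IsCauchy y → EventuallyLipschitz f K x y →
            IsCauchy (λ n → f (x n) (y n))
  cauchy₂ x y cx cy (L , lip) ε 0<ε =
    L ℕ.⊔ (M ℕ.⊔ N) , λ m n p q → begin-strict
      ℚ.∣ f (x m) (y m) ℚ.- f (x n) (y n) ∣
        ≤⟨ lip m n (inL p) (inL q) ⟩
      K ℚ.* (ℚ.∣ x m ℚ.- x n ∣ ℚ.+ ℚ.∣ y m ℚ.- y n ∣)
        <⟨ ℚₚ.*-monoʳ-<-pos K
             (ℚₚ.+-mono-< (proj₂ X m n (inM p) (inM q))
                          (proj₂ Y m n (inN p) (inN q))) ⟩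
      K ℚ.* (δ ε ℚ.+ δ ε)
        ≡⟨ K*2δ ε ⟩
      ε ∎
    where
    open ℚₚ.≤-Reasoning
    X = cx (δ ε) (0<δ 0<ε)
    Y = cy (δ ε) (0<δ 0<ε)
    M = proj₁ X
    N = proj₁ Y
    inL : ∀ {k} → L ℕ.⊔ (M ℕ.⊔ N) ℕ.≤ k → L ℕ.≤ k
    inL = ℕₚ.m⊔n≤o⇒m≤o L (M ℕ.⊔ N)
    inM : ∀ {k} → L ℕ.⊔ (M ℕ.⊔ N) ℕ.≤ k → M ℕ.≤ k
    inM p = ℕₚ.m⊔n≤o⇒m≤o M N (ℕₚ.m⊔n≤o⇒n≤o L (M ℕ.⊔ N) p)
    inN : ∀ {k} → L ℕ.⊔ (M ℕ.⊔ N) ℕ.≤ k → N ℕ.≤ k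
    inN p = ℕₚ.m⊔n≤o⇒n≤o M N (ℕₚ.m⊔n≤o⇒n≤o L (M ℕ.⊔ N) p)

NonExpansive : (ℚ → ℚ → ℚ) → Set
NonExpansive f = ∀ a b c d →
  ℚ.∣ f a b ℚ.- f c d ∣ ℚ.≤ ℚ.∣ a ℚ.- c ∣ ℚ.+ ℚ.∣ b ℚ.- d ∣

lift₂ : (f : ℚ → ℚ → ℚ) → NonExpansive f → ℝ → ℝ → ℝ
lift₂ f ne x y = mkℝ (λ n → f (seq x n) (seq y n))
  (cauchy₂ f 1ℚ (seq x) (seq y) (cauchy x) (cauchy y)
    (0 , λ m n _ _ → ℚₚ.≤-trans
      (ne (seq x m) (seq y m) (seq x n) (seq y n))
      (ℚₚ.≤-reflexive (sym (ℚₚ.*-identityˡ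
        (ℚ.∣ seq x m ℚ.- seq x n ∣ ℚ.+ ℚ.∣ seq y m ℚ.- seq y n ∣))))))

private
  module _ where
    open ℚₚ.≤-Reasoning
    open +-*-Solver

    x≤y+∣x-y∣ : ∀ x y → x ℚ.≤ y ℚ.+ ℚ.∣ x ℚ.- y ∣
    x≤y+∣x-y∣ x y = begin
      x                      ≡⟨ solve 2 (λ x y → x := y :+ (x :- y)) refl x y ⟩
      y ℚ.+ (x ℚ.- y)        ≤⟨ ℚₚ.+-monoʳ-≤ y (p≤∣p∣ (x ℚ.- y)) ⟩
      y ℚ.+ ℚ.∣ x ℚ.- y ∣    ∎
      where
      p≤∣p∣ : ∀ p → p ℚ.≤ ℚ.∣ p ∣
      p≤∣p∣ p with ℚₚ.≤-total 0ℚ p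
      ... | inj₁ 0≤p = ℚₚ.≤-reflexive (sym (ℚₚ.0≤p⇒∣p∣≡p 0≤p))
      ... | inj₂ p≤0 = ℚₚ.≤-trans p≤0 (ℚₚ.0≤∣p∣ p)

    ∣x-y∣-sym : ∀ x y → ℚ.∣ x ℚ.- y ∣ ≡ ℚ.∣ y ℚ.- x ∣
    ∣x-y∣-sym x y = begin-equality
      ℚ.∣ x ℚ.- y ∣          ≡⟨ cong ℚ.∣_∣ (solve 2 (λ x y → x :- y := :- (y :- x)) refl x y) ⟩
      ℚ.∣ ℚ.- (y ℚ.- x) ∣    ≡⟨ ℚₚ.∣-p∣≡∣p∣ (y ℚ.- x) ⟩
      ℚ.∣ y ℚ.- x ∣          ∎

    x≤y+s⇒x-y≤s : ∀ {x y s} → x ℚ.≤ y ℚ.+ s → x ℚ.- y ℚ.≤ s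
    x≤y+s⇒x-y≤s {x} {y} {s} x≤y+s = begin
      x ℚ.- y            ≤⟨ ℚₚ.+-monoˡ-≤ (ℚ.- y) x≤y+s ⟩
      (y ℚ.+ s) ℚ.- y    ≡⟨ solve 2 (λ y s → (y :+ s) :- y := s) refl y s ⟩
      s                  ∎

    ∣x-y∣≤s : ∀ {x y s} → x ℚ.≤ y ℚ.+ s → y ℚ.≤ x ℚ.+ s → ℚ.∣ x ℚ.- y ∣ ℚ.≤ s
    ∣x-y∣≤s {x} {y} p q with ℚₚ.∣p∣≡p∨∣p∣≡-p (x ℚ.- y)
    ... | inj₁ e = subst (ℚ._≤ _) (sym e) (x≤y+s⇒x-y≤s p)
    ... | inj₂ e = subst (ℚ._≤ _) (sym e)
                     (subst (ℚ._≤ _)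
                       (solve 2 (λ x y → y :- x := :- (x :- y)) refl x y)
                       (x≤y+s⇒x-y≤s q))

    s≤s+∣t∣ : ∀ s t → s ℚ.≤ s ℚ.+ ℚ.∣ t ∣
    s≤s+∣t∣ s t = begin
      s                  ≡⟨ sym (ℚₚ.+-identityʳ s) ⟩
      s ℚ.+ 0ℚ           ≤⟨ ℚₚ.+-monoʳ-≤ s (ℚₚ.0≤∣p∣ t) ⟩
      s ℚ.+ ℚ.∣ t ∣      ∎

    t≤∣s∣+t : ∀ s t → t ℚ.≤ ℚ.∣ s ∣ ℚ.+ t
    t≤∣s∣+t s t = subst (t ℚ.≤_) (ℚₚ.+-comm t ℚ.∣ s ∣) (s≤s+∣t∣ t s)

    +-nonExpansive : NonExpansive ℚ._+_
    +-nonExpansive a b c d = begin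
      ℚ.∣ (a ℚ.+ b) ℚ.- (c ℚ.+ d) ∣
        ≡⟨ cong ℚ.∣_∣ (solve 4 (λ a b c d →
             (a :+ b) :- (c :+ d) := (a :- c) :+ (b :- d)) refl a b c d) ⟩
      ℚ.∣ (a ℚ.- c) ℚ.+ (b ℚ.- d) ∣
        ≤⟨ ℚₚ.∣p+q∣≤∣p∣+∣q∣ (a ℚ.- c) (b ℚ.- d) ⟩
      ℚ.∣ a ℚ.- c ∣ ℚ.+ ℚ.∣ b ℚ.- d ∣ ∎

    neg-nonExpansive : NonExpansive (λ a _ → ℚ.- a)
    neg-nonExpansive a b c d = begin
      ℚ.∣ (ℚ.- a) ℚ.- (ℚ.- c) ∣
        ≡⟨ cong ℚ.∣_∣ (solve 2 (λ a c → (:- a) :- (:- c) := c :- a) refl a c) ⟩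
      ℚ.∣ c ℚ.- a ∣
        ≡⟨ ∣x-y∣-sym c a ⟩
      ℚ.∣ a ℚ.- c ∣
        ≤⟨ s≤s+∣t∣ ℚ.∣ a ℚ.- c ∣ (b ℚ.- d) ⟩
      ℚ.∣ a ℚ.- c ∣ ℚ.+ ℚ.∣ b ℚ.- d ∣ ∎

    abs-nonExpansive : NonExpansive (λ a _ → ℚ.∣ a ∣)
    abs-nonExpansive a b c d = begin
      ℚ.∣ ℚ.∣ a ∣ ℚ.- ℚ.∣ c ∣ ∣
        ≤⟨ ∣x-y∣≤s (half a c)
             (subst (λ t → ℚ.∣ c ∣ ℚ.≤ ℚ.∣ a ∣ ℚ.+ t) (∣x-y∣-sym c a) (half c a)) ⟩
      ℚ.∣ a ℚ.- c ∣
        ≤⟨ s≤s+∣t∣ ℚ.∣ a ℚ.- c ∣ (b ℚ.- d) ⟩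
      ℚ.∣ a ℚ.- c ∣ ℚ.+ ℚ.∣ b ℚ.- d ∣ ∎
      where
      half : ∀ x y → ℚ.∣ x ∣ ℚ.≤ ℚ.∣ y ∣ ℚ.+ ℚ.∣ x ℚ.- y ∣
      half x y = begin
        ℚ.∣ x ∣                        ≡⟨ cong ℚ.∣_∣ (solve 2 (λ x y → x := y :+ (x :- y)) refl x y) ⟩
        ℚ.∣ y ℚ.+ (x ℚ.- y) ∣          ≤⟨ ℚₚ.∣p+q∣≤∣p∣+∣q∣ y (x ℚ.- y) ⟩
        ℚ.∣ y ∣ ℚ.+ ℚ.∣ x ℚ.- y ∣      ∎

    ⊔-nonExpansive : NonExpansive ℚ._⊔_
    ⊔-nonExpansive a b c d = ∣x-y∣≤s (half a b c d)
      (subst (λ t → c ℚ.⊔ d ℚ.≤ (a ℚ.⊔ b) ℚ.+ t) swap (half c d a b))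
      where
      swap : ℚ.∣ c ℚ.- a ∣ ℚ.+ ℚ.∣ d ℚ.- b ∣ ≡ ℚ.∣ a ℚ.- c ∣ ℚ.+ ℚ.∣ b ℚ.- d ∣
      swap = cong₂ ℚ._+_ (∣x-y∣-sym c a) (∣x-y∣-sym d b)
      half : ∀ a b c d →
        a ℚ.⊔ b ℚ.≤ (c ℚ.⊔ d) ℚ.+ (ℚ.∣ a ℚ.- c ∣ ℚ.+ ℚ.∣ b ℚ.- d ∣)
      half a b c d = ℚₚ.⊔-lub
        (ℚₚ.≤-trans (x≤y+∣x-y∣ a c)
          (ℚₚ.+-mono-≤ (ℚₚ.p≤p⊔q c d) (s≤s+∣t∣ ℚ.∣ a ℚ.- c ∣ (b ℚ.- d))))
        (ℚₚ.≤-trans (x≤y+∣x-y∣ b d)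
          (ℚₚ.+-mono-≤ (ℚₚ.p≤q⊔p c d) (t≤∣s∣+t (a ℚ.- c) ℚ.∣ b ℚ.- d ∣)))

    cauchy⇒bounded : ∀ x → IsCauchy x →
      ∃ λ N → ∃ λ B → 0ℚ ℚ.≤ B × (∀ n → N ℕ.≤ n → ℚ.∣ x n ∣ ℚ.≤ B)
    cauchy⇒bounded x cx =
      N , ℚ.∣ x N ∣ ℚ.+ 1ℚ , ℚₚ.+-mono-≤ (ℚₚ.0≤∣p∣ (x N)) 0≤1 , λ n N≤n → begin
        ℚ.∣ x n ∣
          ≡⟨ cong ℚ.∣_∣ (solve 2 (λ a b → a := b :+ (a :- b)) refl (x n) (x N)) ⟩
        ℚ.∣ x N ℚ.+ (x n ℚ.- x N) ∣
          ≤⟨ ℚₚ.∣p+q∣≤∣p∣+∣q∣ (x N) (x n ℚ.- x N) ⟩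
        ℚ.∣ x N ∣ ℚ.+ ℚ.∣ x n ℚ.- x N ∣
          ≤⟨ ℚₚ.+-monoʳ-≤ ℚ.∣ x N ∣ (ℚₚ.<⇒≤ (proj₂ X n N N≤n ℕₚ.≤-refl)) ⟩
        ℚ.∣ x N ∣ ℚ.+ 1ℚ ∎
      where
      X = cx 1ℚ (ℚₚ.positive⁻¹ 1ℚ)
      N = proj₁ X
      0≤1 : 0ℚ ℚ.≤ 1ℚ
      0≤1 = ℚₚ.nonNegative⁻¹ 1ℚ

    *-lipschitz : ∀ K a b c d → ℚ.∣ b ∣ ℚ.≤ K → ℚ.∣ c ∣ ℚ.≤ K →
      ℚ.∣ (a ℚ.* b) ℚ.- (c ℚ.* d) ∣ ℚ.≤ K ℚ.* (ℚ.∣ a ℚ.- c ∣ ℚ.+ ℚ.∣ b ℚ.- d ∣)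
    *-lipschitz K a b c d ∣b∣≤K ∣c∣≤K = begin
      ℚ.∣ (a ℚ.* b) ℚ.- (c ℚ.* d) ∣
        ≡⟨ cong ℚ.∣_∣ (solve 4 (λ a b c d →
             (a :* b) :- (c :* d) := (b :* (a :- c)) :+ (c :* (b :- d)))
             refl a b c d) ⟩
      ℚ.∣ (b ℚ.* (a ℚ.- c)) ℚ.+ (c ℚ.* (b ℚ.- d)) ∣
        ≤⟨ ℚₚ.∣p+q∣≤∣p∣+∣q∣ (b ℚ.* (a ℚ.- c)) (c ℚ.* (b ℚ.- d)) ⟩
      ℚ.∣ b ℚ.* (a ℚ.- c) ∣ ℚ.+ ℚ.∣ c ℚ.* (b ℚ.- d) ∣
        ≤⟨ ℚₚ.+-mono-≤ (scale b (a ℚ.- c) ∣b∣≤K) (scale c (b ℚ.- d) ∣c∣≤K) ⟩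
      (K ℚ.* ℚ.∣ a ℚ.- c ∣) ℚ.+ (K ℚ.* ℚ.∣ b ℚ.- d ∣)
        ≡⟨ sym (ℚₚ.*-distribˡ-+ K ℚ.∣ a ℚ.- c ∣ ℚ.∣ b ℚ.- d ∣) ⟩
      K ℚ.* (ℚ.∣ a ℚ.- c ∣ ℚ.+ ℚ.∣ b ℚ.- d ∣) ∎
      where
      scale : ∀ x y → ℚ.∣ x ∣ ℚ.≤ K → ℚ.∣ x ℚ.* y ∣ ℚ.≤ K ℚ.* ℚ.∣ y ∣
      scale x y ∣x∣≤K = begin
        ℚ.∣ x ℚ.* y ∣            ≡⟨ ℚₚ.∣p*q∣≡∣p∣*∣q∣ x y ⟩
        ℚ.∣ x ∣ ℚ.* ℚ.∣ y ∣      ≤⟨ ℚₚ.*-monoʳ-≤-nonNeg ℚ.∣ y ∣ {{ℚₚ.∣-∣-nonNeg y}} ∣x∣≤K ⟩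
        K ℚ.* ℚ.∣ y ∣            ∎

    commonBound : ∀ A B → 0ℚ ℚ.≤ A → 0ℚ ℚ.≤ B →
      ∃ λ K → ℚ.Positive K × A ℚ.≤ K × B ℚ.≤ K
    commonBound A B 0≤A 0≤B =
      1ℚ ℚ.+ (A ℚ.+ B) ,
      ℚₚ.pos+nonNeg⇒pos 1ℚ (A ℚ.+ B) {{ℚ.nonNegative 0≤A+B}} ,
      ℚₚ.≤-trans (ℚₚ.≤-trans (ℚₚ.≤-reflexive (sym (ℚₚ.+-identityʳ A)))
                              (ℚₚ.+-monoʳ-≤ A 0≤B)) A+B≤K ,
      ℚₚ.≤-trans (ℚₚ.≤-trans (ℚₚ.≤-reflexive (sym (ℚₚ.+-identityˡ B)))
                              (ℚₚ.+-monoˡ-≤ B 0≤A)) A+B≤K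
      where
      0≤A+B : 0ℚ ℚ.≤ A ℚ.+ B
      0≤A+B = ℚₚ.+-mono-≤ 0≤A 0≤B
      A+B≤K : A ℚ.+ B ℚ.≤ 1ℚ ℚ.+ (A ℚ.+ B)
      A+B≤K = ℚₚ.≤-trans (ℚₚ.≤-reflexive (sym (ℚₚ.+-identityˡ (A ℚ.+ B))))
                          (ℚₚ.+-monoˡ-≤ (A ℚ.+ B) (ℚₚ.nonNegative⁻¹ 1ℚ))

    *-cauchy : ∀ x y → IsCauchy x → IsCauchy y → IsCauchy (λ n → x n ℚ.* y n)
    *-cauchy x y cx cy =
      let M , A , 0≤A , ∣x∣≤A = cauchy⇒bounded x cx
          N , B , 0≤B , ∣y∣≤B = cauchy⇒bounded y cy
          K , K>0 , A≤K , B≤K = commonBound A B 0≤A 0≤B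
      in cauchy₂ ℚ._*_ K {{K>0}} x y cx cy
           (M ℕ.⊔ N , λ m n p q → *-lipschitz K (x m) (y m) (x n) (y n)
             (ℚₚ.≤-trans (∣y∣≤B m (ℕₚ.m⊔n≤o⇒n≤o M N p)) B≤K)
             (ℚₚ.≤-trans (∣x∣≤A n (ℕₚ.m⊔n≤o⇒m≤o M N q)) A≤K))

infix  8 -_
infixl 7 _*_
infixl 6 _+_ _-_ _⊔_

0ℝ 1ℝ : ℝ
0ℝ = fromℚ 0ℚ
1ℝ = fromℚ 1ℚ

_+_ : ℝ → ℝ → ℝ
_+_ = lift₂ ℚ._+_ +-nonExpansive

-_ : ℝ → ℝ
- x = lift₂ (λ a _ → ℚ.- a) neg-nonExpansive x x

_-_ : ℝ → ℝ → ℝ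
x - y = x + (- y)

_*_ : ℝ → ℝ → ℝ
x * y = mkℝ (λ n → seq x n ℚ.* seq y n) (*-cauchy (seq x) (seq y) (cauchy x) (cauchy y))

_⊔_ : ℝ → ℝ → ℝ
_⊔_ = lift₂ ℚ._⊔_ ⊔-nonExpansive

∣_∣ : ℝ → ℝ
∣ x ∣ = lift₂ (λ a _ → ℚ.∣ a ∣) abs-nonExpansive x x

_÷ℕ_ : ℝ → (q : ℕ) → .{{ℕ.NonZero q}} → ℝ
x ÷ℕ q = x * fromℚ (+ 1 ℚ./ q)

------------------------------------------------------------------------
-- The sphere

_-ᵥ_ : ∀ {k} → Vector ℝ k → Vector ℝ k → Vector ℝ k
_-ᵥ_ = zipWith _-_

-- Starting the maximum from 0 is harmless, absolute values being nonnegative.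
∥_∥ : ∀ {k} → Vector ℝ k → ℝ
∥ v ∥ = foldr _⊔_ 0ℝ (map ∣_∣ v)

Sphere : ∀ n → Pred (Vector ℝ (suc n)) 0ℓ
Sphere n v = foldr _+_ 0ℝ (map (λ x → x * x) v) ≈ 1ℝ

-- For a rational point p₀/q₀ of the sphere, every other rational point p/q of
-- the sphere has ‖p₀/q₀ − p/q‖₂² = 2(q₀q − p₀·p)/(q₀q) ≥ 2/(q₀q), so only
-- finitely many lie within C/q of it.  Approximation with rate C/q infinitely
-- often is therefore a property of irrational points only.
IsRationalVector : ∀ {k} → Pred (Vector ℝ k) 0ℓ
IsRationalVector {k} v = Σ (Vector ℚ k) λ r → ∀ i → v i ≈ fromℚ (r i)

------------------------------------------------------------------------
-- Rational vectors p/q in lowest terms: q > 0 and coprime (p, q).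
-- The proof fields are irrelevant, and p is a Vec rather than a function,
-- so that propositional equality is equality of the pairs (p, q), hence of
-- the rational vectors they represent.

record Fraction (k : ℕ) : Set where
  constructor mkFraction
  field
    num         : Vec ℤ k
    den         : ℕ
    .{{den≢0}}  : ℕ.NonZero den
    .coprime    : ∀ (d : ℤ) → d ℤ∣.∣ + den → (∀ i → d ℤ∣.∣ lookup num i) →
                  ℤ.∣ d ∣ ≡ 1

⟦_⟧ : ∀ {k} → Fraction k → Vector ℝ k
⟦ mkFraction p q _ ⟧ i = fromℚ (lookup p i ℚ./ q)

Approximates : ∀ {k} → ℝ → Vector ℝ k → Pred (Fraction k) 0ℓ
Approximates C α r@(mkFraction _ q _) = ∥ α -ᵥ ⟦ r ⟧ ∥ < C ÷ℕ q

InfinitelyMany : ∀ {A : Set} → Pred A 0ℓ → Set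
InfinitelyMany {A} P = ∀ (xs : List A) → ∃ λ x → P x × x ∉ xs

{-# OPTIONS --safe #-}

-- A rational point p/q of the sphere is an integral vector (q , p) of the light
-- cone |p|² = q².  Fix a rational vector a close to α and a large T, and measure
-- integral vectors by q/T, by e = p − q a and by T (a · e), which is a norm after
-- a Lorentz boost in the direction of a.  A pigeonhole argument in boxes shows
-- that for every nonzero linear functional L there is an integral vector of
-- bounded size on which L does not vanish, unless there is a nonzero integral
-- vector so short that the value of the integral form |p|² − q² on it, being
-- smaller than 1 in absolute value, is 0.  In the latter case this vector lies
-- on the cone.  Otherwise the exchange lemma yields a spanning family of
-- integral vectors of bounded size; its Gram matrix is integral and bounded, so
-- it is one of finitely many, and hence has an isotropic vector whose
-- coefficients are bounded in terms of n alone.  Either way there is a nonzero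
-- integral vector on the cone of size at most S = S(n), that is |p − q a| ≤ S
-- and q ≤ S T; moreover |p/q − a|² ≤ 3S/(qT), so that for T → ∞ infinitely many
-- approximations arise, α being irrational.

module Submission where

open import Algebra.Bundles using (CommutativeRing)
import Algebra.Properties.Semiring.Sum as SemiringSum
open import Axiom.ExcludedMiddle using (ExcludedMiddle)
open import Data.Fin.Base using (Fin; zero; suc; toℕ)
import Data.Fin.Properties as Finₚ
open import Data.Integer.Base as ℤ using (ℤ)
open import Data.Nat.Base as ℕ using (ℕ; zero; suc; z≤n; s≤s)
import Data.Nat.Properties as ℕₚ
open import Data.Product.Base using (∃; _×_; _,_; proj₁; proj₂)
open import Data.Sum.Base using ([_,_]′)
open import Data.Vec.Base using (Vec; lookup)
open import Data.Vec.Functional using (Vector)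
open import Function.Base using (_∘_)
open import Level using (0ℓ)
open import Relation.Binary.PropositionalEquality hiding ([_])
open import Relation.Nullary using (¬_; Dec; yes; no; contradiction)
open import Relation.Nullary.Decidable using (dec⇒maybe; decidable-stable)
open import Tactic.RingSolver using (solve-∀)
open import Tactic.RingSolver.Core.AlmostCommutativeRing
  using (AlmostCommutativeRing; fromCommutativeRing)

-- A box principle alone yields short integral vectors, not vectors on the cone: only integrality
-- forces the value of the form to be 0, and this takes a vector short in all directions, which need
-- not exist. The pigeonhole therefore leaves one direction free, the one in which `L` has its
-- largest coefficient. If `L` vanishes on the vector found, the vector is short in that direction
-- too; if not, it is what the exchange asks for. Bounds are independent of `T` because the `T` in
-- the range of `q` cancels against the `T` that stretches `a · e`. The Gram matrix has an isotropic
-- vector at all because (1, 1, 0, ..., 0) lies on the cone and the family spans over ℚ. Excluded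
-- middle selects a bound for each matrix, so the constant is not explicit. In place of |a| = 1 the
-- condition T² | |a|² - 1 | ≤ 1 is used; it keeps q² (|a|² - 1) bounded for q ≤ S T. The same bound
-- on q makes the passage from `a` to `α` cost at most 1/q. Since q might stay bounded as `T` grows,
-- new approximations come from the second estimate and not from the rate S/q.

module Rational where

  open import Data.Fin.Base using
    (fromℕ; inject₁; punchIn; punchOut; combine; quotient; remainder; funToFin; finToFun)
  open import Data.Fin.Permutation using
    (Permutation′; transpose; _⟨$⟩ʳ_; _⟨$⟩ˡ_; inverseʳ; inverseˡ)
  import Data.Integer.Divisibility as ℤ∣
  import Data.Integer.Divisibility.Signed as ℤ∣ₛ
  import Data.Integer.Properties as ℤₚ
  open import Data.Nat.Divisibility using (divides)
  open import Data.Rational.Base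
  open import Data.Rational.Properties
  import Data.Rational.Unnormalised.Base as ℚᵘ
  import Data.Rational.Unnormalised.Properties as ℚᵘₚ
  open import Data.Sum.Base using (_⊎_; inj₁; inj₂)
  open import Data.Vec.Base using (tabulate)
  open import Data.Vec.Functional using (_∷_)
  open import Data.Vec.Properties using (lookup∘tabulate)
  open import Relation.Binary.Definitions using (Tri; tri<; tri≈; tri>)

  -- Arithmetic and order of the rationals

  ℚ-ring : AlmostCommutativeRing 0ℓ 0ℓ
  ℚ-ring = fromCommutativeRing +-*-commutativeRing (λ x → dec⇒maybe (0ℚ ≟ x))

  open SemiringSum (CommutativeRing.semiring +-*-commutativeRing)
    using (sum; sum-cong-≗; ∑-distrib-+; *-distribˡ-sum; sum-remove; sum-replicate-zero; sum-permute)
    public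

  0≤+ : ∀ {x y} → 0ℚ ≤ x → 0ℚ ≤ y → 0ℚ ≤ x + y
  0≤+ = +-mono-≤

  0≤* : ∀ {x y} → 0ℚ ≤ x → 0ℚ ≤ y → 0ℚ ≤ x * y
  0≤* {x} {y} p q = nonNegative⁻¹ (x * y)
    {{nonNeg*nonNeg⇒nonNeg x {{nonNegative p}} y {{nonNegative q}}}}

  0<* : ∀ {x y} → 0ℚ < x → 0ℚ < y → 0ℚ < x * y
  0<* {x} {y} p q = positive⁻¹ (x * y) {{pos*pos⇒pos x {{positive p}} y {{positive q}}}}

  *-mono-≤ : ∀ {a b c d} → 0ℚ ≤ a → a ≤ b → 0ℚ ≤ c → c ≤ d → a * c ≤ b * d
  *-mono-≤ {a} {b} {c} {d} 0≤a a≤b 0≤c c≤d = ≤-trans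
    (*-monoʳ-≤-nonNeg c {{nonNegative 0≤c}} a≤b)
    (*-monoˡ-≤-nonNeg b {{nonNegative (≤-trans 0≤a a≤b)}} c≤d)

  *-monoˡ : ∀ {a c d} → 0ℚ ≤ a → c ≤ d → a * c ≤ a * d
  *-monoˡ {a} 0≤a = *-monoˡ-≤-nonNeg a {{nonNegative 0≤a}}

  *-monoˡ-< : ∀ {a c d} → 0ℚ < a → c < d → a * c < a * d
  *-monoˡ-< {a} 0<a = *-monoʳ-<-pos a {{positive 0<a}}

  *-cancelˡ-≤ : ∀ {a c d} → 0ℚ < a → a * c ≤ a * d → c ≤ d
  *-cancelˡ-≤ {a} 0<a = *-cancelˡ-≤-pos a {{positive 0<a}}

  0≤y-x : ∀ {x y} → x ≤ y → 0ℚ ≤ y - x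
  0≤y-x {x} {y} p = subst (_≤ y - x) (+-inverseʳ x) (+-monoˡ-≤ (- x) p)

  x+[y-x]≡y : ∀ x y → x + (y - x) ≡ y
  x+[y-x]≡y = solve-∀ ℚ-ring

  1+x-x≡1 : ∀ x → 1ℚ + x - x ≡ 1ℚ
  1+x-x≡1 = solve-∀ ℚ-ring

  by-≤ : ∀ {x y z} → 0ℚ ≤ z → y - x ≡ z → x ≤ y
  by-≤ {x} {y} p refl = subst₂ _≤_ (+-identityʳ x) (x+[y-x]≡y x y) (+-monoʳ-≤ x p)

  by-< : ∀ {x y z} → 0ℚ < z → y - x ≡ z → x < y
  by-< {x} {y} p refl = subst₂ _<_ (+-identityʳ x) (x+[y-x]≡y x y) (+-monoʳ-< x p)

  0≤1 : 0ℚ ≤ 1ℚ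
  0≤1 = nonNegative⁻¹ 1ℚ

  0<1 : 0ℚ < 1ℚ
  0<1 = positive⁻¹ 1ℚ

  x≤∣x∣ : ∀ x → x ≤ ∣ x ∣
  x≤∣x∣ x with ≤-total 0ℚ x
  ... | inj₁ p = ≤-reflexive (sym (0≤p⇒∣p∣≡p p))
  ... | inj₂ p = ≤-trans p (0≤∣p∣ x)

  -x≤∣x∣ : ∀ x → - x ≤ ∣ x ∣
  -x≤∣x∣ x = subst (- x ≤_) (∣-p∣≡∣p∣ x) (x≤∣x∣ (- x))

  ∣∣≤-intro : ∀ {x b} → x ≤ b → - x ≤ b → ∣ x ∣ ≤ b
  ∣∣≤-intro {x} p q with ∣p∣≡p∨∣p∣≡-p x
  ... | inj₁ e = subst (_≤ _) (sym e) p
  ... | inj₂ e = subst (_≤ _) (sym e) q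

  ∣+∣≤ : ∀ {x y a b} → ∣ x ∣ ≤ a → ∣ y ∣ ≤ b → ∣ x + y ∣ ≤ a + b
  ∣+∣≤ {x} {y} p q = ≤-trans (∣p+q∣≤∣p∣+∣q∣ x y) (+-mono-≤ p q)

  ∣*∣≤ : ∀ {x y a b} → ∣ x ∣ ≤ a → ∣ y ∣ ≤ b → ∣ x * y ∣ ≤ a * b
  ∣*∣≤ {x} {y} p q = subst (_≤ _) (sym (∣p*q∣≡∣p∣*∣q∣ x y)) (*-mono-≤ (0≤∣p∣ x) p (0≤∣p∣ y) q)

  ∣x∣∣x∣≡xx : ∀ x → ∣ x ∣ * ∣ x ∣ ≡ x * x
  ∣x∣∣x∣≡xx x with ∣p∣≡p∨∣p∣≡-p x
  ... | inj₁ e = cong₂ _*_ e e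
  ... | inj₂ e = trans (cong₂ _*_ e e) (lemma x)
    where
    lemma : ∀ x → (- x) * (- x) ≡ x * x
    lemma = solve-∀ ℚ-ring

  0≤xx : ∀ x → 0ℚ ≤ x * x
  0≤xx x = subst (0ℚ ≤_) (∣x∣∣x∣≡xx x) (0≤* (0≤∣p∣ x) (0≤∣p∣ x))

  *-cancelˡ-≡0 : ∀ {x y} → x ≢ 0ℚ → x * y ≡ 0ℚ → y ≡ 0ℚ
  *-cancelˡ-≡0 {x} {y} x≢0 e = begin
    y                    ≡⟨ sym (*-identityˡ y) ⟩
    1ℚ * y               ≡⟨ cong (_* y) (sym (*-inverseˡ x)) ⟩
    ((1/ x) * x) * y     ≡⟨ *-assoc (1/ x) x y ⟩
    (1/ x) * (x * y)     ≡⟨ cong ((1/ x) *_) e ⟩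
    (1/ x) * 0ℚ          ≡⟨ *-zeroʳ (1/ x) ⟩
    0ℚ                   ∎
    where
    open ≡-Reasoning
    instance _ = ≢-nonZero x≢0

  xx≡0⇒x≡0 : ∀ x → x * x ≡ 0ℚ → x ≡ 0ℚ
  xx≡0⇒x≡0 x e with x ≟ 0ℚ
  ... | yes p = p
  ... | no ¬p = *-cancelˡ-≡0 ¬p e

  inverse : ∀ {x} → x ≢ 0ℚ → ∃ λ y → x * y ≡ 1ℚ
  inverse {x} x≢0 = 1/ x , *-inverseʳ x
    where instance _ = ≢-nonZero x≢0

  inverse⁺ : ∀ {x} → 0ℚ < x → ∃ λ y → x * y ≡ 1ℚ × 0ℚ < y
  inverse⁺ {x} 0<x = 1/ x , *-inverseʳ x , positive⁻¹ (1/ x) {{1/pos⇒pos x}}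
    where instance
    _ = positive 0<x
    _ = pos⇒nonZero x

  -- Integers as rational numbers

  opaque
    ι : ℤ → ℚ
    ι z = z / 1

    toℚᵘ-ι : ∀ z → toℚᵘ (ι z) ℚᵘ.≃ ℚᵘ.mkℚᵘ z 0
    toℚᵘ-ι z = toℚᵘ-fromℚᵘ (ℚᵘ.mkℚᵘ z 0)

    ι-+ : ∀ x y → ι (x ℤ.+ y) ≡ ι x + ι y
    ι-+ x y = toℚᵘ-injective (begin-equality
      toℚᵘ (ι (x ℤ.+ y))                 ≃⟨ toℚᵘ-ι (x ℤ.+ y) ⟩
      ℚᵘ.mkℚᵘ (x ℤ.+ y) 0                ≃⟨ ℚᵘ.*≡* (cong (ℤ._* ℤ.+ 1) (sym (cong₂ ℤ._+_ (ℤₚ.*-identityʳ x) (ℤₚ.*-identityʳ y)))) ⟩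
      ℚᵘ.mkℚᵘ x 0 ℚᵘ.+ ℚᵘ.mkℚᵘ y 0       ≃⟨ ℚᵘₚ.+-cong (toℚᵘ-ι x) (toℚᵘ-ι y) ⟨
      toℚᵘ (ι x) ℚᵘ.+ toℚᵘ (ι y)         ≃⟨ toℚᵘ-homo-+ (ι x) (ι y) ⟨
      toℚᵘ (ι x + ι y)                   ∎)
      where open ℚᵘₚ.≤-Reasoning

    ι-* : ∀ x y → ι (x ℤ.* y) ≡ ι x * ι y
    ι-* x y = toℚᵘ-injective (begin-equality
      toℚᵘ (ι (x ℤ.* y))                 ≃⟨ toℚᵘ-ι (x ℤ.* y) ⟩
      ℚᵘ.mkℚᵘ x 0 ℚᵘ.* ℚᵘ.mkℚᵘ y 0       ≃⟨ ℚᵘₚ.*-cong (toℚᵘ-ι x) (toℚᵘ-ι y) ⟨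
      toℚᵘ (ι x) ℚᵘ.* toℚᵘ (ι y)         ≃⟨ toℚᵘ-homo-* (ι x) (ι y) ⟨
      toℚᵘ (ι x * ι y)                   ∎)
      where open ℚᵘₚ.≤-Reasoning

    ι-neg : ∀ x → ι (ℤ.- x) ≡ - ι x
    ι-neg (ℤ.+ zero)  = refl
    ι-neg (ℤ.+ suc n) = refl
    ι-neg ℤ.-[1+ n ]  = sym (neg-involutive′ _)
      where
      neg-involutive′ : ∀ x → - (- x) ≡ x
      neg-involutive′ = solve-∀ ℚ-ring

    ι-mono-≤ : ∀ {x y} → x ℤ.≤ y → ι x ≤ ι y
    ι-mono-≤ {x} {y} p = toℚᵘ-cancel-≤ (begin
      toℚᵘ (ι x)    ≃⟨ toℚᵘ-ι x ⟩
      ℚᵘ.mkℚᵘ x 0   ≤⟨ ℚᵘ.*≤* (ℤₚ.*-monoʳ-≤-nonNeg (ℤ.+ 1) p) ⟩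
      ℚᵘ.mkℚᵘ y 0   ≃⟨ toℚᵘ-ι y ⟨
      toℚᵘ (ι y)    ∎)
      where open ℚᵘₚ.≤-Reasoning

    ι-injective : ∀ {x y} → ι x ≡ ι y → x ≡ y
    ι-injective {x} {y} e = begin
      x              ≡⟨ sym (ℤₚ.*-identityʳ x) ⟩
      x ℤ.* ℤ.+ 1      ≡⟨ ℚᵘₚ.drop-*≡* (fromℚᵘ-injective {ℚᵘ.mkℚᵘ x 0} {ℚᵘ.mkℚᵘ y 0} e) ⟩
      y ℤ.* ℤ.+ 1      ≡⟨ ℤₚ.*-identityʳ y ⟩
      y              ∎
      where open ≡-Reasoning

    ι-0 : ι (ℤ.+ 0) ≡ 0ℚ
    ι-0 = refl

    ι-1 : ι (ℤ.+ 1) ≡ 1ℚ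
    ι-1 = refl

  nat : ℕ → ℚ
  nat n = ι (ℤ.+ n)

  nat-+ : ∀ m n → nat (m ℕ.+ n) ≡ nat m + nat n
  nat-+ m n = ι-+ (ℤ.+ m) (ℤ.+ n)

  nat-suc : ∀ n → nat (suc n) ≡ 1ℚ + nat n
  nat-suc n = trans (nat-+ 1 n) (cong (_+ nat n) ι-1)

  nat-* : ∀ m n → nat (m ℕ.* n) ≡ nat m * nat n
  nat-* m n = trans (cong ι (ℤₚ.pos-* m n)) (ι-* (ℤ.+ m) (ℤ.+ n))

  nat-mono : ∀ {m n} → m ℕ.≤ n → nat m ≤ nat n
  nat-mono p = ι-mono-≤ (ℤ.+≤+ p)

  0≤nat : ∀ n → 0ℚ ≤ nat n
  0≤nat n = subst (_≤ nat n) ι-0 (nat-mono {0} {n} z≤n)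

  1≤nat : ∀ {n} → 0 ℕ.< n → 1ℚ ≤ nat n
  1≤nat {n} p = subst (_≤ nat n) ι-1 (nat-mono p)

  0<nat : ∀ {n} → 0 ℕ.< n → 0ℚ < nat n
  0<nat p = <-≤-trans 0<1 (1≤nat p)

  IsInt : ℚ → Set
  IsInt x = ∃ λ z → x ≡ ι z

  int-+ : ∀ {x y} → IsInt x → IsInt y → IsInt (x + y)
  int-+ (a , refl) (b , refl) = a ℤ.+ b , sym (ι-+ a b)

  int-* : ∀ {x y} → IsInt x → IsInt y → IsInt (x * y)
  int-* (a , refl) (b , refl) = a ℤ.* b , sym (ι-* a b)

  int-neg : ∀ {x} → IsInt x → IsInt (- x)
  int-neg (a , refl) = ℤ.- a , sym (ι-neg a)

  int-sum : ∀ {n} {f : Vector ℚ n} → (∀ i → IsInt (f i)) → IsInt (sum f)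
  int-sum {zero}  p = ℤ.+ 0 , sym ι-0
  int-sum {suc n} p = int-+ (p zero) (int-sum (p ∘ suc))

  int-nat : ∀ n → IsInt (nat n)
  int-nat n = ℤ.+ n , refl

  -- The passage from short to isotropic: it is applied to the value of the form on a very short
  -- integral vector. It also identifies an integral matrix entry with its code.
  int-∣∣<1 : ∀ {x} → IsInt x → ∣ x ∣ < 1ℚ → x ≡ 0ℚ
  int-∣∣<1 {x} (ℤ.+ zero , refl) p = ι-0
  int-∣∣<1 {x} (ℤ.+ suc n , refl) p = contradiction
    (<-≤-trans p (≤-trans (1≤nat {suc n} (s≤s z≤n)) (x≤∣x∣ x))) (<-irrefl refl)
  int-∣∣<1 {x} (ℤ.-[1+ n ] , refl) p = contradiction
    (<-≤-trans p (≤-trans (1≤nat {suc n} (s≤s z≤n))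
      (subst (_≤ ∣ x ∣) (sym (ι-neg ℤ.-[1+ n ])) (-x≤∣x∣ x)))) (<-irrefl refl)

  denominator* : ∀ x → nat (↧ₙ x) * x ≡ ι (↥ x)
  denominator* x = toℚᵘ-injective (begin-equality
    toℚᵘ (nat (↧ₙ x) * x)                 ≃⟨ toℚᵘ-homo-* (nat (↧ₙ x)) x ⟩
    toℚᵘ (nat (↧ₙ x)) ℚᵘ.* toℚᵘ x         ≃⟨ ℚᵘₚ.*-congʳ (toℚᵘ-ι (↧ x)) ⟩
    ℚᵘ.mkℚᵘ (↧ x) 0 ℚᵘ.* toℚᵘ x           ≃⟨ lemma x ⟩
    ℚᵘ.mkℚᵘ (↥ x) 0                       ≃⟨ toℚᵘ-ι (↥ x) ⟨
    toℚᵘ (ι (↥ x))                        ∎)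
    where
    open ℚᵘₚ.≤-Reasoning
    lemma : ∀ x → ℚᵘ.mkℚᵘ (↧ x) 0 ℚᵘ.* toℚᵘ x ℚᵘ.≃ ℚᵘ.mkℚᵘ (↥ x) 0
    lemma x@record{} = ℚᵘ.*≡* (trans (ℤₚ.*-identityʳ _) (trans (ℤₚ.*-comm (↧ x) (↥ x))
      (cong (↥ x ℤ.*_) (sym (ℤₚ.*-identityˡ (↧ x))))))

  /-* : ∀ z q .{{_ : ℕ.NonZero q}} → nat q * (z / q) ≡ ι z
  /-* z q@(suc q-1) = toℚᵘ-injective (begin-equality
    toℚᵘ (nat q * (z / q))                ≃⟨ toℚᵘ-homo-* (nat q) (z / q) ⟩
    toℚᵘ (nat q) ℚᵘ.* toℚᵘ (z / q)        ≃⟨ ℚᵘₚ.*-cong (toℚᵘ-ι (ℤ.+ q)) (toℚᵘ-fromℚᵘ (ℚᵘ.mkℚᵘ z q-1)) ⟩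
    ℚᵘ.mkℚᵘ (ℤ.+ q) 0 ℚᵘ.* ℚᵘ.mkℚᵘ z q-1    ≃⟨ ℚᵘ.*≡* (trans (ℤₚ.*-identityʳ _) (trans (ℤₚ.*-comm (ℤ.+ q) z)
      (cong (z ℤ.*_) (sym (ℤₚ.*-identityˡ (ℤ.+ q)))))) ⟩
    ℚᵘ.mkℚᵘ z 0                           ≃⟨ toℚᵘ-ι z ⟨
    toℚᵘ (ι z)                            ∎)
    where open ℚᵘₚ.≤-Reasoning

  opaque
    archimedean : ∀ x → ∃ λ n → x < nat n
    archimedean x = suc n , (begin-strict
      x                    ≤⟨ x≤∣x∣ x ⟩
      y                    ≡⟨ sym (*-identityˡ y) ⟩
      1ℚ * y               ≤⟨ *-monoʳ-≤-nonNeg y {{nonNegative (0≤∣p∣ x)}} (1≤nat {↧ₙ y} (s≤s z≤n)) ⟩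
      nat (↧ₙ y) * y       ≡⟨ denominator* y ⟩
      ι (↥ y)              ≤⟨ ι-mono-≤ (z≤∣z∣ (↥ y)) ⟩
      nat n                <⟨ by-< 0<1 (trans (cong (_- nat n) (nat-suc n)) (1+x-x≡1 (nat n))) ⟩
      nat (suc n)          ∎)
      where
      open ≤-Reasoning
      y : ℚ
      y = ∣ x ∣
      n : ℕ
      n = ℤ.∣ ↥ y ∣
      z≤∣z∣ : ∀ z → z ℤ.≤ ℤ.+ ℤ.∣ z ∣
      z≤∣z∣ (ℤ.+ n)    = ℤₚ.≤-refl
      z≤∣z∣ ℤ.-[1+ n ] = ℤ.-≤+

  -- Boxes, sums and linear functionals

  opaque
    box : ∀ m {x} → 0ℚ ≤ x → x < nat m →
      ∃ λ (k : Fin m) → nat (toℕ k) ≤ x × x < 1ℚ + nat (toℕ k)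
    box zero    0≤x x<0 = contradiction (≤-<-trans 0≤x x<0) (<-irrefl (sym ι-0))
    box (suc m) {x} 0≤x x<1+m with x <? nat m
    ... | yes x<m = let k , k≤x , x<1+k = box m 0≤x x<m in
      inject₁ k , subst (λ l → nat l ≤ x × x < 1ℚ + nat l) (sym (Finₚ.toℕ-inject₁ k)) (k≤x , x<1+k)
    ... | no x≮m = fromℕ m , subst (λ l → nat l ≤ x × x < 1ℚ + nat l) (sym (Finₚ.toℕ-fromℕ m))
      (≮⇒≥ x≮m , subst (x <_) (nat-suc m) x<1+m)

    -- For a natural number `m` above `∣ x ∣`, the difference `m - x` lies between 0 and `2m`; if
    -- `k` is its integral part, `m - k` is the ceiling of `x`.
    ceil : ∀ x → ∃ λ c → IsInt c × 0ℚ ≤ c - x × c - x < 1ℚ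
    ceil x = nat m - nat (toℕ k) ,
      int-+ (int-nat m) (int-neg (int-nat (toℕ k))) ,
      subst (0ℚ ≤_) (regroup (nat m) x (nat (toℕ k))) (0≤y-x k≤) ,
      subst₂ _<_ (regroup (nat m) x (nat (toℕ k))) (1+x-x≡1 (nat (toℕ k))) (+-monoˡ-< (- nat (toℕ k)) <k)
      where
      m : ℕ
      m = proj₁ (archimedean ∣ x ∣)
      ∣x∣<m : ∣ x ∣ < nat m
      ∣x∣<m = proj₂ (archimedean ∣ x ∣)
      lower : 0ℚ ≤ nat m - x
      lower = 0≤y-x (≤-trans (x≤∣x∣ x) (<⇒≤ ∣x∣<m))
      upper : nat m - x < nat (m ℕ.+ m)
      upper = subst (nat m - x <_) (sym (nat-+ m m))
        (+-monoʳ-< (nat m) (≤-<-trans (-x≤∣x∣ x) ∣x∣<m))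
      k : Fin (m ℕ.+ m)
      k = proj₁ (box (m ℕ.+ m) lower upper)
      k≤ : nat (toℕ k) ≤ nat m - x
      k≤ = proj₁ (proj₂ (box (m ℕ.+ m) lower upper))
      <k : nat m - x < 1ℚ + nat (toℕ k)
      <k = proj₂ (proj₂ (box (m ℕ.+ m) lower upper))
      regroup : ∀ m x k → (m - x) - k ≡ (m - k) - x
      regroup = solve-∀ ℚ-ring

  0≤sum : ∀ {n} {f : Vector ℚ n} → (∀ i → 0ℚ ≤ f i) → 0ℚ ≤ sum f
  0≤sum {zero}  p = ≤-refl
  0≤sum {suc n} p = 0≤+ (p zero) (0≤sum (p ∘ suc))

  sum-zero : ∀ {n} {f : Vector ℚ n} → (∀ i → f i ≡ 0ℚ) → sum f ≡ 0ℚ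
  sum-zero {n} p = trans (sum-cong-≗ p) (sum-replicate-zero n)

  sum-mono : ∀ {n} {f g : Vector ℚ n} → (∀ i → f i ≤ g i) → sum f ≤ sum g
  sum-mono {zero}  p = ≤-refl
  sum-mono {suc n} p = +-mono-≤ (p zero) (sum-mono (p ∘ suc))

  sum-const : ∀ n c → sum {n} (λ _ → c) ≡ nat n * c
  sum-const zero    c = sym (trans (cong (_* c) ι-0) (*-zeroˡ c))
  sum-const (suc n) c = trans (cong (c +_) (sum-const n c))
    (trans (lemma c (nat n)) (cong (_* c) (sym (nat-suc n))))
    where
    lemma : ∀ c k → c + k * c ≡ (1ℚ + k) * c
    lemma = solve-∀ ℚ-ring

  ∣sum∣≤ : ∀ {n} {f g : Vector ℚ n} → (∀ i → ∣ f i ∣ ≤ g i) → ∣ sum f ∣ ≤ sum g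
  ∣sum∣≤ {zero}  p = ≤-refl
  ∣sum∣≤ {suc n} p = ∣+∣≤ (p zero) (∣sum∣≤ (p ∘ suc))

  ∣sum∣≤const : ∀ {n} {f : Vector ℚ n} {c} → (∀ i → ∣ f i ∣ ≤ c) → ∣ sum f ∣ ≤ nat n * c
  ∣sum∣≤const {n} {c = c} p = subst (_ ≤_) (sum-const n c) (∣sum∣≤ p)

  term≤sum : ∀ {n} {f : Vector ℚ n} → (∀ i → 0ℚ ≤ f i) → ∀ i → f i ≤ sum f
  term≤sum {f = f} p zero    = subst (_≤ sum f) (+-identityʳ (f zero)) (+-monoʳ-≤ (f zero) (0≤sum (p ∘ suc)))
  term≤sum {f = f} p (suc i) = subst (_≤ sum f) (+-identityˡ (f (suc i))) (+-mono-≤ (p zero) (term≤sum (p ∘ suc) i))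

  sum≡0⇒≡0 : ∀ {n} {f : Vector ℚ n} → (∀ i → 0ℚ ≤ f i) → sum f ≡ 0ℚ → ∀ i → f i ≡ 0ℚ
  sum≡0⇒≡0 p e i = ≤-antisym (≤-trans (term≤sum p i) (≤-reflexive e)) (p i)

  sum-‿- : ∀ {n} (f g : Vector ℚ n) → sum (λ i → f i - g i) ≡ sum f - sum g
  sum-‿- {zero}  f g = refl
  sum-‿- {suc n} f g = trans (cong (f zero - g zero +_) (sum-‿- (f ∘ suc) (g ∘ suc)))
    (lemma (f zero) (g zero) (sum (f ∘ suc)) (sum (g ∘ suc)))
    where
    lemma : ∀ a b c d → a - b + (c - d) ≡ a + c - (b + d)
    lemma = solve-∀ ℚ-ring

  bounded : ∀ {n} (f : Vector ℚ n) → ∃ λ b → ∀ i → ∣ f i ∣ ≤ nat b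
  bounded f = proj₁ (archimedean s) , λ i →
    ≤-trans (term≤sum (0≤∣p∣ ∘ f) i) (<⇒≤ (proj₂ (archimedean s)))
    where s = sum (∣_∣ ∘ f)

  opaque
    argmax : ∀ {n} (f : Vector ℚ (suc n)) → ∃ λ i → ∀ j → f j ≤ f i
    argmax {zero}  f = zero , λ { zero → ≤-refl }
    argmax {suc n} f with argmax (f ∘ suc)
    ... | i , max with ≤-total (f zero) (f (suc i))
    ...   | inj₁ p = suc i , λ { zero → p ; (suc j) → max j }
    ...   | inj₂ p = zero , λ { zero → ≤-refl ; (suc j) → ≤-trans (max j) p }

    clearDenominators : ∀ {n} (c : Vector ℚ n) → ∃ λ N → IsInt N × N ≢ 0ℚ × (∀ i → IsInt (N * c i))
    clearDenominators {zero}  c = 1ℚ , (ℤ.+ 1 , sym ι-1) , (λ ()) , λ ()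
    clearDenominators {suc n} c =
      let N , intN , N≢0 , intNc = clearDenominators (c ∘ suc)
          D = nat (↧ₙ (c zero))
          0<D : 0ℚ < D
          0<D = 0<nat {↧ₙ (c zero)} (s≤s z≤n)
      in  D * N , int-* (int-nat (↧ₙ (c zero))) intN ,
          (λ e → N≢0 (*-cancelˡ-≡0 (λ e → <⇒≢ 0<D (sym e)) e)) ,
          λ { zero    → subst IsInt (lemma D N (c zero)) (int-* intN (↥ c zero , denominator* (c zero)))
            ; (suc i) → subst IsInt (sym (*-assoc D N (c (suc i)))) (int-* (int-nat (↧ₙ (c zero))) (intNc i)) }
      where
      lemma : ∀ D N x → N * (D * x) ≡ D * N * x
      lemma = solve-∀ ℚ-ring

  record IsLinear {d} (L : Vector ℚ d → ℚ) : Set where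
    field
      ≗-cong : ∀ {u v} → u ≗ v → L u ≡ L v
      +-homo : ∀ u v → L (λ k → u k + v k) ≡ L u + L v
      *-homo : ∀ c u → L (λ k → c * u k) ≡ c * L u

  open IsLinear public

  module _ {d} {L : Vector ℚ d → ℚ} (lin : IsLinear L) where

    -‿homo : ∀ u v → L (λ k → u k - v k) ≡ L u - L v
    -‿homo u v = begin
      L (λ k → u k - v k)              ≡⟨ ≗-cong lin (λ k → minus (u k) (v k)) ⟩
      L (λ k → u k + - 1ℚ * v k)       ≡⟨ +-homo lin u (λ k → - 1ℚ * v k) ⟩
      L u + L (λ k → - 1ℚ * v k)       ≡⟨ cong (L u +_) (*-homo lin (- 1ℚ) v) ⟩
      L u + - 1ℚ * L v                 ≡⟨ sym (minus (L u) (L v)) ⟩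
      L u - L v                        ∎
      where
      open ≡-Reasoning
      minus : ∀ x y → x - y ≡ x + - 1ℚ * y
      minus = solve-∀ ℚ-ring

    0-homo : L (λ _ → 0ℚ) ≡ 0ℚ
    0-homo = trans (≗-cong lin (λ _ → sym (*-zeroˡ 0ℚ))) (trans (*-homo lin 0ℚ (λ _ → 0ℚ)) (*-zeroˡ (L (λ _ → 0ℚ))))

    sum-homo : ∀ {m} (c : Vector ℚ m) (x : Fin m → Vector ℚ d) →
      L (λ k → sum (λ i → c i * x i k)) ≡ sum (λ i → c i * L (x i))
    sum-homo {zero}  c x = 0-homo
    sum-homo {suc m} c x = trans (+-homo lin (λ k → c zero * x zero k) (λ k → sum (λ i → c (suc i) * x (suc i) k)))
      (cong₂ _+_ (*-homo lin (c zero) (x zero)) (sum-homo (c ∘ suc) (x ∘ suc)))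

    ∣sum-homo∣≤ : ∀ {m} {c : Vector ℚ m} {x : Fin m → Vector ℚ d} {a b} →
      (∀ i → ∣ c i ∣ ≤ a) → (∀ i → ∣ L (x i) ∣ ≤ b) →
      ∣ L (λ k → sum (λ i → c i * x i k)) ∣ ≤ nat m * (a * b)
    ∣sum-homo∣≤ {c = c} {x} p q = subst (λ s → ∣ s ∣ ≤ _) (sym (sum-homo c x))
      (∣sum∣≤const (λ i → ∣*∣≤ (p i) (q i)))

  coord-linear : ∀ {d} (k : Fin d) → IsLinear (λ v → v k)
  coord-linear k = record
    { ≗-cong = λ e → e k ; +-homo = λ _ _ → refl ; *-homo = λ _ _ → refl }

  zero-linear : ∀ {d} → IsLinear {d} (λ _ → 0ℚ)
  zero-linear = record
    { ≗-cong = λ _ → refl ; +-homo = λ _ _ → refl ; *-homo = λ c _ → sym (*-zeroʳ c) }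

  scale-linear : ∀ {d} {L : Vector ℚ d → ℚ} a → IsLinear L → IsLinear (λ v → a * L v)
  scale-linear {L = L} a lin = record
    { ≗-cong = λ e → cong (a *_) (≗-cong lin e)
    ; +-homo = λ u v → trans (cong (a *_) (+-homo lin u v)) (*-distribˡ-+ a (L u) (L v))
    ; *-homo = λ c u → trans (cong (a *_) (*-homo lin c u)) (swap a c (L u)) }
    where
    swap : ∀ a c x → a * (c * x) ≡ c * (a * x)
    swap = solve-∀ ℚ-ring

  -‿linear : ∀ {d} {L M : Vector ℚ d → ℚ} → IsLinear L → IsLinear M → IsLinear (λ v → L v - M v)
  -‿linear {L = L} {M} l m = record
    { ≗-cong = λ e → cong₂ _-_ (≗-cong l e) (≗-cong m e)
    ; +-homo = λ u v → trans (cong₂ _-_ (+-homo l u v) (+-homo m u v)) (swap (L u) (L v) (M u) (M v))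
    ; *-homo = λ c u → trans (cong₂ _-_ (*-homo l c u) (*-homo m c u)) (distrib c (L u) (M u)) }
    where
    swap : ∀ a b c d → a + b - (c + d) ≡ (a - c) + (b - d)
    swap = solve-∀ ℚ-ring
    distrib : ∀ c x y → c * x - c * y ≡ c * (x - y)
    distrib = solve-∀ ℚ-ring

  sum-linear : ∀ {d n} {L : Fin n → Vector ℚ d → ℚ} → (∀ j → IsLinear (L j)) →
    IsLinear (λ v → sum (λ j → L j v))
  sum-linear {L = L} lin = record
    { ≗-cong = λ e → sum-cong-≗ (λ j → ≗-cong (lin j) e)
    ; +-homo = λ u v → trans (sum-cong-≗ (λ j → +-homo (lin j) u v)) (∑-distrib-+ (λ j → L j u) (λ j → L j v))
    ; *-homo = λ c u → trans (sum-cong-≗ (λ j → *-homo (lin j) c u)) (sym (*-distribˡ-sum c (λ j → L j u))) }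

  -- The light cone in the coordinates adapted to a point near the sphere

  represent : ∀ {d} {L : Vector ℚ d → ℚ} → IsLinear L →
    ∃ λ (y : Vector ℚ d) → ∀ v → L v ≡ sum (λ k → y k * v k)
  represent {zero}  lin = (λ ()) , λ v → trans (≗-cong lin (λ ())) (0-homo lin)
  represent {suc d} {L} lin = y⁺ , λ v → begin
    L v                                        ≡⟨ ≗-cong lin (split v) ⟩
    L (λ k → v zero * e₀ k + (0ℚ ∷ v ∘ suc) k) ≡⟨ +-homo lin (λ k → v zero * e₀ k) (0ℚ ∷ v ∘ suc) ⟩
    L (λ k → v zero * e₀ k) + L (0ℚ ∷ v ∘ suc)
      ≡⟨ cong₂ _+_ (trans (*-homo lin (v zero) e₀) (*-comm (v zero) (L e₀))) (L≡ (v ∘ suc)) ⟩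
    L e₀ * v zero + sum (λ k → y k * v (suc k)) ∎
    where
    open ≡-Reasoning
    e₀ : Vector ℚ (suc d)
    e₀ = 1ℚ ∷ λ _ → 0ℚ
    tail-linear : IsLinear (λ w → L (0ℚ ∷ w))
    tail-linear = record
      { ≗-cong = λ e → ≗-cong lin λ { zero → refl ; (suc k) → e k }
      ; +-homo = λ u v → trans (≗-cong lin λ { zero → refl ; (suc k) → refl }) (+-homo lin (0ℚ ∷ u) (0ℚ ∷ v))
      ; *-homo = λ c u → trans (≗-cong lin λ { zero → sym (*-zeroʳ c) ; (suc k) → refl }) (*-homo lin c (0ℚ ∷ u)) }
    y : Vector ℚ d
    y = proj₁ (represent tail-linear)
    y⁺ : Vector ℚ (suc d)
    y⁺ = L e₀ ∷ y
    L≡ = proj₂ (represent tail-linear)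
    split : ∀ v k → v k ≡ v zero * e₀ k + (0ℚ ∷ v ∘ suc) k
    split v zero    = lemma (v zero)
      where
      lemma : ∀ x → x ≡ x * 1ℚ + 0ℚ
      lemma = solve-∀ ℚ-ring
    split v (suc k) = lemma (v zero) (v (suc k))
      where
      lemma : ∀ x y → y ≡ x * 0ℚ + y
      lemma = solve-∀ ℚ-ring

  -- Solving the relation for `x k` divides by the largest coefficient, so no ratio of coefficients
  -- exceeds 1. It recovers the error that the frame omits, and later the frame coordinate that the
  -- pigeonhole leaves free.
  dominant-bound : ∀ {n} (c x : Vector ℚ (suc n)) k {η} → (∀ j → ∣ c j ∣ ≤ ∣ c k ∣) → c k ≢ 0ℚ →
    sum (λ j → c j * x j) ≡ 0ℚ → (∀ j → ∣ x (punchIn k j) ∣ ≤ η) → ∣ x k ∣ ≤ nat n * η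
  dominant-bound {n} c x k {η} max cₖ≢0 relation bound = *-cancelˡ-≤ 0<∣cₖ∣ (begin
    ∣ c k ∣ * ∣ x k ∣       ≡⟨ sym (∣p*q∣≡∣p∣*∣q∣ (c k) (x k)) ⟩
    ∣ c k * x k ∣           ≡⟨ cong ∣_∣ (isolate _ _ (trans (sym (sum-remove {i = k} (λ j → c j * x j))) relation)) ⟩
    ∣ - rest ∣              ≡⟨ ∣-p∣≡∣p∣ rest ⟩
    ∣ rest ∣                ≤⟨ ∣sum∣≤const (λ j → ∣*∣≤ (max (punchIn k j)) (bound j)) ⟩
    nat n * (∣ c k ∣ * η)   ≡⟨ swap (nat n) ∣ c k ∣ η ⟩
    ∣ c k ∣ * (nat n * η)   ∎)
    where
    open ≤-Reasoning
    rest = sum (λ j → c (punchIn k j) * x (punchIn k j))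
    0<∣cₖ∣ : 0ℚ < ∣ c k ∣
    0<∣cₖ∣ = ≰⇒> λ p → cₖ≢0 (∣p∣≡0⇒p≡0 (c k) (≤-antisym p (0≤∣p∣ (c k))))
    swap : ∀ a b c → a * (b * c) ≡ b * (a * c)
    swap = solve-∀ ℚ-ring
    isolate : ∀ x y → x + y ≡ 0ℚ → x ≡ - y
    isolate x y e = trans (lemma x y) (trans (cong (_- y) e) (+-identityˡ (- y)))
      where
      lemma : ∀ x y → x ≡ x + y - y
      lemma = solve-∀ ℚ-ring

  -- Here `τ` is the parameter T and `σ` its inverse. `near` replaces the equation of the sphere for
  -- the rational vector `a`. That the first coordinate dominates will be arranged by a permutation.
  module Geometry (n : ℕ) (a : Vector ℚ (suc n)) (τ σ : ℚ)
    (0<τ : 0ℚ < τ) (0<σ : 0ℚ < σ) (τσ≡1 : τ * σ ≡ 1ℚ)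
    (near : (τ * τ) * ∣ sum (λ j → a j * a j) - 1ℚ ∣ ≤ 1ℚ)
    (a₀-max : ∀ j → ∣ a j ∣ ≤ ∣ a zero ∣)
    (σ≤∣a₀∣ : σ ≤ ∣ a zero ∣) where

    V : Set
    V = Vector ℚ (suc (suc n))

    err : Fin (suc n) → V → ℚ
    err j v = v (suc j) - a j * v zero

    height : V → ℚ
    height v = sum (λ j → a j * err j v)

    form : V → V → ℚ
    form u v = sum (λ j → u (suc j) * v (suc j)) - u zero * v zero

    -- The factor `τ` by which `v zero` may grow is the one by which `height v` has to shrink, so
    -- that their product, which is what enters the form, is bounded independently of `τ`.
    record Size (r : ℚ) (v : V) : Set where
      constructor mkSize
      field
        zero-≤   : ∣ v zero ∣ ≤ τ * r
        err-≤    : ∀ j → ∣ err j v ∣ ≤ r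
        height-≤ : ∣ τ * height v ∣ ≤ r
    open Size public

    Integral : V → Set
    Integral v = ∀ k → IsInt (v k)

    Isotropic : ℚ → Set
    Isotropic r = ∃ λ v → Integral v × Size r v × ¬ (∀ k → v k ≡ 0ℚ) × form v v ≡ 0ℚ

    err-linear : ∀ j → IsLinear (err j)
    err-linear j = -‿linear (coord-linear (suc j)) (scale-linear (a j) (coord-linear zero))

    height-linear : IsLinear height
    height-linear = sum-linear (λ j → scale-linear (a j) (err-linear j))

    form-linear : ∀ u → IsLinear (form u)
    form-linear u = -‿linear (sum-linear (λ j → scale-linear (u (suc j)) (coord-linear (suc j))))
      (scale-linear (u zero) (coord-linear zero))

    form-comm : ∀ u v → form u v ≡ form v u
    form-comm u v = cong₂ _-_ (sum-cong-≗ (λ j → *-comm (u (suc j)) (v (suc j)))) (*-comm (u zero) (v zero))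

    integral-form : ∀ {u v} → Integral u → Integral v → IsInt (form u v)
    integral-form p q = int-+ (int-sum (λ j → int-* (p (suc j)) (q (suc j)))) (int-neg (int-* (p zero) (q zero)))

    size-nonneg : ∀ {r v} → Size r v → 0ℚ ≤ r
    size-nonneg s = ≤-trans (0≤∣p∣ _) (height-≤ s)

    s : ℚ
    s = sum (λ j → a j * a j)

    -- Substituting p = e + q a in p · p′ − q q′.
    form-expansion : ∀ u v → form u v ≡
      u zero * v zero * (s - 1ℚ) + u zero * height v + v zero * height u + sum (λ j → err j u * err j v)
    form-expansion u v = begin
      sum (λ j → u (suc j) * v (suc j)) - u₀ * v₀
        ≡⟨ cong (λ x → x - u₀ * v₀) (sum-cong-≗ (λ j → pointwise (a j) u₀ v₀ (u (suc j)) (v (suc j)))) ⟩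
      sum (λ j → f₁ j + f₂ j + f₃ j + f₄ j) - u₀ * v₀
        ≡⟨ cong (λ x → x - u₀ * v₀) sum₄ ⟩
      u₀ * v₀ * s + u₀ * height v + v₀ * height u + sum f₄ - u₀ * v₀
        ≡⟨ collect u₀ v₀ s (height v) (height u) (sum f₄) ⟩
      u₀ * v₀ * (s - 1ℚ) + u₀ * height v + v₀ * height u + sum f₄ ∎
      where
      open ≡-Reasoning
      u₀ = u zero
      v₀ = v zero
      f₁ f₂ f₃ f₄ : Fin (suc n) → ℚ
      f₁ j = u₀ * v₀ * (a j * a j)
      f₂ j = u₀ * (a j * err j v)
      f₃ j = v₀ * (a j * err j u)
      f₄ j = err j u * err j v
      pointwise : ∀ a x y p q → p * q ≡
        x * y * (a * a) + x * (a * (q - a * y)) + y * (a * (p - a * x)) + (p - a * x) * (q - a * y)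
      pointwise = solve-∀ ℚ-ring
      sum₄ : sum (λ j → f₁ j + f₂ j + f₃ j + f₄ j) ≡ u₀ * v₀ * s + u₀ * height v + v₀ * height u + sum f₄
      sum₄ = trans (∑-distrib-+ (λ j → f₁ j + f₂ j + f₃ j) f₄) (cong (_+ sum f₄)
        (trans (∑-distrib-+ (λ j → f₁ j + f₂ j) f₃) (cong₂ _+_
          (trans (∑-distrib-+ f₁ f₂) (cong₂ _+_
            (sym (*-distribˡ-sum (u₀ * v₀) (λ j → a j * a j)))
            (sym (*-distribˡ-sum u₀ (λ j → a j * err j v)))))
          (sym (*-distribˡ-sum v₀ (λ j → a j * err j u))))))
      collect : ∀ x y s h g e → x * y * s + x * h + y * g + e - x * y ≡ x * y * (s - 1ℚ) + x * h + y * g + e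
      collect = solve-∀ ℚ-ring

    ∣zero*height∣≤ : ∀ {r r′ u v} → Size r u → Size r′ v → ∣ u zero * height v ∣ ≤ r * r′
    ∣zero*height∣≤ {r} {r′} {u} {v} su sv = begin
      ∣ u zero * height v ∣              ≤⟨ ∣*∣≤ (zero-≤ su) (≤-refl {∣ height v ∣}) ⟩
      τ * r * ∣ height v ∣               ≡⟨ shuffle τ r ∣ height v ∣ ⟩
      r * (τ * ∣ height v ∣)             ≡⟨ cong (λ t → r * (t * ∣ height v ∣)) (sym (0≤p⇒∣p∣≡p (<⇒≤ 0<τ))) ⟩
      r * (∣ τ ∣ * ∣ height v ∣)         ≡⟨ cong (r *_) (sym (∣p*q∣≡∣p∣*∣q∣ τ (height v))) ⟩
      r * ∣ τ * height v ∣               ≤⟨ *-monoˡ (size-nonneg su) (height-≤ sv) ⟩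
      r * r′                             ∎
      where
      open ≤-Reasoning
      shuffle : ∀ t r h → t * r * h ≡ r * (t * h)
      shuffle = solve-∀ ℚ-ring

    -- In `form-expansion` the powers of `τ` cancel. The first summand and the two cross terms
    -- contribute `r * r′` each, and so does each of the n + 1 products of errors: 4 + n in all.
    ∣form∣≤ : ∀ {r r′ u v} → Size r u → Size r′ v → ∣ form u v ∣ ≤ nat (4 ℕ.+ n) * (r * r′)
    ∣form∣≤ {r} {r′} {u} {v} su sv = begin
      ∣ form u v ∣       ≡⟨ cong ∣_∣ (form-expansion u v) ⟩
      ∣ u zero * v zero * (s - 1ℚ) + u zero * height v + v zero * height u + sum (λ j → err j u * err j v) ∣
        ≤⟨ ∣+∣≤ (∣+∣≤ (∣+∣≤ near-term (∣zero*height∣≤ su sv)) (∣zero*height∣≤ sv su))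
                (∣sum∣≤const (λ j → ∣*∣≤ (err-≤ su j) (err-≤ sv j))) ⟩
      r * r′ + r * r′ + r′ * r + nat (suc n) * (r * r′)
        ≡⟨ trans (collect r r′ (nat (suc n))) (cong (λ x → (x + nat (suc n)) * (r * r′)) (sym nat-3)) ⟩
      (nat 3 + nat (suc n)) * (r * r′)                    ≡⟨ cong (_* (r * r′)) (sym (nat-+ 3 (suc n))) ⟩
      nat (4 ℕ.+ n) * (r * r′)                            ∎
      where
      open ≤-Reasoning
      collect : ∀ r s k → r * s + r * s + s * r + k * (r * s) ≡ (1ℚ + (1ℚ + (1ℚ + 0ℚ)) + k) * (r * s)
      collect = solve-∀ ℚ-ring
      shuffle : ∀ t r s d → (t * r) * (t * s) * d ≡ (r * s) * ((t * t) * d)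
      shuffle = solve-∀ ℚ-ring
      nat-3 : nat 3 ≡ 1ℚ + (1ℚ + (1ℚ + 0ℚ))
      nat-3 = trans (nat-suc 2) (cong (1ℚ +_) (trans (nat-suc 1) (cong (1ℚ +_) (trans (nat-suc 0) (cong (1ℚ +_) ι-0)))))
      near-term : ∣ u zero * v zero * (s - 1ℚ) ∣ ≤ r * r′
      near-term = begin
        ∣ u zero * v zero * (s - 1ℚ) ∣               ≤⟨ ∣*∣≤ (∣*∣≤ (zero-≤ su) (zero-≤ sv)) (≤-refl {∣ s - 1ℚ ∣}) ⟩
        (τ * r) * (τ * r′) * ∣ s - 1ℚ ∣              ≡⟨ shuffle τ r r′ ∣ s - 1ℚ ∣ ⟩
        (r * r′) * ((τ * τ) * ∣ s - 1ℚ ∣)            ≤⟨ *-monoˡ (0≤* (size-nonneg su) (size-nonneg sv)) near ⟩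
        (r * r′) * 1ℚ                                ≡⟨ *-identityʳ (r * r′) ⟩
        r * r′                                       ∎

    -- A basis of the dual space. `err zero` is left out, because `height` is the combination of all
    -- errors with coefficients `a j` and `a zero` is not 0.
    frame : Fin (suc (suc n)) → V → ℚ
    frame zero          v = σ * v zero
    frame (suc zero)    v = τ * height v
    frame (suc (suc j)) v = err (suc j) v

    frame-linear : ∀ m → IsLinear (frame m)
    frame-linear zero          = scale-linear σ (coord-linear zero)
    frame-linear (suc zero)    = scale-linear τ height-linear
    frame-linear (suc (suc j)) = err-linear (suc j)

    a₀≢0 : a zero ≢ 0ℚ
    a₀≢0 e = contradiction (<-≤-trans 0<σ (subst (λ x → σ ≤ ∣ x ∣) e σ≤∣a₀∣)) (<-irrefl refl)

    expand : ∀ {L} → IsLinear L → ∃ λ (c : Vector ℚ (suc (suc n))) → ∀ v → L v ≡ sum (λ m → c m * frame m v)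
    expand {L} lin = c , λ v → begin
      L v                                                ≡⟨ L≡ v ⟩
      y zero * v zero + sum (λ j → y′ j * v (suc j))
        ≡⟨ cong (λ x → y zero * v zero + x) (sum-cong-≗ {suc n} (λ j → pointwise (a j) (y′ j) κ (v zero) (v (suc j)))) ⟩
      y zero * v zero + sum (λ j → v zero * (a j * y′ j) + κ * (a j * err j v) + (y′ j - κ * a j) * err j v)
        ≡⟨ cong (λ x → y zero * v zero + x) (sum₃ v) ⟩
      y zero * v zero + (v zero * sum (λ j → a j * y′ j) + κ * height v
        + ((y′ zero - κ * a zero) * err zero v + sum (λ j → (y′ (suc j) - κ * a (suc j)) * err (suc j) v)))
        ≡⟨ cong (λ x → y zero * v zero + (v zero * sum (λ j → a j * y′ j) + κ * height v + (x * err zero v + rest v))) κ-cancels ⟩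
      y zero * v zero + (v zero * sum (λ j → a j * y′ j) + κ * height v + (0ℚ * err zero v + rest v))
        ≡⟨ cong₂ (λ x z → y zero * x + (x * sum (λ j → a j * y′ j) + κ * z + (0ℚ * err zero v + rest v)))
             (unit (v zero)) (unit (height v)) ⟩
      y zero * (τ * σ * v zero) + (τ * σ * v zero * sum (λ j → a j * y′ j) + κ * (τ * σ * height v) + (0ℚ * err zero v + rest v))
        ≡⟨ collect (y zero) τ σ (v zero) (sum (λ j → a j * y′ j)) κ (height v) (err zero v) (rest v) ⟩
      sum (λ m → c m * frame m v) ∎
      where
      open ≡-Reasoning
      y = proj₁ (represent lin)
      L≡ = proj₂ (represent lin)
      y′ = y ∘ suc
      -- Splitting off κ times the height cancels the coefficient of `err zero`, which the frame
      -- lacks.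
      κ = y′ zero * proj₁ (inverse a₀≢0)
      c : Vector ℚ (suc (suc n))
      c zero = τ * (y zero + sum (λ j → a j * y′ j))
      c (suc zero) = σ * κ
      c (suc (suc j)) = y′ (suc j) - κ * a (suc j)
      rest : V → ℚ
      rest v = sum (λ j → (y′ (suc j) - κ * a (suc j)) * err (suc j) v)
      unit : ∀ x → x ≡ τ * σ * x
      unit x = trans (sym (*-identityˡ x)) (cong (_* x) (sym τσ≡1))
      κ-cancels : y′ zero - κ * a zero ≡ 0ℚ
      κ-cancels = trans (lemma (y′ zero) (proj₁ (inverse a₀≢0)) (a zero))
        (trans (cong (λ x → y′ zero - y′ zero * x) (proj₂ (inverse a₀≢0))) (lemma′ (y′ zero)))
        where
        lemma : ∀ y i a → y - y * i * a ≡ y - y * (a * i)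
        lemma = solve-∀ ℚ-ring
        lemma′ : ∀ y → y - y * 1ℚ ≡ 0ℚ
        lemma′ = solve-∀ ℚ-ring
      pointwise : ∀ a y k x p → y * p ≡ x * (a * y) + k * (a * (p - a * x)) + (y - k * a) * (p - a * x)
      pointwise = solve-∀ ℚ-ring
      sum₃ : ∀ v → sum (λ j → v zero * (a j * y′ j) + κ * (a j * err j v) + (y′ j - κ * a j) * err j v) ≡
        v zero * sum (λ j → a j * y′ j) + κ * height v + sum (λ j → (y′ j - κ * a j) * err j v)
      sum₃ v = trans (∑-distrib-+ (λ j → v zero * (a j * y′ j) + κ * (a j * err j v)) (λ j → (y′ j - κ * a j) * err j v))
        (cong (_+ sum (λ j → (y′ j - κ * a j) * err j v))
          (trans (∑-distrib-+ (λ j → v zero * (a j * y′ j)) (λ j → κ * (a j * err j v)))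
            (cong₂ _+_ (sym (*-distribˡ-sum (v zero) (λ j → a j * y′ j))) (sym (*-distribˡ-sum κ (λ j → a j * err j v))))))
      collect : ∀ y t s x w k h e r →
        y * (t * s * x) + (t * s * x * w + k * (t * s * h) + (0ℚ * e + r)) ≡ t * (y + w) * (s * x) + (s * k * (t * h) + r)
      collect = solve-∀ ℚ-ring

    -- The relation Σ aⱼ eⱼ = h recovers the coordinate e₀ omitted from the frame.
    err₀-≤ : ∀ {v η} → (∀ m → ∣ frame m v ∣ ≤ η) → ∣ err zero v ∣ ≤ nat (suc n) * η
    err₀-≤ {v} {η} bound = dominant-bound c x zero max a₀≢0 relation (λ { zero → bound (suc zero) ; (suc j) → bound (suc (suc j)) })
      where
      c x : Vector ℚ (suc (suc n))
      c zero = a zero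
      c (suc zero) = - σ
      c (suc (suc j)) = a (suc j)
      x zero = err zero v
      x (suc zero) = τ * height v
      x (suc (suc j)) = err (suc j) v
      max : ∀ j → ∣ c j ∣ ≤ ∣ a zero ∣
      max zero = ≤-refl
      max (suc zero) = subst (_≤ ∣ a zero ∣) (trans (sym (0≤p⇒∣p∣≡p (<⇒≤ 0<σ))) (sym (∣-p∣≡∣p∣ σ))) σ≤∣a₀∣
      max (suc (suc j)) = a₀-max (suc j)
      relation : sum (λ j → c j * x j) ≡ 0ℚ
      relation = trans (lemma (a zero * err zero v) (sum (λ j → a (suc j) * err (suc j) v)) σ τ)
        (trans (cong (λ ts → (1ℚ - ts) * height v) τσ≡1) (*-zeroˡ (height v)))
        where
        lemma : ∀ x y s t → x + (- s * (t * (x + y)) + y) ≡ (1ℚ - t * s) * (x + y)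
        lemma = solve-∀ ℚ-ring

    size-from-frame : ∀ {v η} → (∀ m → ∣ frame m v ∣ ≤ η) → Size (nat (suc n) * η) v
    size-from-frame {v} {η} bound = mkSize
      (begin
        ∣ v zero ∣
          ≡⟨ cong ∣_∣ (trans (sym (*-identityˡ (v zero)))
               (trans (cong (_* v zero) (sym τσ≡1)) (*-assoc τ σ (v zero)))) ⟩
        ∣ τ * (σ * v zero) ∣   ≤⟨ ∣*∣≤ (≤-reflexive (0≤p⇒∣p∣≡p (<⇒≤ 0<τ))) (weaken (bound zero)) ⟩
        τ * (nat (suc n) * η)  ∎)
      (λ { zero → err₀-≤ bound ; (suc j) → weaken (bound (suc (suc j))) })
      (weaken (bound (suc zero)))
      where
      open ≤-Reasoning
      0≤η : 0ℚ ≤ η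
      0≤η = ≤-trans (0≤∣p∣ _) (bound zero)
      weaken : ∀ {x} → ∣ x ∣ ≤ η → ∣ x ∣ ≤ nat (suc n) * η
      weaken p = ≤-trans p (subst (_≤ nat (suc n) * η) (*-identityˡ η)
        (*-monoʳ-≤-nonNeg η {{nonNegative 0≤η}} (1≤nat {suc n} (s≤s z≤n))))

  -- The pigeonhole argument

  nat-injective : ∀ {m n} → nat m ≡ nat n → m ≡ n
  nat-injective = ℤₚ.+-injective ∘ ι-injective

  funToFin-cong : ∀ {m n} {f g : Fin m → Fin n} → f ≗ g → funToFin f ≡ funToFin g
  funToFin-cong {zero}  p = refl
  funToFin-cong {suc m} p = cong₂ combine (p zero) (funToFin-cong (p ∘ suc))

  funToFin-injective : ∀ {m n} {f g : Fin m → Fin n} → funToFin f ≡ funToFin g → f ≗ g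
  funToFin-injective {f = f} {g} e i =
    trans (sym (Finₚ.finToFun-funToFin f i)) (trans (cong (λ k → finToFun k i) e) (Finₚ.finToFun-funToFin g i))

  finToFun-injective : ∀ {m n} {i j : Fin (n ℕ.^ m)} → finToFun {n} {m} i ≗ finToFun j → i ≡ j
  finToFun-injective {m} {n} {i} {j} p =
    trans (sym (Finₚ.funToFin-finToFin {m} {n} i)) (trans (funToFin-cong p) (Finₚ.funToFin-finToFin {m} {n} j))

  remQuot-injective : ∀ {m} n {i j : Fin (m ℕ.* n)} →
    quotient {m} n i ≡ quotient n j → remainder {m} n i ≡ remainder {m} n j → i ≡ j
  remQuot-injective {m} n {i} {j} p q =
    trans (sym (Finₚ.combine-remQuot {m} n i)) (trans (cong₂ combine p q) (Finₚ.combine-remQuot {m} n j))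

  ∣-∣≤-interval : ∀ {x y l w} → l ≤ x → x ≤ l + w → l ≤ y → y ≤ l + w → ∣ x - y ∣ ≤ w
  ∣-∣≤-interval {x} {y} {l} {w} l≤x x≤ l≤y y≤ = ∣∣≤-intro
    (by-≤ (0≤+ (0≤y-x x≤) (0≤y-x l≤y)) (lemma l w x y))
    (by-≤ (0≤+ (0≤y-x y≤) (0≤y-x l≤x)) (lemma′ l w x y))
    where
    lemma : ∀ l w x y → w - (x - y) ≡ (l + w - x) + (y - l)
    lemma = solve-∀ ℚ-ring
    lemma′ : ∀ l w x y → w - - (x - y) ≡ (l + w - y) + (x - l)
    lemma′ = solve-∀ ℚ-ring

  punchIn-cases : ∀ {n} (P : Fin (suc n) → Set) k → P k → (∀ j → P (punchIn k j)) → ∀ m → P m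
  punchIn-cases P k Pk Pj m with k Finₚ.≟ m
  ... | yes refl = Pk
  ... | no k≢m = subst P (Finₚ.punchIn-punchOut k≢m) (Pj (punchOut k≢m))

  module Pigeonhole (n : ℕ) (a : Vector ℚ (suc n)) (T : ℕ) (σ : ℚ)
    (0<T : 0ℚ < nat T) (0<σ : 0ℚ < σ) (Tσ≡1 : nat T * σ ≡ 1ℚ)
    (near : (nat T * nat T) * ∣ sum (λ j → a j * a j) - 1ℚ ∣ ≤ 1ℚ)
    (a₀-max : ∀ j → ∣ a j ∣ ≤ ∣ a zero ∣)
    (σ≤∣a₀∣ : σ ≤ ∣ a zero ∣)
    (∣a∣≤2 : ∀ j → ∣ a j ∣ ≤ nat 2)
    (R D A : ℕ) (0<R : 0ℚ < nat R) (0<D : 0ℚ < nat D)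
    (A-large : nat 4 * nat (suc n) < nat A)
    (more-points : A ℕ.* T ℕ.* (R ℕ.* D) ℕ.^ suc n ℕ.< R ℕ.* T ℕ.* R ℕ.^ suc n)
    (η : ℚ) (Dη≡1 : nat D * η ≡ 1ℚ)
    (η-small : nat (4 ℕ.+ n) * ((nat (suc n) * (nat (suc n) * η)) * (nat (suc n) * (nat (suc n) * η))) < 1ℚ)
    where

    open Geometry n a (nat T) σ 0<T 0<σ Tσ≡1 near a₀-max σ≤∣a₀∣

    private
      τ ρ δ : ℚ
      τ = nat T
      ρ = nat R
      δ = nat D

      ⌈_⌉ₐ : Fin (R ℕ.* T) → Fin (suc n) → ℚ
      ⌈ t ⌉ₐ j = proj₁ (ceil (a j * nat (toℕ t)))

    record Point : Set where
      constructor ⟨_,_⟩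
      field
        time   : Fin (R ℕ.* T)
        offset : Fin (suc n) → Fin R
    open Point

    -- The offset is counted from the ceiling of `a j` times the time, so that every error lies in
    -- [0, R). Rescaled by `σ`, the time lies in [0, R) as well.
    vec : Point → V
    vec p zero    = nat (toℕ (time p))
    vec p (suc j) = nat (toℕ (offset p j)) + ⌈ time p ⌉ₐ j

    vec-integral : ∀ p → Integral (vec p)
    vec-integral p zero    = int-nat (toℕ (time p))
    vec-integral p (suc j) = int-+ (int-nat (toℕ (offset p j))) (proj₁ (proj₂ (ceil (a j * nat (toℕ (time p))))))

    vec-injective : ∀ p q → vec p ≗ vec q → time p ≡ time q × offset p ≗ offset q
    vec-injective p q e = time≡ , λ j → Finₚ.toℕ-injective (nat-injective
      (+-cancelʳ (⌈ time p ⌉ₐ j) (trans (e (suc j)) (cong (λ t → nat (toℕ (offset q j)) + ⌈ t ⌉ₐ j) (sym time≡)))))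
      where
      time≡ : time p ≡ time q
      time≡ = Finₚ.toℕ-injective (nat-injective (e zero))
      +-cancelʳ : ∀ {x y} z → x + z ≡ y + z → x ≡ y
      +-cancelʳ {x} {y} z e = trans (lemma x z) (trans (cong (_- z) e) (sym (lemma y z)))
        where
        lemma : ∀ x z → x ≡ x + z - z
        lemma = solve-∀ ℚ-ring

    toℕ<nat : ∀ {m} (i : Fin m) → 1ℚ + nat (toℕ i) ≤ nat m
    toℕ<nat i = subst (_≤ _) (nat-suc (toℕ i)) (nat-mono (Finₚ.toℕ<n i))

    err-range : ∀ p j → 0ℚ ≤ err j (vec p) × err j (vec p) < ρ
    err-range p j =
      subst (0ℚ ≤_) (sym err≡) (0≤+ (0≤nat (toℕ o)) 0≤) ,
      subst (_< ρ) (sym err≡) (<-≤-trans (+-monoʳ-< (nat (toℕ o)) <1)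
        (subst (_≤ ρ) (+-comm 1ℚ (nat (toℕ o))) (toℕ<nat o)))
      where
      o = offset p j
      x = a j * nat (toℕ (time p))
      c = ⌈ time p ⌉ₐ j
      0≤ : 0ℚ ≤ c - x
      0≤ = proj₁ (proj₂ (proj₂ (ceil x)))
      <1 : c - x < 1ℚ
      <1 = proj₂ (proj₂ (proj₂ (ceil x)))
      err≡ : err j (vec p) ≡ nat (toℕ o) + (c - x)
      err≡ = +-assoc (nat (toℕ o)) c (- x)

    time-range : ∀ p → 0ℚ ≤ σ * vec p zero × σ * vec p zero < ρ
    time-range p = 0≤* (<⇒≤ 0<σ) (0≤nat t) , (begin-strict
      σ * nat t            <⟨ *-monoˡ-< 0<σ (<-≤-trans (by-< 0<1 (1+x-x≡1 (nat t))) (toℕ<nat (time p))) ⟩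
      σ * nat (R ℕ.* T)    ≡⟨ cong (σ *_) (nat-* R T) ⟩
      σ * (ρ * τ)          ≡⟨ shuffle σ ρ τ ⟩
      ρ * (τ * σ)          ≡⟨ cong (ρ *_) Tσ≡1 ⟩
      ρ * 1ℚ               ≡⟨ *-identityʳ ρ ⟩
      ρ                    ∎)
      where
      open ≤-Reasoning
      t = toℕ (time p)
      shuffle : ∀ s r t → s * (r * t) ≡ r * (t * s)
      shuffle = solve-∀ ℚ-ring

    -- Bounds the height of every point, a sum of n + 1 products of some `a j`, at most 2, and an
    -- error below R. Adding it makes the height nonnegative before it is cut into boxes.
    shift : ℚ
    shift = nat (suc n) * (nat 2 * ρ)

    ∣height∣≤shift : ∀ p → ∣ height (vec p) ∣ ≤ shift
    ∣height∣≤shift p = ∣sum∣≤const λ j → ∣*∣≤ (∣a∣≤2 j)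
      (subst (_≤ ρ) (sym (0≤p⇒∣p∣≡p (proj₁ (err-range p j)))) (<⇒≤ (proj₂ (err-range p j))))

    -- Heights fill an interval of length 2 `shift` = 4 (n + 1) R, hence the demand on `A`. Scaling
    -- by `τ` stretches it by T, and this T is matched by the one in the number of times.
    height-range : ∀ p → 0ℚ ≤ τ * (height (vec p) + shift) × τ * (height (vec p) + shift) < nat (A ℕ.* T) * ρ
    height-range p =
      0≤* (<⇒≤ 0<T) (subst (0ℚ ≤_) (lemma h shift) (0≤y-x (≤-trans (-x≤∣x∣ h) (∣height∣≤shift p)))) ,
      (begin-strict
        τ * (h + shift)                        ≤⟨ *-monoˡ (<⇒≤ 0<T) (+-monoˡ-≤ shift (≤-trans (x≤∣x∣ h) (∣height∣≤shift p))) ⟩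
        τ * (shift + shift)                    ≡⟨ shuffle τ (nat (suc n)) (nat 2) ρ ⟩
        (τ * ρ) * ((nat 2 + nat 2) * nat (suc n))
          ≡⟨ cong (λ x → (τ * ρ) * (x * nat (suc n))) (sym (nat-+ 2 2)) ⟩
        (τ * ρ) * (nat 4 * nat (suc n))        <⟨ *-monoˡ-< (0<* 0<T 0<R) A-large ⟩
        (τ * ρ) * nat A                        ≡⟨ shuffle′ τ ρ (nat A) ⟩
        (nat A * τ) * ρ                        ≡⟨ cong (_* ρ) (sym (nat-* A T)) ⟩
        nat (A ℕ.* T) * ρ                      ∎)
      where
      open ≤-Reasoning
      h = height (vec p)
      lemma : ∀ h s → s - - h ≡ h + s
      lemma = solve-∀ ℚ-ring
      shuffle : ∀ t k b r → t * (k * (b * r) + k * (b * r)) ≡ (t * r) * ((b + b) * k)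
      shuffle = solve-∀ ℚ-ring
      shuffle′ : ∀ t r a → (t * r) * a ≡ (a * t) * r
      shuffle′ = solve-∀ ℚ-ring

    fine-box : ∀ {x} → 0ℚ ≤ x × x < ρ → ∃ λ (k : Fin (R ℕ.* D)) → nat (toℕ k) ≤ δ * x × δ * x < 1ℚ + nat (toℕ k)
    fine-box {x} (0≤x , x<ρ) = box (R ℕ.* D) (0≤* (<⇒≤ 0<D) 0≤x)
      (subst (δ * x <_) (trans (*-comm δ ρ) (sym (nat-* R D))) (*-monoˡ-< 0<D x<ρ))

    height-box : ∀ p → ∃ λ (k : Fin (A ℕ.* T ℕ.* (R ℕ.* D))) →
      nat (toℕ k) ≤ δ * (τ * (height (vec p) + shift)) × δ * (τ * (height (vec p) + shift)) < 1ℚ + nat (toℕ k)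
    height-box p = box (A ℕ.* T ℕ.* (R ℕ.* D)) (0≤* (<⇒≤ 0<D) (proj₁ (height-range p)))
      (subst (δ * (τ * (height (vec p) + shift)) <_)
        (trans (trans (shuffle δ (nat (A ℕ.* T)) ρ) (cong (nat (A ℕ.* T) *_) (sym (nat-* R D))))
               (sym (nat-* (A ℕ.* T) (R ℕ.* D))))
        (*-monoˡ-< 0<D (proj₂ (height-range p))))
      where
      shuffle : ∀ d a r → d * (a * r) ≡ a * (r * d)
      shuffle = solve-∀ ℚ-ring

    -- The box of the height coordinate is split into its quotient (which boxes
    -- of width ρ it lies in) and its remainder, so that all digits range over
    -- the same set and any one of them can be discarded.
    coarse : Point → Fin (A ℕ.* T)
    coarse p = quotient (R ℕ.* D) (proj₁ (height-box p))

    digit : Point → Fin (suc (suc n)) → Fin (R ℕ.* D)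
    digit p zero          = proj₁ (fine-box (time-range p))
    digit p (suc zero)    = remainder {A ℕ.* T} (R ℕ.* D) (proj₁ (height-box p))
    digit p (suc (suc j)) = proj₁ (fine-box (err-range p (suc j)))

    -- Dropping a digit is what makes a collision possible: there are T R^(n+2) points, but A T (R
    -- D)^(n+2) codes if all digits are kept.
    code : Fin (suc (suc n)) → Point → Fin (A ℕ.* T ℕ.* (R ℕ.* D) ℕ.^ suc n)
    code k p = combine (coarse p) (funToFin (λ j → digit p (punchIn k j)))

    private
      1≡δη : 1ℚ ≡ δ * η
      1≡δη = sym Dη≡1

      scaled-≤ : ∀ x y {w} → ∣ δ * x - δ * y ∣ ≤ δ * w → ∣ x - y ∣ ≤ w
      scaled-≤ x y {w} p = *-cancelˡ-≤ 0<D (subst (_≤ δ * w) (trans (cong ∣_∣ (factor δ x y))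
        (trans (∣p*q∣≡∣p∣*∣q∣ δ (x - y)) (cong (_* ∣ x - y ∣) (0≤p⇒∣p∣≡p (<⇒≤ 0<D))))) p)
        where
        factor : ∀ d x y → d * x - d * y ≡ d * (x - y)
        factor = solve-∀ ℚ-ring

      same-box : ∀ {m} (k l : Fin m) {x y} →
        nat (toℕ k) ≤ δ * x × δ * x < 1ℚ + nat (toℕ k) →
        nat (toℕ l) ≤ δ * y × δ * y < 1ℚ + nat (toℕ l) → k ≡ l → ∣ x - y ∣ ≤ η
      same-box k _ {x} {y} (p , p′) (q , q′) refl = scaled-≤ x y (subst (∣ δ * x - δ * y ∣ ≤_) 1≡δη
        (∣-∣≤-interval p (subst (_ ≤_) (+-comm 1ℚ (nat (toℕ k))) (<⇒≤ p′)) q (subst (_ ≤_) (+-comm 1ℚ (nat (toℕ k))) (<⇒≤ q′))))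

      shift-cancels : ∀ x y → ∣ τ * (x + shift) - τ * (y + shift) ∣ ≡ ∣ τ * x - τ * y ∣
      shift-cancels x y = cong ∣_∣ (lemma τ x y shift)
        where
        lemma : ∀ t x y s → t * (x + s) - t * (y + s) ≡ t * x - t * y
        lemma = solve-∀ ℚ-ring

    _⊖_ : Point → Point → V
    (p ⊖ q) k = vec p k - vec q k

    frame-⊖ : ∀ p q m → frame m (p ⊖ q) ≡ frame m (vec p) - frame m (vec q)
    frame-⊖ p q m = -‿homo (frame-linear m) (vec p) (vec q)

    frame-fine : ∀ p q m → coarse p ≡ coarse q → digit p m ≡ digit q m → ∣ frame m (p ⊖ q) ∣ ≤ η
    frame-fine p q m c d = subst (λ x → ∣ x ∣ ≤ η) (sym (frame-⊖ p q m)) (go m d)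
      where
      go : ∀ m → digit p m ≡ digit q m → ∣ frame m (vec p) - frame m (vec q) ∣ ≤ η
      go zero d = same-box _ _ (proj₂ (fine-box (time-range p))) (proj₂ (fine-box (time-range q))) d
      go (suc zero) d = subst (_≤ η) (shift-cancels (height (vec p)) (height (vec q)))
        (same-box _ _ (proj₂ (height-box p)) (proj₂ (height-box q)) (remQuot-injective {A ℕ.* T} (R ℕ.* D) c d))
      go (suc (suc j)) d = same-box _ _ (proj₂ (fine-box (err-range p (suc j)))) (proj₂ (fine-box (err-range q (suc j)))) d

    coarse-range : ∀ p → let l = nat (R ℕ.* D) * nat (toℕ (coarse p)); x = δ * (τ * (height (vec p) + shift)) in
      l ≤ x × x ≤ l + δ * ρ
    coarse-range p =
      ≤-trans (subst (l ≤_) (sym k≡) (subst (_≤ l + nat (toℕ r)) (+-identityʳ l) (+-monoʳ-≤ l (0≤nat (toℕ r))))) (proj₁ b) ,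
      ≤-trans (<⇒≤ (proj₂ b)) (begin
        1ℚ + nat (toℕ k)              ≡⟨ cong (λ z → 1ℚ + z) k≡ ⟩
        1ℚ + (l + nat (toℕ r))        ≡⟨ shuffle l (nat (toℕ r)) ⟩
        l + (1ℚ + nat (toℕ r))        ≤⟨ +-monoʳ-≤ l (toℕ<nat r) ⟩
        l + nat (R ℕ.* D)             ≡⟨ cong (λ z → l + z) (trans (nat-* R D) (*-comm ρ δ)) ⟩
        l + δ * ρ                     ∎)
      where
      open ≤-Reasoning
      l = nat (R ℕ.* D) * nat (toℕ (coarse p))
      k = proj₁ (height-box p)
      b = proj₂ (height-box p)
      r = remainder {A ℕ.* T} (R ℕ.* D) k
      k≡ : nat (toℕ k) ≡ l + nat (toℕ r)
      k≡ = trans (cong nat (trans (cong toℕ (sym (Finₚ.combine-remQuot {A ℕ.* T} (R ℕ.* D) k))) (Finₚ.toℕ-combine (coarse p) r)))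
        (trans (nat-+ (R ℕ.* D ℕ.* toℕ (coarse p)) (toℕ r)) (cong (_+ nat (toℕ r)) (nat-* (R ℕ.* D) (toℕ (coarse p)))))
      shuffle : ∀ l r → 1ℚ + (l + r) ≡ l + (1ℚ + r)
      shuffle = solve-∀ ℚ-ring

    -- Rescaled times and errors lie in an interval of length R from the start, and equal coarse
    -- parts put the scaled heights into one interval of that length. No digit is consulted, so the
    -- bound survives the loss of any of them.
    ⊖-size : ∀ p q → coarse p ≡ coarse q → Size ρ (p ⊖ q)
    ⊖-size p q c = mkSize
      (begin
        ∣ vec p zero - vec q zero ∣                    ≡⟨ cong ∣_∣ (rescale (vec p zero - vec q zero)) ⟩
        ∣ τ * (σ * (vec p zero - vec q zero)) ∣        ≤⟨ ∣*∣≤ (≤-reflexive (0≤p⇒∣p∣≡p (<⇒≤ 0<T))) time-≤ ⟩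
        τ * ρ                                          ∎)
      (λ j → subst (λ x → ∣ x ∣ ≤ ρ) (sym (-‿homo (err-linear j) (vec p) (vec q)))
        (within (err-range p j) (err-range q j)))
      (subst (λ x → ∣ x ∣ ≤ ρ) (sym (frame-⊖ p q (suc zero)))
        (subst (_≤ ρ) (shift-cancels (height (vec p)) (height (vec q)))
          (scaled-≤ (H p) (H q) (∣-∣≤-interval (proj₁ (coarse-range p)) (proj₂ (coarse-range p))
            (subst (λ i → nat (R ℕ.* D) * nat (toℕ i) ≤ δ * H q) (sym c) (proj₁ (coarse-range q)))
            (subst (λ i → δ * H q ≤ nat (R ℕ.* D) * nat (toℕ i) + δ * ρ) (sym c) (proj₂ (coarse-range q)))))))
      where
      open ≤-Reasoning
      H : Point → ℚ
      H r = τ * (height (vec r) + shift)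
      within : ∀ {x y} → 0ℚ ≤ x × x < ρ → 0ℚ ≤ y × y < ρ → ∣ x - y ∣ ≤ ρ
      within {x} {y} (p , p′) (q , q′) =
        ∣-∣≤-interval p (subst (x ≤_) (sym (+-identityˡ ρ)) (<⇒≤ p′))
                      q (subst (y ≤_) (sym (+-identityˡ ρ)) (<⇒≤ q′))
      rescale : ∀ x → x ≡ τ * (σ * x)
      rescale x = trans (sym (*-identityˡ x)) (trans (cong (_* x) (sym Tσ≡1)) (*-assoc τ σ x))
      time-≤ : ∣ σ * (vec p zero - vec q zero) ∣ ≤ ρ
      time-≤ = subst (λ x → ∣ x ∣ ≤ ρ) (sym (frame-⊖ p q zero)) (within (time-range p) (time-range q))

    point : Fin (R ℕ.* T ℕ.* R ℕ.^ suc n) → Point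
    point i = ⟨ quotient {R ℕ.* T} (R ℕ.^ suc n) i , finToFun {R} {suc n} (remainder {R ℕ.* T} (R ℕ.^ suc n) i) ⟩

    point-injective : ∀ i j → vec (point i) ≗ vec (point j) → i ≡ j
    point-injective i j e = let t , o = vec-injective (point i) (point j) e in
      remQuot-injective {R ℕ.* T} (R ℕ.^ suc n) t (finToFun-injective {suc n} {R} o)

    collision : ∀ k → ∃ λ p → ∃ λ q → code k p ≡ code k q × ¬ (vec p ≗ vec q)
    collision k =
      let i , j , i<j , e = Finₚ.pigeonhole more-points (code k ∘ point)
      in  point i , point j , e , λ e′ → ℕₚ.<-irrefl (cong toℕ (point-injective i j e′)) i<j

    -- If `L` does not vanish on the difference `w`, then `w` itself is the independent vector. If
    -- it does, the relation between the frame coordinates of `w` bounds the dropped one, since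
    -- `c k` dominates. All of them are then of order `η`, the form on `w` is below 1 in absolute
    -- value and, being an integer, it is 0.
    dichotomy : ∀ {L} → IsLinear L → (c : Vector ℚ (suc (suc n))) → (∀ v → L v ≡ sum (λ m → c m * frame m v)) →
      ∀ k → (∀ m → ∣ c m ∣ ≤ ∣ c k ∣) → c k ≢ 0ℚ → ∀ p q → code k p ≡ code k q → ¬ (vec p ≗ vec q) →
      Isotropic ρ ⊎ ∃ λ v → Integral v × Size ρ v × L v ≢ 0ℚ
    dichotomy {L} lin c L≡ k max cₖ≢0 p q codes p≢q = result (L w ≟ 0ℚ)
      where
      w : V
      w = p ⊖ q
      codes≡ : coarse p ≡ coarse q × funToFin (λ j → digit p (punchIn k j)) ≡ funToFin (λ j → digit q (punchIn k j))
      codes≡ = Finₚ.combine-injective (coarse p) (funToFin (λ j → digit p (punchIn k j)))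
        (coarse q) (funToFin (λ j → digit q (punchIn k j))) codes
      digits≡ : ∀ j → digit p (punchIn k j) ≡ digit q (punchIn k j)
      digits≡ = funToFin-injective {f = λ j → digit p (punchIn k j)} {g = λ j → digit q (punchIn k j)} (proj₂ codes≡)
      w-integral : Integral w
      w-integral m = int-+ (vec-integral p m) (int-neg (vec-integral q m))
      w≢0 : ¬ (∀ m → w m ≡ 0ℚ)
      w≢0 e = p≢q λ m → trans (sym (x+[y-x]≡y (vec q m) (vec p m))) (trans (cong (λ z → vec q m + z) (e m)) (+-identityʳ (vec q m)))
      η₁ : ℚ
      η₁ = nat (suc n) * η
      fine : ∀ j → ∣ frame (punchIn k j) w ∣ ≤ η
      fine j = frame-fine p q (punchIn k j) (proj₁ codes≡) (digits≡ j)
      0≤η : 0ℚ ≤ η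
      0≤η = ≤-trans (0≤∣p∣ (frame (punchIn k zero) w)) (fine zero)
      η≤η₁ : η ≤ η₁
      η≤η₁ = subst (_≤ η₁) (*-identityˡ η) (*-monoʳ-≤-nonNeg η {{nonNegative 0≤η}} (1≤nat {suc n} (s≤s z≤n)))
      result : Dec (L w ≡ 0ℚ) → Isotropic ρ ⊎ ∃ λ v → Integral v × Size ρ v × L v ≢ 0ℚ
      result (no Lw≢0) = inj₂ (w , w-integral , ⊖-size p q (proj₁ codes≡) , Lw≢0)
      result (yes Lw≡0) = inj₁ (w , w-integral , ⊖-size p q (proj₁ codes≡) , w≢0 ,
        int-∣∣<1 (integral-form w-integral w-integral) (≤-<-trans (∣form∣≤ small small) η-small))
        where
        pivot : ∣ frame k w ∣ ≤ η₁
        pivot = dominant-bound c (λ m → frame m w) k max cₖ≢0 (trans (sym (L≡ w)) Lw≡0) fine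
        all : ∀ m → ∣ frame m w ∣ ≤ η₁
        all m = punchIn-cases (λ i → ∣ frame i w ∣ ≤ η₁) k pivot (λ j → ≤-trans (fine j) η≤η₁) m
        small : Size (nat (suc n) * η₁) w
        small = size-from-frame all

    isotropic-or-independent : ∀ {L} → IsLinear L → ¬ (∀ v → L v ≡ 0ℚ) →
      Isotropic ρ ⊎ ∃ λ v → Integral v × Size ρ v × L v ≢ 0ℚ
    isotropic-or-independent {L} lin L≢0 =
      let c , L≡ = expand lin
          k , max = argmax (λ m → ∣ c m ∣)
          p , q , codes , p≢q = collision k
      in  dichotomy lin c L≡ k max
            -- Were the largest coefficient 0, all of them would be, and `L` with them.
            (λ e → L≢0 λ v → trans (L≡ v) (sum-zero λ m → trans (cong (_* frame m v)
              (∣p∣≡0⇒p≡0 (c m) (≤-antisym (≤-trans (max m) (≤-reflexive (cong ∣_∣ e))) (0≤∣p∣ (c m))))) (*-zeroˡ (frame m v))))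
            p q codes p≢q

  -- Exchange and Gram matrices

  unit : ∀ {d} → Fin d → Vector ℚ d
  unit zero    = 1ℚ ∷ λ _ → 0ℚ
  unit (suc i) = 0ℚ ∷ unit i

  unit-expansion : ∀ {d} (v : Vector ℚ d) k → v k ≡ sum (λ i → v i * unit i k)
  unit-expansion v zero    = sym (trans (cong₂ _+_ (*-identityʳ (v zero)) (sum-zero (λ i → *-zeroʳ (v (suc i))))) (+-identityʳ (v zero)))
  unit-expansion v (suc k) = sym (trans (cong₂ _+_ (*-zeroʳ (v zero)) (sym (unit-expansion (v ∘ suc) k))) (+-identityˡ (v (suc k))))

  sum-eliminate : ∀ {n} (f g x : Vector ℚ n) t →
    sum (λ i → (f i - t * g i) * x i) ≡ sum (λ i → f i * x i) - t * sum (λ i → g i * x i)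
  sum-eliminate f g x t = begin
    sum (λ i → (f i - t * g i) * x i)                           ≡⟨ sum-cong-≗ (λ i → lemma (f i) (g i) (x i) t) ⟩
    sum (λ i → f i * x i - t * (g i * x i))                     ≡⟨ sum-‿- (λ i → f i * x i) (λ i → t * (g i * x i)) ⟩
    sum (λ i → f i * x i) - sum (λ i → t * (g i * x i))
      ≡⟨ cong (λ s → sum (λ i → f i * x i) - s) (sym (*-distribˡ-sum t (λ i → g i * x i))) ⟩
    sum (λ i → f i * x i) - t * sum (λ i → g i * x i)           ∎
    where
    open ≡-Reasoning
    lemma : ∀ f g x t → (f - t * g) * x ≡ f * x - t * (g * x)
    lemma = solve-∀ ℚ-ring

  -- X and Z are one choice of coordinates: the family x ∪ z may be dependent.
  record Spanning {d} (Good : Vector ℚ d → Set) (m l : ℕ) : Set where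
    field
      x      : Fin m → Vector ℚ d
      z      : Fin l → Vector ℚ d
      X      : Fin m → Vector ℚ d → ℚ
      Z      : Fin l → Vector ℚ d → ℚ
      X-lin  : ∀ i → IsLinear (X i)
      Z-lin  : ∀ j → IsLinear (Z j)
      good   : ∀ j → Good (z j)
      spans  : ∀ v k → v k ≡ sum (λ i → X i v * x i k) + sum (λ j → Z j v * z j k)

  module _ {d} {Good : Vector ℚ d → Set} where

    open Spanning

    standard : Spanning Good d 0
    standard = record
      { x = unit ; z = λ () ; X = λ i v → v i ; Z = λ () ; X-lin = coord-linear ; Z-lin = λ () ; good = λ ()
      ; spans = λ v k → trans (unit-expansion v k) (sym (+-identityʳ (sum (λ i → v i * unit i k)))) }

    -- The factor `t v` is such that `v - t v * b` has no component along `x zero`. Expanding this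
    -- difference in the old family gives the new coordinates.
    replace : ∀ {m l} (S : Spanning Good (suc m) l) b (t : Vector ℚ d → ℚ) → Good b → IsLinear t →
      (∀ v → X S zero v ≡ t v * X S zero b) → Spanning Good m (suc l)
    replace {m} {l} S b t good-b t-lin X₀≡ = record
      { x = x S ∘ suc
      ; z = z′
      ; X = λ i v → X S (suc i) v - t v * X S (suc i) b
      ; Z = Z′
      ; X-lin = λ i → eliminated (X-lin S (suc i)) (X S (suc i) b)
      ; Z-lin = λ { zero → t-lin ; (suc j) → eliminated (Z-lin S j) (Z S j b) }
      ; good = λ { zero → good-b ; (suc j) → good S j }
      ; spans = spans′ }
      where
      z′ : Fin (suc l) → Vector ℚ d
      z′ zero    = b
      z′ (suc j) = z S j
      Z′ : Fin (suc l) → Vector ℚ d → ℚ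
      Z′ zero    v = t v
      Z′ (suc j) v = Z S j v - t v * Z S j b
      eliminated : ∀ {L} → IsLinear L → ∀ r → IsLinear (λ v → L v - t v * r)
      eliminated lin r = -‿linear lin record
        { ≗-cong = λ e → cong (_* r) (≗-cong t-lin e)
        ; +-homo = λ u v → trans (cong (_* r) (+-homo t-lin u v)) (*-distribʳ-+ r (t u) (t v))
        ; *-homo = λ c u → trans (cong (_* r) (*-homo t-lin c u)) (*-assoc c (t u) r) }
      spans′ : ∀ v k → v k ≡ sum (λ i → (X S (suc i) v - t v * X S (suc i) b) * x S (suc i) k) + sum (λ j → Z′ j v * z′ j k)
      spans′ v k = begin
        v k                                                       ≡⟨ spans S v k ⟩
        (X S zero v * x₀ + SX v) + SZ v                           ≡⟨ cong (λ y → (y * x₀ + SX v) + SZ v) (X₀≡ v) ⟩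
        (t v * X S zero b * x₀ + SX v) + SZ v                     ≡⟨ regroup (t v) (X S zero b) x₀ (SX v) (SZ v) (SX b) (SZ b) ⟩
        (SX v - t v * SX b) + (t v * ((X S zero b * x₀ + SX b) + SZ b) + (SZ v - t v * SZ b))
          ≡⟨ cong (λ y → (SX v - t v * SX b) + (t v * y + (SZ v - t v * SZ b))) (sym (spans S b k)) ⟩
        (SX v - t v * SX b) + (t v * b k + (SZ v - t v * SZ b))
          ≡⟨ sym (cong₂ (λ p q → p + (t v * b k + q))
               (sum-eliminate (λ i → X S (suc i) v) (λ i → X S (suc i) b) (λ i → x S (suc i) k) (t v))
               (sum-eliminate (λ j → Z S j v) (λ j → Z S j b) (λ j → z S j k) (t v))) ⟩
        sum (λ i → (X S (suc i) v - t v * X S (suc i) b) * x S (suc i) k) + sum (λ j → Z′ j v * z′ j k) ∎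
        where
        open ≡-Reasoning
        x₀ : ℚ
        x₀ = x S zero k
        SX SZ : Vector ℚ d → ℚ
        SX w = sum (λ i → X S (suc i) w * x S (suc i) k)
        SZ w = sum (λ j → Z S j w * z S j k)
        regroup : ∀ t y x p q p′ q′ → (t * y * x + p) + q ≡ (p - t * p′) + (t * ((y * x + p′) + q′) + (q - t * q′))
        regroup = solve-∀ ℚ-ring

    exchange : ExcludedMiddle 0ℓ → {Found : Set} → Good (λ _ → 0ℚ) →
      (∀ {L} → IsLinear L → ¬ (∀ v → L v ≡ 0ℚ) → Found ⊎ ∃ λ v → Good v × L v ≢ 0ℚ) →
      ∀ m {l} → Spanning Good m l → Found ⊎ Spanning Good 0 (m ℕ.+ l)
    exchange em good-0 step zero    S = inj₂ S
    exchange em {Found} good-0 step (suc m) {l} S = go em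
      where
      continue : Spanning Good m (suc l) → Found ⊎ Spanning Good 0 (suc m ℕ.+ l)
      continue S′ = subst (λ k → Found ⊎ Spanning Good 0 k) (ℕₚ.+-suc m l) (exchange em good-0 step m S′)
      go : Dec (∀ v → X S zero v ≡ 0ℚ) → Found ⊎ Spanning Good 0 (suc m ℕ.+ l)
      -- A direction that never occurs is replaced by the zero vector instead of being deleted, so
      -- that the family, and with it the Gram matrix, always has the same size.
      go (yes X₀≡0) = continue (replace S (λ _ → 0ℚ) (λ _ → 0ℚ) good-0 zero-linear
        (λ v → trans (X₀≡0 v) (sym (*-zeroˡ (X S zero (λ _ → 0ℚ))))))
      go (no X₀≢0) with step (X-lin S zero) X₀≢0
      ... | inj₁ found = inj₁ found
      ... | inj₂ (b , good-b , X₀b≢0) = let i , X₀b*i≡1 = inverse X₀b≢0 in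
        continue (replace S b (λ v → i * X S zero v) good-b (scale-linear i (X-lin S zero))
          (λ v → trans (sym (*-identityˡ (X S zero v)))
            (trans (cong (_* X S zero v) (sym X₀b*i≡1)) (shuffle (X S zero b) i (X S zero v)))))
        where
        shuffle : ∀ y i x → y * i * x ≡ i * x * y
        shuffle = solve-∀ ℚ-ring

  -- Excluded middle tells for each index whether any bound exists; indices without one impose no
  -- condition. By monotonicity the largest of the chosen bounds serves for all.
  maximum : ExcludedMiddle 0ℓ → ∀ m (P : Fin m → ℕ → Set) →
    (∀ i {b b′} → b ℕ.≤ b′ → P i b → P i b′) → ∃ λ B → ∀ i → ∃ (P i) → P i B
  maximum em zero    P mono = 0 , λ ()
  maximum em (suc m) P mono with maximum em m (P ∘ suc) (mono ∘ suc) | em {∃ (P zero)}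
  ... | B , bound | yes (b , p) = b ℕ.⊔ B , λ
    { zero    _ → mono zero (ℕₚ.m≤m⊔n b B) p
    ; (suc i) q → mono (suc i) (ℕₚ.m≤n⊔m b B) (bound i q) }
  ... | B , bound | no ¬p = B , λ
    { zero    q → contradiction q ¬p
    ; (suc i) q → bound i q }

  -- Integral matrices with bounded entries

  Matrix : ℕ → Set
  Matrix d = Fin d → Vector ℚ d

  -- It is M c, not merely c, that is nonzero: if M is the Gram matrix of a
  -- dependent family, this still makes the combination with coefficients c nonzero.
  record Isotropic≤ {d} (M : Matrix d) (b : ℕ) : Set where
    constructor mkIsotropic
    field
      coeff     : Vector ℚ d
      integral  : ∀ i → IsInt (coeff i)
      coeff-≤   : ∀ i → ∣ coeff i ∣ ≤ nat b
      isotropic : sum (λ i → coeff i * sum (λ j → coeff j * M i j)) ≡ 0ℚ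
      nonzero   : ¬ (∀ i → sum (λ j → coeff j * M i j) ≡ 0ℚ)

  open Isotropic≤

  Isotropic≤-cong : ∀ {d b} {M N : Matrix d} → (∀ i j → M i j ≡ N i j) → Isotropic≤ M b → Isotropic≤ N b
  Isotropic≤-cong {M = M} {N} e s = mkIsotropic (coeff s) (integral s) (coeff-≤ s)
    (trans (sum-cong-≗ (λ i → cong (coeff s i *_) (sym (rows i)))) (isotropic s))
    (λ q → nonzero s λ i → trans (rows i) (q i))
    where
    rows : ∀ i → sum (λ j → coeff s j * M i j) ≡ sum (λ j → coeff s j * N i j)
    rows i = sum-cong-≗ (λ j → cong (coeff s j *_) (e i j))

  module _ (d G : ℕ) where
    private
      m : ℕ
      -- One code for each integer from -G to G.
      m = suc (G ℕ.+ G)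

      decode : Fin ((m ℕ.^ d) ℕ.^ d) → Matrix d
      decode k i j = nat (toℕ (finToFun {m} {d} (finToFun {m ℕ.^ d} {d} k i) j)) - nat G

      entry : ∀ {x} → IsInt x → ∣ x ∣ ≤ nat G → ∃ λ (k : Fin m) → nat (toℕ k) - nat G ≡ x
      entry {x} int-x ∣x∣≤G =
        let k , k≤ , <1+k = box m lower upper in k , (begin
          nat (toℕ k) - nat G                                        ≡⟨ regroup (nat (toℕ k)) (nat G) x ⟩
          x - (x + nat G - nat (toℕ k))                              ≡⟨ cong (λ y → x - y) (int-∣∣<1
            (int-+ (int-+ int-x (int-nat G)) (int-neg (int-nat (toℕ k)))) (fractional k≤ <1+k)) ⟩
          x - 0ℚ                                                     ≡⟨ +-identityʳ x ⟩
          x                                                          ∎)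
        where
        open ≡-Reasoning
        regroup : ∀ k g x → k - g ≡ x - (x + g - k)
        regroup = solve-∀ ℚ-ring
        minus-neg : ∀ g x → g - - x ≡ x + g
        minus-neg = solve-∀ ℚ-ring
        lower : 0ℚ ≤ x + nat G
        lower = subst (0ℚ ≤_) (minus-neg (nat G) x) (0≤y-x (≤-trans (-x≤∣x∣ x) ∣x∣≤G))
        upper : x + nat G < nat m
        upper = ≤-<-trans (+-monoˡ-≤ (nat G) (≤-trans (x≤∣x∣ x) ∣x∣≤G))
          (by-< 0<1 (trans (cong₂ _-_ (trans (nat-suc (G ℕ.+ G)) (cong (1ℚ +_) (nat-+ G G))) refl) (1+x-x≡1 (nat G + nat G))))
        fractional : ∀ {y k} → k ≤ y → y < 1ℚ + k → ∣ y - k ∣ < 1ℚ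
        fractional {y} {k} p q = subst (_< 1ℚ) (sym (0≤p⇒∣p∣≡p (0≤y-x p)))
          (subst (y - k <_) (1+x-x≡1 k) (+-monoˡ-< (- k) q))

      encode : ∀ {M : Matrix d} → (∀ i j → IsInt (M i j)) → (∀ i j → ∣ M i j ∣ ≤ nat G) →
        ∃ λ k → ∀ i j → decode k i j ≡ M i j
      encode {M} int-M M≤ = funToFin (λ i → funToFin (f i)) , λ i j → begin
        nat (toℕ (finToFun (finToFun (funToFin (λ i → funToFin (f i))) i) j)) - nat G
          ≡⟨ cong (λ k → nat (toℕ (finToFun {m} {d} k j)) - nat G) (Finₚ.finToFun-funToFin (λ i → funToFin (f i)) i) ⟩
        nat (toℕ (finToFun (funToFin (f i)) j)) - nat G
          ≡⟨ cong (λ k → nat (toℕ k) - nat G) (Finₚ.finToFun-funToFin (f i) j) ⟩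
        nat (toℕ (f i j)) - nat G
          ≡⟨ proj₂ (entry (int-M i j) (M≤ i j)) ⟩
        M i j ∎
        where
        open ≡-Reasoning
        f : Fin d → Fin d → Fin m
        f i j = proj₁ (entry (int-M i j) (M≤ i j))

    opaque
      -- The matrices in question have finitely many codes, so one `B` suits all that possess an
      -- isotropic vector. It depends on `d` and `G` only, hence neither on the point nor on T.
      uniform-isotropic : ExcludedMiddle 0ℓ → ∃ λ B → ∀ {M : Matrix d} →
        (∀ i j → IsInt (M i j)) → (∀ i j → ∣ M i j ∣ ≤ nat G) → ∃ (Isotropic≤ M) → Isotropic≤ M B
      uniform-isotropic em =
        let B , bound = maximum em ((m ℕ.^ d) ℕ.^ d) (Isotropic≤ ∘ decode)
              (λ _ b≤b′ s → mkIsotropic (coeff s) (integral s) (λ i → ≤-trans (coeff-≤ s i) (nat-mono b≤b′)) (isotropic s) (nonzero s))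
        in  B , λ int-M M≤ (b , s) →
              let k , e = encode int-M M≤
              in  Isotropic≤-cong e (bound k (b , Isotropic≤-cong (λ i j → sym (e i j)) s))

  -- From a spanning family to an isotropic vector

  nat-mono-< : ∀ {m n} → m ℕ.< n → nat m < nat n
  nat-mono-< {m} {n} m<n = <-≤-trans (by-< 0<1 (1+x-x≡1 (nat m))) (subst (_≤ nat n) (nat-suc m) (nat-mono m<n))

  ∣0∣≤ : ∀ {x r} → x ≡ 0ℚ → 0ℚ ≤ r → ∣ x ∣ ≤ r
  ∣0∣≤ refl p = p

  module Lattice (n : ℕ) (a : Vector ℚ (suc n)) (τ σ : ℚ)
    (0<τ : 0ℚ < τ) (0<σ : 0ℚ < σ) (τσ≡1 : τ * σ ≡ 1ℚ)
    (near : (τ * τ) * ∣ sum (λ j → a j * a j) - 1ℚ ∣ ≤ 1ℚ)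
    (a₀-max : ∀ j → ∣ a j ∣ ≤ ∣ a zero ∣)
    (σ≤∣a₀∣ : σ ≤ ∣ a zero ∣) where

    open Geometry n a τ σ 0<τ 0<σ τσ≡1 near a₀-max σ≤∣a₀∣

    GoodVector : ℚ → V → Set
    GoodVector r v = Integral v × Size r v

    good-0 : ∀ {r} → 0ℚ ≤ r → GoodVector r (λ _ → 0ℚ)
    good-0 {r} 0≤r = (λ _ → ℤ.+ 0 , sym ι-0) ,
      mkSize (0≤* (<⇒≤ 0<τ) 0≤r) (λ j → ∣0∣≤ (0-homo (err-linear j)) 0≤r)
        (∣0∣≤ (trans (cong (τ *_) (0-homo height-linear)) (*-zeroʳ τ)) 0≤r)

    size-mono : ∀ {r r′ v} → r ≤ r′ → Size r v → Size r′ v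
    size-mono r≤r′ s = mkSize (≤-trans (zero-≤ s) (*-monoˡ (<⇒≤ 0<τ) r≤r′)) (λ j → ≤-trans (err-≤ s j) r≤r′) (≤-trans (height-≤ s) r≤r′)

    isotropic-mono : ∀ {r r′} → r ≤ r′ → Isotropic r → Isotropic r′
    isotropic-mono r≤r′ (v , int , size , rest) = v , int , size-mono r≤r′ size , rest

    combination-size : ∀ {l} (c : Vector ℚ l) (z : Fin l → V) {b r} → (∀ i → ∣ c i ∣ ≤ b) → (∀ i → Size r (z i)) →
      Size (nat l * (b * r)) (λ k → sum (λ i → c i * z i k))
    combination-size {l} c z {b} {r} c≤ sizes = mkSize
      (subst (∣ sum (λ i → c i * z i zero) ∣ ≤_) (shuffle (nat l) b τ r)
        (∣sum-homo∣≤ (coord-linear zero) {c = c} {x = z} c≤ (λ i → zero-≤ (sizes i))))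
      (λ j → ∣sum-homo∣≤ (err-linear j) {c = c} {x = z} c≤ (λ i → err-≤ (sizes i) j))
      (∣sum-homo∣≤ (scale-linear τ height-linear) {c = c} {x = z} c≤ (λ i → height-≤ (sizes i)))
      where
      shuffle : ∀ l b t r → l * (b * (t * r)) ≡ t * (l * (b * r))
      shuffle = solve-∀ ℚ-ring

    module _ {l : ℕ} {r : ℚ} (S : Spanning (GoodVector r) 0 l) where
      open Spanning S using (z; Z; good; spans)

      combination : Vector ℚ l → V
      combination c k = sum (λ i → c i * z i k)

      gram : Matrix l
      gram i j = form (z i) (z j)

      gram-row : ∀ c i → sum (λ j → c j * gram i j) ≡ form (z i) (combination c)
      gram-row c i = sym (sum-homo (form-linear (z i)) c z)

      gram-quadratic : ∀ c → sum (λ i → c i * sum (λ j → c j * gram i j)) ≡ form (combination c) (combination c)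
      gram-quadratic c = trans
        (sum-cong-≗ (λ i → cong (c i *_) (trans (gram-row c i) (form-comm (z i) (combination c)))))
        (sym (sum-homo (form-linear (combination c)) c z))

      spans′ : ∀ v → v ≗ combination (λ j → Z j v)
      spans′ v k = trans (spans v k) (+-identityˡ (combination (λ j → Z j v) k))

      -- `u` is the vector on the cone that belongs to the rational point (1, 0, ..., 0) of the
      -- sphere; `e` witnesses that pairing with `u` is not identically 0.
      u e : V
      u zero          = 1ℚ
      u (suc zero)    = 1ℚ
      u (suc (suc j)) = 0ℚ
      e zero    = 1ℚ
      e (suc j) = 0ℚ

      form-uu : form u u ≡ 0ℚ
      form-uu = cong (λ x → 1ℚ * 1ℚ + x - 1ℚ * 1ℚ) (sum-zero {n} (λ _ → refl))

      form-ue : form u e ≡ - 1ℚ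
      form-ue = cong (λ x → x - 1ℚ * 1ℚ) (sum-zero {suc n} (λ j → *-zeroʳ (u (suc j))))

      -- The coordinates of `u` in the spanning family, cleared of denominators, are isotropic for
      -- the Gram matrix. If the matrix killed them, `u` would be orthogonal to the family and thus
      -- to every vector, against `form-ue`. The bound `b` depends on the family; uniformity is
      -- supplied by `uniform-isotropic`.
      gram-isotropic : ∃ (Isotropic≤ gram)
      gram-isotropic =
        let N , int-N , N≢0 , int-Nc = clearDenominators (λ j → Z j u)
            c : Vector ℚ l
            c j = N * Z j u
            b , c≤b = bounded c
            combination≗ : combination c ≗ (λ k → N * u k)
            combination≗ k = begin
              sum (λ j → N * Z j u * z j k)      ≡⟨ sum-cong-≗ (λ j → *-assoc N (Z j u) (z j k)) ⟩
              sum (λ j → N * (Z j u * z j k))    ≡⟨ sym (*-distribˡ-sum N (λ j → Z j u * z j k)) ⟩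
              N * combination (λ j → Z j u) k        ≡⟨ cong (N *_) (sym (spans′ u k)) ⟩
              N * u k                            ∎
            form-c : ∀ w → form w (combination c) ≡ N * form w u
            form-c w = trans (≗-cong (form-linear w) combination≗) (*-homo (form-linear w) N u)
        in  b , mkIsotropic c int-Nc c≤b
              (begin
                sum (λ i → c i * sum (λ j → c j * gram i j))   ≡⟨ gram-quadratic c ⟩
                form (combination c) (combination c)                   ≡⟨ form-c (combination c) ⟩
                N * form (combination c) u                         ≡⟨ cong (N *_) (trans (form-comm (combination c) u) (form-c u)) ⟩
                N * (N * form u u)                             ≡⟨ cong (λ x → N * (N * x)) form-uu ⟩
                N * (N * 0ℚ)                                   ≡⟨ trans (cong (N *_) (*-zeroʳ N)) (*-zeroʳ N) ⟩
                0ℚ                                             ∎)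
              (λ rows → contradiction
                (begin
                  - 1ℚ                                   ≡⟨ sym form-ue ⟩
                  form u e                               ≡⟨ ≗-cong (form-linear u) (spans′ e) ⟩
                  form u (combination (λ j → Z j e))         ≡⟨ sum-homo (form-linear u) (λ j → Z j e) z ⟩
                  sum (λ j → Z j e * form u (z j))
                    ≡⟨ sum-zero (λ j → trans (cong (Z j e *_) (trans (form-comm u (z j))
                         (*-cancelˡ-≡0 N≢0 (trans (sym (form-c (z j))) (trans (sym (gram-row c j)) (rows j)))))) (*-zeroʳ (Z j e))) ⟩
                  0ℚ                                     ∎)
                (λ ()))
        where open ≡-Reasoning

      isotropic-from-spanning : ∀ {G B} → nat (4 ℕ.+ n) * (r * r) ≤ nat G →
        (∀ {M : Matrix l} → (∀ i j → IsInt (M i j)) → (∀ i j → ∣ M i j ∣ ≤ nat G) → ∃ (Isotropic≤ M) → Isotropic≤ M B) →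
        Isotropic (nat l * (nat B * r))
      isotropic-from-spanning {G} {B} G-large uniform =
        combination c ,
        (λ k → int-sum (λ j → int-* (integral sol j) (proj₁ (good j) k))) ,
        combination-size c z (coeff-≤ sol) (proj₂ ∘ good) ,
        -- The Gram matrix applied to `c` lists the pairings of the combination with the `z i`; as
        -- they are not all 0, neither is the combination.
        (λ v≡0 → nonzero sol λ i → trans (gram-row c i) (trans (≗-cong (form-linear (z i)) v≡0) (0-homo (form-linear (z i))))) ,
        trans (sym (gram-quadratic c)) (isotropic sol)
        where
        open Isotropic≤
        sol : Isotropic≤ gram B
        sol = uniform (λ i j → integral-form (proj₁ (good i)) (proj₁ (good j)))
          (λ i j → ≤-trans (∣form∣≤ (proj₂ (good i)) (proj₂ (good j))) G-large) gram-isotropic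
        c : Vector ℚ l
        c = coeff sol

    -- `err≤` gives the rate S/q. `err²≤` forces convergence as `τ` grows, whether or not `v zero`
    -- grows too.
    record Approximant (S : ℚ) : Set where
      constructor mkApproximant
      field
        v          : V
        v-integral : Integral v
        v₀>0       : 0ℚ < v zero
        v₀≤        : v zero ≤ τ * S
        on-cone    : sum (λ j → v (suc j) * v (suc j)) ≡ v zero * v zero
        err≤       : ∀ j → ∣ err j v ∣ ≤ S
        err²≤      : ∀ j → τ * (err j v * err j v) ≤ (1ℚ + 1ℚ + 1ℚ) * S * v zero

    -- On the cone, `form-expansion` turns the sum of the squared errors into -q² (s - 1) - 2 q h,
    -- with q = `v zero` and h the height. Times `τ`, the first term is at most S q, by `near` and q
    -- ≤ `τ` S; the second is at most 2 S q, by the bound on the height.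
    approximant⁺ : ∀ {S} v → Integral v → Size S v → form v v ≡ 0ℚ → 0ℚ < v zero → Approximant S
    approximant⁺ {S} v int size iso 0<v₀ = mkApproximant v int 0<v₀
      (≤-trans (x≤∣x∣ (v zero)) (zero-≤ size))
      (trans (sym (x+[y-x]≡y (v zero * v zero) _)) (trans (cong (v zero * v zero +_) iso) (+-identityʳ (v zero * v zero))))
      (err-≤ size)
      (λ j → begin
        τ * (err j v * err j v)
          ≤⟨ *-monoˡ (<⇒≤ 0<τ) (term≤sum (λ j → 0≤xx (err j v)) j) ⟩
        τ * E
          ≡⟨ expand-τE ⟩
        - (τ * (v₀ * v₀ * (s - 1ℚ))) + (1ℚ + 1ℚ) * v₀ * - (τ * height v)
          ≤⟨ +-mono-≤ near-term (*-monoˡ (0≤* (0≤+ 0≤1 0≤1) (<⇒≤ 0<v₀)) (≤-trans (-x≤∣x∣ (τ * height v)) (height-≤ size))) ⟩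
        S * v₀ + (1ℚ + 1ℚ) * v₀ * S
          ≡⟨ collect S v₀ ⟩
        (1ℚ + 1ℚ + 1ℚ) * S * v₀ ∎)
      where
      open ≤-Reasoning
      v₀ E : ℚ
      v₀ = v zero
      E = sum (λ j → err j v * err j v)
      collect : ∀ S v → S * v + (1ℚ + 1ℚ) * v * S ≡ (1ℚ + 1ℚ + 1ℚ) * S * v
      collect = solve-∀ ℚ-ring
      expand-τE : τ * E ≡ - (τ * (v₀ * v₀ * (s - 1ℚ))) + (1ℚ + 1ℚ) * v₀ * - (τ * height v)
      expand-τE = trans (lemma τ v₀ (s - 1ℚ) (height v) E)
        (trans (cong (λ x → τ * x + (- (τ * (v₀ * v₀ * (s - 1ℚ))) + (1ℚ + 1ℚ) * v₀ * - (τ * height v)))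
            (trans (sym (form-expansion v v)) iso))
          (trans (cong (_+ (- (τ * (v₀ * v₀ * (s - 1ℚ))) + (1ℚ + 1ℚ) * v₀ * - (τ * height v))) (*-zeroʳ τ)) (+-identityˡ _)))
        where
        lemma : ∀ t v d h E → t * E ≡ t * (v * v * d + v * h + v * h + E) + (- (t * (v * v * d)) + (1ℚ + 1ℚ) * v * - (t * h))
        lemma = solve-∀ ℚ-ring
      0≤S : 0ℚ ≤ S
      0≤S = size-nonneg size
      near-term : - (τ * (v₀ * v₀ * (s - 1ℚ))) ≤ S * v₀
      near-term = begin
        - (τ * (v₀ * v₀ * (s - 1ℚ)))        ≡⟨ shuffle τ v₀ (s - 1ℚ) ⟩
        v₀ * (v₀ * (τ * - (s - 1ℚ)))        ≤⟨ *-monoˡ (<⇒≤ 0<v₀) (*-monoˡ (<⇒≤ 0<v₀) (*-monoˡ (<⇒≤ 0<τ) (-x≤∣x∣ (s - 1ℚ)))) ⟩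
        v₀ * (v₀ * (τ * ∣ s - 1ℚ ∣))
          ≤⟨ *-monoˡ (<⇒≤ 0<v₀) (*-monoʳ-≤-nonNeg (τ * ∣ s - 1ℚ ∣) {{nonNegative (0≤* (<⇒≤ 0<τ) (0≤∣p∣ (s - 1ℚ)))}}
                 (≤-trans (x≤∣x∣ v₀) (zero-≤ size))) ⟩
        v₀ * (τ * S * (τ * ∣ s - 1ℚ ∣))     ≡⟨ shuffle′ v₀ τ S ∣ s - 1ℚ ∣ ⟩
        (S * v₀) * ((τ * τ) * ∣ s - 1ℚ ∣)   ≤⟨ *-monoˡ (0≤* 0≤S (<⇒≤ 0<v₀)) near ⟩
        (S * v₀) * 1ℚ                       ≡⟨ *-identityʳ (S * v₀) ⟩
        S * v₀                              ∎
        where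
        shuffle : ∀ t v d → - (t * (v * v * d)) ≡ v * (v * (t * - d))
        shuffle = solve-∀ ℚ-ring
        shuffle′ : ∀ v t S d → v * (t * S * (t * d)) ≡ (S * v) * ((t * t) * d)
        shuffle′ = solve-∀ ℚ-ring

    approximant : ∀ {S} → Isotropic S → Approximant S
    approximant {S} (v , int , size , v≢0 , iso) = go (<-cmp (v zero) 0ℚ)
      where
      -v : V
      -v k = - 1ℚ * v k
      abs-neg : ∀ x → ∣ - 1ℚ * x ∣ ≡ ∣ x ∣
      abs-neg x = trans (cong ∣_∣ (lemma x)) (∣-p∣≡∣p∣ x)
        where
        lemma : ∀ x → - 1ℚ * x ≡ - x
        lemma = solve-∀ ℚ-ring
      neg-size : Size S -v
      neg-size = mkSize
        (subst (_≤ τ * S) (sym (abs-neg (v zero))) (zero-≤ size))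
        (λ j → subst (_≤ S) (sym (trans (cong ∣_∣ (*-homo (err-linear j) (- 1ℚ) v)) (abs-neg (err j v)))) (err-≤ size j))
        (subst (_≤ S) (sym (trans (cong ∣_∣ (*-homo (scale-linear τ height-linear) (- 1ℚ) v)) (abs-neg (τ * height v)))) (height-≤ size))
      neg-iso : form -v -v ≡ 0ℚ
      neg-iso = trans (*-homo (form-linear -v) (- 1ℚ) v) (trans (cong (- 1ℚ *_) (trans (form-comm -v v) (*-homo (form-linear v) (- 1ℚ) v)))
        (cong (λ x → - 1ℚ * (- 1ℚ * x)) iso))
      go : Tri (v zero < 0ℚ) (v zero ≡ 0ℚ) (v zero > 0ℚ) → Approximant S
      go (tri< v₀<0 _ _) = approximant⁺ -v (λ k → int-* (int-neg (ℤ.+ 1 , sym ι-1)) (int k)) neg-size neg-iso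
        (by-< (neg-antimono-< v₀<0) (lemma (v zero)))
        where
        lemma : ∀ x → - 1ℚ * x - 0ℚ ≡ - x
        lemma = solve-∀ ℚ-ring
      -- On the cone, q = 0 makes the sum of the squares of the other coordinates 0.
      go (tri≈ _ v₀≡0 _) = contradiction all-zero v≢0
        where
        squares : sum (λ j → v (suc j) * v (suc j)) ≡ 0ℚ
        squares = trans (lemma (sum (λ j → v (suc j) * v (suc j))) (v zero * v zero))
          (cong₂ _+_ iso (trans (cong (_* v zero) v₀≡0) (*-zeroˡ (v zero))))
          where
          lemma : ∀ x y → x ≡ x - y + y
          lemma = solve-∀ ℚ-ring
        all-zero : ∀ k → v k ≡ 0ℚ
        all-zero zero    = v₀≡0
        all-zero (suc j) = xx≡0⇒x≡0 (v (suc j)) (sum≡0⇒≡0 (λ j → 0≤xx (v (suc j))) squares j)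
      go (tri> _ _ v₀>0) = approximant⁺ v int size iso v₀>0

  -- Rational points near a rational vector

  record RationalApproximation {n} (S : ℕ) (a : Vector ℚ (suc n)) (T : ℕ) : Set where
    constructor mkRationalApproximation
    field
      p       : Fin (suc n) → ℤ
      q       : ℕ
      0<q     : 0 ℕ.< q
      q≤      : nat q ≤ nat T * nat S
      on-cone : sum (λ j → ι (p j) * ι (p j)) ≡ nat q * nat q
      err≤    : ∀ j → ∣ ι (p j) - a j * nat q ∣ ≤ nat S
      err²≤   : ∀ j → nat T * ((ι (p j) - a j * nat q) * (ι (p j) - a j * nat q)) ≤ (1ℚ + 1ℚ + 1ℚ) * nat S * nat q

  positive-int : ∀ {x} → IsInt x → 0ℚ < x → ∃ λ q → 0 ℕ.< q × x ≡ nat q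
  positive-int (ℤ.+ zero , refl)  0<x = contradiction 0<x (<-irrefl (sym ι-0))
  positive-int (ℤ.+ suc q , e)    0<x = suc q , s≤s z≤n , e
  positive-int (ℤ.-[1+ q ] , refl) 0<x = contradiction (<-≤-trans 0<x
    (subst (_≤ 0ℚ) (sym (ι-neg (ℤ.+ suc q))) (neg-antimono-≤ (0≤nat (suc q))))) (<-irrefl refl)

  -- Sphere and error bounds are symmetric in the coordinates, so the largest coordinate of `a` may
  -- be moved to the front.
  permute : ∀ {n S T} {a : Vector ℚ (suc n)} (π : Permutation′ (suc n)) →
    RationalApproximation S (λ i → a (π ⟨$⟩ʳ i)) T → RationalApproximation S a T
  permute {n} {S} {T} {a} π r = mkRationalApproximation p′ q 0<q q≤
    (begin
      sum (λ k → square (p′ k))                 ≡⟨ sum-permute (λ k → square (p′ k)) π ⟩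
      sum (λ i → square (p′ (π ⟨$⟩ʳ i)))        ≡⟨ sum-cong-≗ {suc n} (λ i → cong (λ k → square (p k)) (inverseˡ π {i})) ⟩
      sum (λ i → square (p i))                  ≡⟨ on-cone ⟩
      nat q * nat q                             ∎)
    (λ k → subst (λ l → ∣ ι (p′ k) - a l * nat q ∣ ≤ nat S) (inverseʳ π {k}) (err≤ (π ⟨$⟩ˡ k)))
    (λ k → subst (λ l → nat T * ((ι (p′ k) - a l * nat q) * (ι (p′ k) - a l * nat q)) ≤ (1ℚ + 1ℚ + 1ℚ) * nat S * nat q)
      (inverseʳ π {k}) (err²≤ (π ⟨$⟩ˡ k)))
    where
    open RationalApproximation r
    open ≡-Reasoning
    square : ℤ → ℚ
    square z = ι z * ι z
    p′ : Fin (suc n) → ℤ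
    p′ k = p (π ⟨$⟩ˡ k)

  -- Constants depending on n alone

  module Constants (n : ℕ) where
    K : ℕ
    K = 4 ℕ.+ n

    -- There are R T R^(n+1) points and A T (R D)^(n+1) boxes.
    opaque
      D A R : ℕ
      D = K ℕ.* (K ℕ.* K)
      A = suc (4 ℕ.* suc n)
      -- After division by T R^(n+1), the counts of points and of boxes are R and A D^(n+1).
      R = suc (A ℕ.* D ℕ.^ suc n)

      A-large : nat 4 * nat (suc n) < nat A
      A-large = subst (_< nat A) (nat-* 4 (suc n)) (nat-mono-< (ℕₚ.n<1+n (4 ℕ.* suc n)))

      more-points : ∀ T → 0 ℕ.< T → A ℕ.* T ℕ.* (R ℕ.* D) ℕ.^ suc n ℕ.< R ℕ.* T ℕ.* R ℕ.^ suc n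
      more-points T 0<T = begin-strict
        A ℕ.* T ℕ.* (R ℕ.* D) ℕ.^ suc n              ≡⟨ cong (A ℕ.* T ℕ.*_) (distrib R D (suc n)) ⟩
        A ℕ.* T ℕ.* (R ℕ.^ suc n ℕ.* D ℕ.^ suc n)    ≡⟨ shuffle A T (R ℕ.^ suc n) (D ℕ.^ suc n) ⟩
        A ℕ.* D ℕ.^ suc n ℕ.* (T ℕ.* R ℕ.^ suc n)
          <⟨ ℕₚ.*-monoˡ-< (T ℕ.* R ℕ.^ suc n)
               {{ℕ.>-nonZero (ℕₚ.*-mono-< 0<T (ℕₚ.m^n>0 R (suc n)))}} (ℕₚ.n<1+n (A ℕ.* D ℕ.^ suc n)) ⟩
        R ℕ.* (T ℕ.* R ℕ.^ suc n)                    ≡⟨ sym (ℕₚ.*-assoc R T (R ℕ.^ suc n)) ⟩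
        R ℕ.* T ℕ.* R ℕ.^ suc n                      ∎
        where
        open ℕₚ.≤-Reasoning
        distrib : ∀ x y k → (x ℕ.* y) ℕ.^ k ≡ x ℕ.^ k ℕ.* y ℕ.^ k
        distrib x y zero    = refl
        distrib x y (suc k) = trans (cong (x ℕ.* y ℕ.*_) (distrib x y k)) (ℕₚ.[m*n]*[o*p]≡[m*o]*[n*p] x y (x ℕ.^ k) (y ℕ.^ k))
        shuffle : ∀ a t r d → a ℕ.* t ℕ.* (r ℕ.* d) ≡ a ℕ.* d ℕ.* (t ℕ.* r)
        shuffle a t r d = trans (cong (a ℕ.* t ℕ.*_) (ℕₚ.*-comm r d)) (ℕₚ.[m*n]*[o*p]≡[m*o]*[n*p] a t d r)

      0<D : 0ℚ < nat D
      0<D = 0<nat {D} (s≤s z≤n)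

      0<R : 0ℚ < nat R
      0<R = 0<nat {R} (s≤s z≤n)

      nat-D : nat D ≡ nat K * (nat K * nat K)
      nat-D = trans (nat-* K (K ℕ.* K)) (cong (nat K *_) (nat-* K K))

    η : ℚ
    η = proj₁ (inverse⁺ 0<D)

    Dη≡1 : nat D * η ≡ 1ℚ
    Dη≡1 = proj₁ (proj₂ (inverse⁺ 0<D))

    -- With κ = 4 + n ≥ 1 + n and η = κ⁻³ the left-hand side is at most κ⁻¹.
    η-small : nat K * ((nat (suc n) * (nat (suc n) * η)) * (nat (suc n) * (nat (suc n) * η))) < 1ℚ
    η-small = ≰⇒> λ 1≤X → contradiction (<-≤-trans (nat-mono-< {1} {K} (s≤s (s≤s z≤n))) (begin
        κ                                  ≡⟨ sym (*-identityʳ κ) ⟩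
        κ * 1ℚ                             ≤⟨ *-monoˡ (0≤nat K) 1≤X ⟩
        κ * (κ * (y * y))                  ≡⟨ shuffle κ y ⟩
        (κ * y) * (κ * y)                  ≤⟨ *-mono-≤ 0≤κy κy≤1 0≤κy κy≤1 ⟩
        1ℚ * 1ℚ                            ≡⟨ sym ι-1 ⟩
        nat 1                              ∎)) (<-irrefl refl)
      where
      open ≤-Reasoning
      κ m y : ℚ
      κ = nat K
      m = nat (suc n)
      y = m * (m * η)
      0≤η : 0ℚ ≤ η
      0≤η = <⇒≤ (proj₂ (proj₂ (inverse⁺ 0<D)))
      m≤κ : m ≤ κ
      m≤κ = nat-mono (ℕₚ.m≤n+m (suc n) 3)
      0≤m : 0ℚ ≤ m
      0≤m = 0≤nat (suc n)
      0≤κy : 0ℚ ≤ κ * y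
      0≤κy = 0≤* (0≤nat K) (0≤* 0≤m (0≤* 0≤m 0≤η))
      κy≤1 : κ * y ≤ 1ℚ
      κy≤1 = begin
        κ * (m * (m * η))   ≤⟨ *-monoˡ (0≤nat K) (*-mono-≤ 0≤m m≤κ (0≤* 0≤m 0≤η) (*-mono-≤ 0≤m m≤κ 0≤η ≤-refl)) ⟩
        κ * (κ * (κ * η))   ≡⟨ regroup κ η ⟩
        κ * (κ * κ) * η     ≡⟨ cong (_* η) (sym nat-D) ⟩
        nat D * η           ≡⟨ Dη≡1 ⟩
        1ℚ                  ∎
        where
        regroup : ∀ k e → k * (k * (k * e)) ≡ k * (k * k) * e
        regroup = solve-∀ ℚ-ring
      shuffle : ∀ k y → k * (k * (y * y)) ≡ (k * y) * (k * y)
      shuffle = solve-∀ ℚ-ring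

  module _ {n : ℕ} {a : Vector ℚ (suc n)} {T : ℕ} (n+2≤T : suc (suc n) ℕ.≤ T)
    (near : (nat T * nat T) * ∣ sum (λ j → a j * a j) - 1ℚ ∣ ≤ 1ℚ) where

    private
      τ s : ℚ
      τ = nat T
      s = sum (λ j → a j * a j)

      1≤τ : 1ℚ ≤ τ
      1≤τ = 1≤nat (ℕₚ.≤-trans (s≤s z≤n) n+2≤T)

      ∣s-1∣≤1 : ∣ s - 1ℚ ∣ ≤ 1ℚ
      ∣s-1∣≤1 = begin
        ∣ s - 1ℚ ∣               ≡⟨ sym (*-identityˡ ∣ s - 1ℚ ∣) ⟩
        1ℚ * ∣ s - 1ℚ ∣          ≤⟨ *-mono-≤ 0≤1 (*-mono-≤ 0≤1 1≤τ 0≤1 1≤τ) (0≤∣p∣ (s - 1ℚ)) ≤-refl ⟩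
        (τ * τ) * ∣ s - 1ℚ ∣     ≤⟨ near ⟩
        1ℚ                       ∎
        where open ≤-Reasoning

      s≤2 : s ≤ nat 2
      s≤2 = begin
        s                   ≡⟨ sym (x+[y-x]≡y 1ℚ s) ⟩
        1ℚ + (s - 1ℚ)       ≤⟨ +-monoʳ-≤ 1ℚ (≤-trans (x≤∣x∣ (s - 1ℚ)) ∣s-1∣≤1) ⟩
        1ℚ + 1ℚ             ≡⟨ cong (1ℚ +_) (sym ι-1) ⟩
        1ℚ + nat 1          ≡⟨ sym (nat-suc 1) ⟩
        nat 2               ∎
        where open ≤-Reasoning

    coordinate≤2 : ∀ j → ∣ a j ∣ ≤ nat 2
    coordinate≤2 j = ≮⇒≥ λ 2<∣aⱼ∣ → contradiction (<-≤-trans (nat-mono-< {2} {4} (s≤s (s≤s (s≤s z≤n)))) (begin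
      nat 4                     ≡⟨ nat-* 2 2 ⟩
      nat 2 * nat 2             ≤⟨ *-mono-≤ (0≤nat 2) (<⇒≤ 2<∣aⱼ∣) (0≤nat 2) (<⇒≤ 2<∣aⱼ∣) ⟩
      ∣ a j ∣ * ∣ a j ∣         ≡⟨ ∣x∣∣x∣≡xx (a j) ⟩
      a j * a j                 ≤⟨ term≤sum (λ j → 0≤xx (a j)) j ⟩
      s                         ≤⟨ s≤2 ⟩
      nat 2                     ∎)) (<-irrefl refl)
      where open ≤-Reasoning

    -- If all coordinates were at most 1/T, then T² s ≤ n + 1 and `near` would give T² ≤ n + 2. This
    -- is what T ≥ n + 2 excludes.
    largest-coordinate≥ : ∀ {σ} → τ * σ ≡ 1ℚ → (∀ j → ∣ a j ∣ ≤ ∣ a zero ∣) → σ ≤ ∣ a zero ∣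
    largest-coordinate≥ {σ} τσ≡1 a₀-max = ≮⇒≥ λ ∣a₀∣<σ →
      contradiction (<-≤-trans (nat-mono-< n+2<T²) (T²≤n+2 (<⇒≤ ∣a₀∣<σ))) (<-irrefl refl)
      where
      open ≤-Reasoning
      n+2<T² : suc (suc n) ℕ.< T ℕ.* T
      n+2<T² = ℕₚ.<-≤-trans (ℕₚ.m<m*n (suc (suc n)) (suc (suc n)) (s≤s (s≤s z≤n))) (ℕₚ.*-mono-≤ n+2≤T n+2≤T)
      T²≤n+2 : ∣ a zero ∣ ≤ σ → nat (T ℕ.* T) ≤ nat (suc (suc n))
      T²≤n+2 ∣a₀∣≤σ = begin
        nat (T ℕ.* T)                               ≡⟨ nat-* T T ⟩
        τ * τ                                       ≡⟨ split τ s ⟩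
        (τ * τ) * - (s - 1ℚ) + (τ * τ) * s          ≤⟨ +-mono-≤ (≤-trans (*-monoˡ (0≤xx τ) (-x≤∣x∣ (s - 1ℚ))) near) (*-monoˡ (0≤xx τ) s≤) ⟩
        1ℚ + (τ * τ) * (nat (suc n) * (σ * σ))
          ≡⟨ cong (1ℚ +_) (trans (shuffle τ (nat (suc n)) σ) (trans (cong (λ x → nat (suc n) * (x * x)) τσ≡1) (*-identityʳ (nat (suc n))))) ⟩
        1ℚ + nat (suc n)                            ≡⟨ sym (nat-suc (suc n)) ⟩
        nat (suc (suc n))                           ∎
        where
        split : ∀ t s → t * t ≡ (t * t) * - (s - 1ℚ) + (t * t) * s
        split = solve-∀ ℚ-ring
        shuffle : ∀ t k s → (t * t) * (k * (s * s)) ≡ k * ((t * s) * (t * s))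
        shuffle = solve-∀ ℚ-ring
        s≤ : s ≤ nat (suc n) * (σ * σ)
        s≤ = ≤-trans (x≤∣x∣ s) (∣sum∣≤const (λ j → ∣*∣≤ (≤-trans (a₀-max j) ∣a₀∣≤σ) (≤-trans (a₀-max j) ∣a₀∣≤σ)))

  -- Assembling an approximation to a rational vector

  module _ (n : ℕ) (a : Vector ℚ (suc n)) (T : ℕ) (σ : ℚ)
    (0<T : 0ℚ < nat T) (0<σ : 0ℚ < σ) (Tσ≡1 : nat T * σ ≡ 1ℚ)
    (near : (nat T * nat T) * ∣ sum (λ j → a j * a j) - 1ℚ ∣ ≤ 1ℚ)
    (a₀-max : ∀ j → ∣ a j ∣ ≤ ∣ a zero ∣)
    (σ≤∣a₀∣ : σ ≤ ∣ a zero ∣) where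

    open Geometry n a (nat T) σ 0<T 0<σ Tσ≡1 near a₀-max σ≤∣a₀∣
    open Lattice n a (nat T) σ 0<T 0<σ Tσ≡1 near a₀-max σ≤∣a₀∣

    rationalApproximation : ∀ {S} → Approximant (nat S) → RationalApproximation S a T
    rationalApproximation {S} r =
      let q , 0<q , v₀≡ = positive-int (v-integral zero) v₀>0
          p = λ j → proj₁ (v-integral (suc j))
          err≡ : ∀ j → err j v ≡ ι (p j) - a j * nat q
          err≡ j = cong₂ (λ x y → x - a j * y) (proj₂ (v-integral (suc j))) v₀≡
      in  mkRationalApproximation p q 0<q
            (subst (_≤ nat T * nat S) v₀≡ v₀≤)
            (trans (sym (sum-cong-≗ {suc n} (λ j → cong₂ _*_ (proj₂ (v-integral (suc j))) (proj₂ (v-integral (suc j))))))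
              (trans on-cone (cong₂ _*_ v₀≡ v₀≡)))
            (λ j → subst (λ x → ∣ x ∣ ≤ nat S) (err≡ j) (err≤ j))
            (λ j → subst₂ (λ x y → nat T * (x * x) ≤ (1ℚ + 1ℚ + 1ℚ) * nat S * y) (err≡ j) v₀≡ (err²≤ j))
      where open Approximant r

    isotropic-from-step : ∀ {R G l B} → ExcludedMiddle 0ℓ → l ≡ suc (suc n) ℕ.+ 0 →
      nat (4 ℕ.+ n) * (nat R * nat R) ≤ nat G →
      (∀ {M : Matrix l} → (∀ i j → IsInt (M i j)) → (∀ i j → ∣ M i j ∣ ≤ nat G) → ∃ (Isotropic≤ M) → Isotropic≤ M B) →
      (∀ {L} → IsLinear L → ¬ (∀ v → L v ≡ 0ℚ) →
        Isotropic (nat R) ⊎ ∃ λ v → Integral v × Size (nat R) v × L v ≢ 0ℚ) →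
      Isotropic (nat (R ℕ.+ l ℕ.* (B ℕ.* R)))
    isotropic-from-step {R} {G} {l} {B} em refl G-large uniform step =
      [ isotropic-mono (nat-mono (ℕₚ.m≤m+n R (l ℕ.* (B ℕ.* R))))
      , (λ S → isotropic-mono (≤-trans (≤-reflexive bound≡) (nat-mono (ℕₚ.m≤n+m (l ℕ.* (B ℕ.* R)) R)))
                 (isotropic-from-spanning S {G} {B} G-large uniform)) ]′
        (exchange em (good-0 (0≤nat R)) step′ (suc (suc n)) standard)
      where
      bound≡ : nat l * (nat B * nat R) ≡ nat (l ℕ.* (B ℕ.* R))
      bound≡ = sym (trans (nat-* l (B ℕ.* R)) (cong (nat l *_) (nat-* B R)))
      step′ : ∀ {L} → IsLinear L → ¬ (∀ v → L v ≡ 0ℚ) →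
        Isotropic (nat R) ⊎ ∃ λ v → GoodVector (nat R) v × L v ≢ 0ℚ
      step′ lin L≢0 = [ inj₁ , (λ (v , int , size , Lv≢0) → inj₂ (v , (int , size) , Lv≢0)) ]′ (step lin L≢0)

  module _ (em : ExcludedMiddle 0ℓ) (n : ℕ) where
    open Constants n

    private
      l G B : ℕ
      l = suc (suc n) ℕ.+ 0
      G = K ℕ.* (R ℕ.* R)
      B = proj₁ (uniform-isotropic l G em)

    -- R is enough when the pigeonhole itself meets the cone; otherwise the vector combines l
    -- vectors of size R with coefficients up to B. The sum covers both cases.
    bound : ℕ
    bound = R ℕ.+ l ℕ.* (B ℕ.* R)

    approximate-max : ∀ {a T} → suc (suc n) ℕ.≤ T → (nat T * nat T) * ∣ sum (λ j → a j * a j) - 1ℚ ∣ ≤ 1ℚ →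
      (∀ j → ∣ a j ∣ ≤ ∣ a zero ∣) → RationalApproximation bound a T
    approximate-max {a} {T} n+2≤T near a₀-max =
      go σ (0<nat 0<T) 0<σ τσ≡1 (largest-coordinate≥ {a = a} n+2≤T near τσ≡1 a₀-max) (coordinate≤2 {a = a} n+2≤T near)
      where
      0<T : 0 ℕ.< T
      0<T = ℕₚ.≤-trans (s≤s z≤n) n+2≤T
      σ : ℚ
      σ = proj₁ (inverse⁺ (0<nat 0<T))
      τσ≡1 : nat T * σ ≡ 1ℚ
      τσ≡1 = proj₁ (proj₂ (inverse⁺ (0<nat 0<T)))
      0<σ : 0ℚ < σ
      0<σ = proj₂ (proj₂ (inverse⁺ (0<nat 0<T)))
      G-large : nat (4 ℕ.+ n) * (nat R * nat R) ≤ nat G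
      G-large = ≤-reflexive (sym (trans (nat-* K (R ℕ.* R)) (cong (nat K *_) (nat-* R R))))
      go : ∀ σ → 0ℚ < nat T → 0ℚ < σ → nat T * σ ≡ 1ℚ → σ ≤ ∣ a zero ∣ → (∀ j → ∣ a j ∣ ≤ nat 2) → RationalApproximation bound a T
      go σ 0<τ 0<σ τσ≡1 σ≤∣a₀∣ a≤2 = rationalApproximation n a T σ 0<τ 0<σ τσ≡1 near a₀-max σ≤∣a₀∣
        (Lattice.approximant n a (nat T) σ 0<τ 0<σ τσ≡1 near a₀-max σ≤∣a₀∣
          (isotropic-from-step n a T σ 0<τ 0<σ τσ≡1 near a₀-max σ≤∣a₀∣ em refl G-large (proj₂ (uniform-isotropic l G em))
            (Pigeonhole.isotropic-or-independent n a T σ 0<τ 0<σ τσ≡1 near a₀-max σ≤∣a₀∣ a≤2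
              R D A 0<R 0<D A-large (more-points T 0<T) η Dη≡1 η-small)))

    approximate : ∀ {a T} → suc (suc n) ℕ.≤ T → (nat T * nat T) * ∣ sum (λ j → a j * a j) - 1ℚ ∣ ≤ 1ℚ →
      RationalApproximation bound a T
    approximate {a} {T} n+2≤T near =
      let i , max = argmax (λ j → ∣ a j ∣)
          π = transpose zero i
      in  permute {a = a} π (approximate-max n+2≤T
            (subst (λ s → (nat T * nat T) * ∣ s - 1ℚ ∣ ≤ 1ℚ) (sum-permute (λ j → a j * a j) π) near)
            (λ j → max (π ⟨$⟩ʳ j)))

  -- Reduction to lowest terms

  IsCoprime : ∀ {k} → Vec ℤ k → ℕ → Set
  IsCoprime p q = ∀ d → d ℤ∣.∣ ℤ.+ q → (∀ i → d ℤ∣.∣ lookup p i) → ℤ.∣ d ∣ ≡ 1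

  record LowestTerms {k} (p : Fin k → ℤ) (q : ℕ) : Set where
    constructor mkLowestTerms
    field
      num     : Vec ℤ k
      den     : ℕ
      factor  : ℕ
      coprime : IsCoprime num den
      p≡      : ∀ i → p i ≡ ℤ.+ factor ℤ.* lookup num i
      q≡      : q ≡ factor ℕ.* den

  -- Recursion on a bound `b` for `q`: excluded middle either rules out common divisors other than
  -- ±1 or provides one, and dividing by it makes `q` smaller.
  lowestTerms : ExcludedMiddle 0ℓ → ∀ {k} b (p : Fin k → ℤ) q → 0 ℕ.< q → q ℕ.≤ b → LowestTerms p q
  lowestTerms em zero p q 0<q q≤0 = contradiction (ℕₚ.<-≤-trans 0<q q≤0) ℕₚ.n≮0
  lowestTerms em {k} (suc b) p q 0<q q≤1+b = go em
    where
    CommonDivisor : Set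
    CommonDivisor = ∃ λ d → d ℤ∣.∣ ℤ.+ q × (∀ i → d ℤ∣.∣ p i) × ℤ.∣ d ∣ ≢ 1
    go : Dec CommonDivisor → LowestTerms p q
    go (no none) = mkLowestTerms (tabulate p) q 1
      (λ d d∣q d∣p → decidable-stable (ℤ.∣ d ∣ ℕₚ.≟ 1) λ ≢1 →
        none (d , d∣q , (λ i → subst (d ℤ∣.∣_) (lookup∘tabulate p i) (d∣p i)) , ≢1))
      (λ i → trans (sym (lookup∘tabulate p i)) (sym (ℤₚ.*-identityˡ (lookup (tabulate p) i))))
      (sym (ℕₚ.*-identityˡ q))
    go (yes (d , divides q′ q≡q′*c , d∣p , c≢1)) = mkLowestTerms num den (c ℕ.* factor) coprime
      (λ i → begin
        p i                                              ≡⟨ ℤ∣ₛ._∣_.equality (c∣p i) ⟩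
        p′ i ℤ.* ℤ.+ c                                   ≡⟨ ℤₚ.*-comm (p′ i) (ℤ.+ c) ⟩
        ℤ.+ c ℤ.* p′ i                                   ≡⟨ cong (ℤ.+ c ℤ.*_) (p≡ i) ⟩
        ℤ.+ c ℤ.* (ℤ.+ factor ℤ.* lookup num i)          ≡⟨ sym (ℤₚ.*-assoc (ℤ.+ c) (ℤ.+ factor) (lookup num i)) ⟩
        ℤ.+ c ℤ.* ℤ.+ factor ℤ.* lookup num i            ≡⟨ cong (ℤ._* lookup num i) (sym (ℤₚ.pos-* c factor)) ⟩
        ℤ.+ (c ℕ.* factor) ℤ.* lookup num i              ∎)
      (begin
        q                        ≡⟨ q≡q′*c ⟩
        q′ ℕ.* c                 ≡⟨ ℕₚ.*-comm q′ c ⟩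
        c ℕ.* q′                 ≡⟨ cong (c ℕ.*_) q≡ ⟩
        c ℕ.* (factor ℕ.* den)   ≡⟨ sym (ℕₚ.*-assoc c factor den) ⟩
        c ℕ.* factor ℕ.* den     ∎)
      where
      open ≡-Reasoning
      c : ℕ
      c = ℤ.∣ d ∣
      c∣p : ∀ i → ℤ.+ c ℤ∣ₛ.∣ p i
      c∣p i = ℤ∣ₛ.∣ᵤ⇒∣ (d∣p i)
      p′ : Fin k → ℤ
      p′ i = ℤ∣ₛ._∣_.quotient (c∣p i)
      0<q′ : 0 ℕ.< q′
      0<q′ = ℕₚ.n≢0⇒n>0 λ q′≡0 → ℕₚ.<⇒≢ 0<q (sym (trans q≡q′*c (cong (ℕ._* c) q′≡0)))
      1<c : 1 ℕ.< c
      1<c = ℕₚ.≤∧≢⇒< (ℕₚ.n≢0⇒n>0 λ c≡0 → ℕₚ.<⇒≢ 0<q (sym (trans q≡q′*c (trans (cong (q′ ℕ.*_) c≡0) (ℕₚ.*-zeroʳ q′))))) (c≢1 ∘ sym)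
      q′<q : q′ ℕ.< q
      q′<q = subst (q′ ℕ.<_) (sym q≡q′*c) (ℕₚ.m<m*n q′ c {{ℕ.>-nonZero 0<q′}} 1<c)
      open LowestTerms (lowestTerms em b p′ q′ 0<q′ (ℕₚ.≤-pred (ℕₚ.≤-trans q′<q q≤1+b)))

  module Reduced {n S T} {a : Vector ℚ (suc n)} (approx : RationalApproximation S a T)
    (terms : LowestTerms (RationalApproximation.p approx) (RationalApproximation.q approx)) where
    open RationalApproximation approx
    open LowestTerms terms

    factor*den>0 : 0 ℕ.< factor ℕ.* den
    factor*den>0 = subst (0 ℕ.<_) q≡ 0<q

    0<den : 0 ℕ.< den
    0<den = ℕₚ.n≢0⇒n>0 λ e → ℕₚ.<⇒≢ factor*den>0 (sym (trans (cong (factor ℕ.*_) e) (ℕₚ.*-zeroʳ factor)))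

    0<factor : 0 ℕ.< factor
    0<factor = ℕₚ.n≢0⇒n>0 λ e → ℕₚ.<⇒≢ factor*den>0 (sym (cong (ℕ._* den) e))

    instance
      den-nonZero : ℕ.NonZero den
      den-nonZero = ℕ.>-nonZero 0<den

    0<natq : 0ℚ < nat q
    0<natq = 0<nat 0<q

    value : Vector ℚ (suc n)
    value i = lookup num i / den

    q*value : ∀ i → nat q * value i ≡ ι (p i)
    q*value i = begin
      nat q * value i                     ≡⟨ cong (λ k → nat k * value i) q≡ ⟩
      nat (factor ℕ.* den) * value i      ≡⟨ cong (_* value i) (nat-* factor den) ⟩
      nat factor * nat den * value i      ≡⟨ *-assoc (nat factor) (nat den) (value i) ⟩
      nat factor * (nat den * value i)    ≡⟨ cong (nat factor *_) (/-* (lookup num i) den) ⟩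
      nat factor * ι (lookup num i)       ≡⟨ sym (ι-* (ℤ.+ factor) (lookup num i)) ⟩
      ι (ℤ.+ factor ℤ.* lookup num i)     ≡⟨ cong ι (sym (p≡ i)) ⟩
      ι (p i)                             ∎
      where open ≡-Reasoning

    value-on-sphere : sum (λ i → value i * value i) ≡ 1ℚ
    value-on-sphere = cancel (begin
      nat q * nat q * sum (λ i → value i * value i)                  ≡⟨ *-distribˡ-sum (nat q * nat q) (λ i → value i * value i) ⟩
      sum (λ i → nat q * nat q * (value i * value i))                ≡⟨ sum-cong-≗ {suc n} (λ i → shuffle (nat q) (value i)) ⟩
      sum (λ i → (nat q * value i) * (nat q * value i))              ≡⟨ sum-cong-≗ {suc n} (λ i → cong₂ _*_ (q*value i) (q*value i)) ⟩
      sum (λ i → ι (p i) * ι (p i))                                  ≡⟨ on-cone ⟩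
      nat q * nat q                                                  ≡⟨ sym (*-identityʳ (nat q * nat q)) ⟩
      nat q * nat q * 1ℚ                                             ∎)
      where
      open ≡-Reasoning
      shuffle : ∀ q v → q * q * (v * v) ≡ (q * v) * (q * v)
      shuffle = solve-∀ ℚ-ring
      cancel : ∀ {x y} → nat q * nat q * x ≡ nat q * nat q * y → x ≡ y
      cancel e = ≤-antisym (*-cancelˡ-≤ (0<* 0<natq 0<natq) (≤-reflexive e)) (*-cancelˡ-≤ (0<* 0<natq 0<natq) (≤-reflexive (sym e)))

    error : ∀ i → nat q * (value i - a i) ≡ ι (p i) - a i * nat q
    error i = trans (distrib (nat q) (value i) (a i)) (cong (_- a i * nat q) (q*value i))
      where
      distrib : ∀ q v a → q * (v - a) ≡ q * v - a * q
      distrib = solve-∀ ℚ-ring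

    ∣q*∣ : ∀ x → ∣ nat q * x ∣ ≡ nat q * ∣ x ∣
    ∣q*∣ x = trans (∣p*q∣≡∣p∣*∣q∣ (nat q) x) (cong (_* ∣ x ∣) (0≤p⇒∣p∣≡p (0≤nat q)))

    -- Times q, the distance is at most q θ + S, and q θ ≤ 1 since q ≤ T S ≤ T² and θ is 1/T².
    -- Reduction to lowest terms only lowers the denominator, which relaxes the bound to be met.
    ∣x-value∣≤ : ∀ {θ} → nat T * nat T * θ ≡ 1ℚ → 0ℚ ≤ θ → S ℕ.≤ T → ∀ i x → ∣ x - a i ∣ ≤ θ →
      ∣ x - value i ∣ ≤ nat (suc S) * (ℤ.+ 1 / den)
    ∣x-value∣≤ {θ} TTθ≡1 0≤θ S≤T i x x-a≤θ = *-cancelˡ-≤ (0<nat 0<den) (begin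
      nat den * ∣ x - value i ∣
        ≤⟨ *-monoʳ-≤-nonNeg ∣ x - value i ∣ {{nonNegative (0≤∣p∣ (x - value i))}} (nat-mono den≤q) ⟩
      nat q * ∣ x - value i ∣                      ≡⟨ sym (∣q*∣ (x - value i)) ⟩
      ∣ nat q * (x - value i) ∣                    ≡⟨ cong ∣_∣ (split (nat q) x (value i) (a i)) ⟩
      ∣ nat q * (x - a i) - nat q * (value i - a i) ∣
        ≤⟨ ∣p-q∣≤∣p∣+∣q∣ (nat q * (x - a i)) (nat q * (value i - a i)) ⟩
      ∣ nat q * (x - a i) ∣ + ∣ nat q * (value i - a i) ∣
        ≤⟨ +-mono-≤ near-term (subst (λ y → ∣ y ∣ ≤ nat S) (sym (error i)) (err≤ i)) ⟩
      1ℚ + nat S                                   ≡⟨ sym (nat-suc S) ⟩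
      nat (suc S)                                  ≡⟨ sym (*-identityʳ (nat (suc S))) ⟩
      nat (suc S) * 1ℚ                             ≡⟨ cong (nat (suc S) *_) (sym (trans (/-* (ℤ.+ 1) den) ι-1)) ⟩
      nat (suc S) * (nat den * (ℤ.+ 1 / den))      ≡⟨ swap (nat (suc S)) (nat den) (ℤ.+ 1 / den) ⟩
      nat den * (nat (suc S) * (ℤ.+ 1 / den))      ∎)
      where
      open ≤-Reasoning
      den≤q : den ℕ.≤ q
      den≤q = subst (den ℕ.≤_) (sym q≡) (ℕₚ.m≤n*m den factor {{ℕ.>-nonZero 0<factor}})
      split : ∀ q x v a → q * (x - v) ≡ q * (x - a) - q * (v - a)
      split = solve-∀ ℚ-ring
      swap : ∀ s d w → s * (d * w) ≡ d * (s * w)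
      swap = solve-∀ ℚ-ring
      near-term : ∣ nat q * (x - a i) ∣ ≤ 1ℚ
      near-term = begin
        ∣ nat q * (x - a i) ∣      ≤⟨ ∣*∣≤ (≤-trans (≤-reflexive (0≤p⇒∣p∣≡p (0≤nat q))) q≤) x-a≤θ ⟩
        nat T * nat S * θ          ≤⟨ *-monoʳ-≤-nonNeg θ {{nonNegative 0≤θ}} (*-monoˡ (0≤nat T) (nat-mono S≤T)) ⟩
        nat T * nat T * θ          ≡⟨ TTθ≡1 ⟩
        1ℚ                         ∎

    -- Divided by q², `err²≤` says that T times the squared distance is at most 3 S / q, hence at
    -- most 3 S. As q has dropped out, a large T alone ensures closeness.
    ∣a-value∣< : ∀ {ε} → 0ℚ < ε → (1ℚ + 1ℚ + 1ℚ) * nat S < nat T * (ε * ε) → ∀ i → ∣ a i - value i ∣ < ε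
    ∣a-value∣< {ε} 0<ε large i = ≰⇒> λ ε≤ → contradiction (<-≤-trans large (begin
      nat T * (ε * ε)                    ≤⟨ *-monoˡ (0≤nat T) (*-mono-≤ (<⇒≤ 0<ε) ε≤ (<⇒≤ 0<ε) ε≤) ⟩
      nat T * (∣ a i - v ∣ * ∣ a i - v ∣)   ≡⟨ cong (nat T *_) (trans (∣x∣∣x∣≡xx (a i - v)) (square-sym (a i) v)) ⟩
      Y                                  ≤⟨ *-cancelˡ-≤ 0<natq qX≤ ⟩
      (1ℚ + 1ℚ + 1ℚ) * nat S             ∎)) (<-irrefl refl)
      where
      open ≤-Reasoning
      v Y : ℚ
      v = value i
      Y = nat T * ((v - a i) * (v - a i))
      square-sym : ∀ a v → (a - v) * (a - v) ≡ (v - a) * (v - a)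
      square-sym = solve-∀ ℚ-ring
      shuffle : ∀ q t d → q * (q * (t * (d * d))) ≡ t * ((q * d) * (q * d))
      shuffle = solve-∀ ℚ-ring
      0≤Y : 0ℚ ≤ Y
      0≤Y = 0≤* (0≤nat T) (0≤xx (v - a i))
      qX≤ : nat q * Y ≤ nat q * ((1ℚ + 1ℚ + 1ℚ) * nat S)
      qX≤ = begin
        nat q * Y                                                   ≤⟨ *-monoˡ (0≤nat q) (subst (_≤ nat q * Y) (*-identityˡ Y)
                                                                         (*-monoʳ-≤-nonNeg Y {{nonNegative 0≤Y}} (1≤nat 0<q))) ⟩
        nat q * (nat q * Y)                                         ≡⟨ shuffle (nat q) (nat T) (v - a i) ⟩
        nat T * ((nat q * (v - a i)) * (nat q * (v - a i)))         ≡⟨ cong (λ e → nat T * (e * e)) (error i) ⟩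
        nat T * ((ι (p i) - a i * nat q) * (ι (p i) - a i * nat q)) ≤⟨ err²≤ i ⟩
        (1ℚ + 1ℚ + 1ℚ) * nat S * nat q                              ≡⟨ *-comm ((1ℚ + 1ℚ + 1ℚ) * nat S) (nat q) ⟩
        nat q * ((1ℚ + 1ℚ + 1ℚ) * nat S)                            ∎

-- Real points

open import Defs
open import Data.List.Base using (List; []; _∷_)
open import Data.List.Membership.Propositional using (_∉_)
open import Data.List.Relation.Unary.All as All using (All; []; _∷_)
open import Data.Rational.Base as ℚ using (ℚ; 0ℚ; 1ℚ; ½)
import Data.Rational.Properties as ℚₚ
open import Data.Vec.Functional using (foldr; map)
open Rational

seq-sum : ∀ {k} (v : Vector ℝ k) m → seq (foldr _+_ 0ℝ v) m ≡ sum (λ i → seq (v i) m)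
seq-sum {zero}  v m = refl
seq-sum {suc k} v m = cong (seq (v zero) m ℚ.+_) (seq-sum (v ∘ suc) m)

seq-⊔≤ : ∀ {k} (v : Vector ℝ k) m {b} → 0ℚ ℚ.≤ b → (∀ i → seq (v i) m ℚ.≤ b) → seq (foldr _⊔_ 0ℝ v) m ℚ.≤ b
seq-⊔≤ {zero}  v m 0≤b p = 0≤b
seq-⊔≤ {suc k} v m 0≤b p = ℚₚ.⊔-lub (p zero) (seq-⊔≤ (v ∘ suc) m 0≤b (p ∘ suc))

seq≡⇒≈ : ∀ {x y : ℝ} → (∀ m → seq x m ≡ seq y m) → x ≈ y
seq≡⇒≈ {x} {y} e ε 0<ε = 0 , λ m _ → subst (λ d → ℚ.∣ d ∣ ℚ.< ε)
  (sym (trans (cong (λ z → seq x m ℚ.- z) (sym (e m))) (ℚₚ.+-inverseʳ (seq x m)))) 0<ε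

<-≤⇒⊥ : ∀ {x y : ℚ} → x ℚ.< y → ¬ (y ℚ.≤ x)
<-≤⇒⊥ p q = ℚₚ.<-irrefl refl (ℚₚ.<-≤-trans p q)

fromℚ-mono-≤ : ∀ {r s} → r ℚ.≤ s → fromℚ r ≤ fromℚ s
fromℚ-mono-≤ {r} {s} r≤s (ε , 0<ε , N , gap) =
  <-≤⇒⊥ (ℚₚ.<-trans (by-< 0<ε (cancel s ε)) (gap N ℕₚ.≤-refl)) r≤s
  where
  cancel : ∀ s e → s ℚ.+ e ℚ.- s ≡ e
  cancel = solve-∀ ℚ-ring

-- Keeping away from given fractions

Apart : ℝ → ℚ → ℚ → ℕ → Set
Apart x r ε N = ∀ m → N ℕ.≤ m → ¬ (ℚ.∣ seq x m ℚ.- r ∣ ℚ.< ε)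

-- The coordinates of `⟦ f ⟧` are constant sequences, so the term at 0 is the coordinate itself.
Separated : ∀ {k} → Vector ℝ k → ℚ → ℕ → Fraction k → Set
Separated α ε N f = ∃ λ i → Apart (α i) (seq (⟦ f ⟧ i) 0) ε N

separated-mono : ∀ {k} (α : Vector ℝ k) {ε ε′ N N′} {f : Fraction k} → ε′ ℚ.≤ ε → N ℕ.≤ N′ →
  Separated α ε N f → Separated α ε′ N′ f
separated-mono α ε′≤ε N≤N′ (i , apart) = i , λ m N′≤m close →
  apart m (ℕₚ.≤-trans N≤N′ N′≤m) (ℚₚ.<-≤-trans close ε′≤ε)

module _ (em : ExcludedMiddle 0ℓ) where

  -- Past the Cauchy index for ε/2, a sequence that comes within ε/2 of `r` once stays within ε of
  -- it. Without any separation this would happen for every ε.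
  ¬≈⇒apart : ∀ {x r} → ¬ (x ≈ fromℚ r) → ∃ λ ε → 0ℚ ℚ.< ε × ∃ (Apart x r ε)
  ¬≈⇒apart {x} {r} x≉r = decidable-stable em λ ¬apart → x≉r λ ε 0<ε → decidable-stable em λ ¬close →
    let ε/2 : ℚ
        ε/2 = ½ ℚ.* ε
        0<ε/2 : 0ℚ ℚ.< ε/2
        0<ε/2 = 0<* (ℚₚ.positive⁻¹ ½) 0<ε
        N , cauchy-N = cauchy x ε/2 0<ε/2
    in  ¬apart (ε/2 , 0<ε/2 , N , λ m N≤m close → ¬close (N , λ n N≤n →
          subst₂ ℚ._<_ refl (halves ε) (ℚₚ.≤-<-trans
            (subst (λ d → ℚ.∣ d ∣ ℚ.≤ ℚ.∣ seq x n ℚ.- seq x m ∣ ℚ.+ ℚ.∣ seq x m ℚ.- r ∣) (telescope (seq x n) (seq x m) r)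
              (ℚₚ.∣p+q∣≤∣p∣+∣q∣ (seq x n ℚ.- seq x m) (seq x m ℚ.- r)))
            (ℚₚ.+-mono-< (cauchy-N n m N≤n N≤m) close))))
    where
    telescope : ∀ x y z → (x ℚ.- y) ℚ.+ (y ℚ.- z) ≡ x ℚ.- z
    telescope = solve-∀ ℚ-ring
    halves : ∀ e → ½ ℚ.* e ℚ.+ ½ ℚ.* e ≡ e
    halves = solve-∀ ℚ-ring

  -- No fraction equals an irrational vector, so each differs from it in some coordinate. The list
  -- is finite, so the least ε and the greatest index serve for all of it.
  irrational⇒separated : ∀ {k} (α : Vector ℝ k) → ¬ IsRationalVector α →
    ∀ fs → ∃ λ ε → 0ℚ ℚ.< ε × ∃ λ N → All (Separated α ε N) fs
  irrational⇒separated α irr [] = 1ℚ , 0<1 , 0 , []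
  irrational⇒separated {k} α irr (f ∷ fs) = combine (irrational⇒separated α irr fs) separated
    where
    value : Vector ℚ k
    value i = seq (⟦ f ⟧ i) 0
    separated : ∃ λ ε → 0ℚ ℚ.< ε × ∃ λ N → Separated α ε N f
    separated =
      let i , αᵢ≉ = Finₚ.¬∀⟶∃¬ k (λ i → α i ≈ fromℚ (value i)) (λ i → em) (λ α≈f → irr (value , α≈f))
          ε , 0<ε , N , apart = ¬≈⇒apart {α i} {value i} αᵢ≉
      in  ε , 0<ε , N , i , apart
    0<⊓ : ∀ {x y} → 0ℚ ℚ.< x → 0ℚ ℚ.< y → 0ℚ ℚ.< x ℚ.⊓ y
    0<⊓ {x} {y} 0<x 0<y = [ (λ x≤y → subst (0ℚ ℚ.<_) (sym (ℚₚ.p≤q⇒p⊓q≡p x≤y)) 0<x)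
                          , (λ y≤x → subst (0ℚ ℚ.<_) (sym (ℚₚ.p≥q⇒p⊓q≡q y≤x)) 0<y) ]′ (ℚₚ.≤-total x y)
    combine : (∃ λ ε → 0ℚ ℚ.< ε × ∃ λ N → All (Separated α ε N) fs) →
      (∃ λ ε → 0ℚ ℚ.< ε × ∃ λ N → Separated α ε N f) →
      ∃ λ ε → 0ℚ ℚ.< ε × ∃ λ N → All (Separated α ε N) (f ∷ fs)
    combine (ε , 0<ε , N , seps) (ε′ , 0<ε′ , N′ , sep) =
      ε ℚ.⊓ ε′ , 0<⊓ 0<ε 0<ε′ , N ℕ.⊔ N′ ,
      separated-mono α {f = f} (ℚₚ.p⊓q≤q ε ε′) (ℕₚ.m≤n⊔m N N′) sep
        ∷ All.map (λ {g} → separated-mono α {f = g} (ℚₚ.p⊓q≤p ε ε′) (ℕₚ.m≤m⊔n N N′)) seps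

  uniform-cauchy : ∀ {k} (α : Vector ℝ k) ε → 0ℚ ℚ.< ε → ∃ λ N → ∀ i m n → N ℕ.≤ m → N ℕ.≤ n →
    ℚ.∣ seq (α i) m ℚ.- seq (α i) n ∣ ℚ.< ε
  uniform-cauchy {k} α ε 0<ε =
    let N , bound = maximum em k (λ i N → ∀ m n → N ℕ.≤ m → N ℕ.≤ n → ℚ.∣ seq (α i) m ℚ.- seq (α i) n ∣ ℚ.< ε)
          (λ i N≤N′ p m n N′≤m N′≤n → p m n (ℕₚ.≤-trans N≤N′ N′≤m) (ℕₚ.≤-trans N≤N′ N′≤n))
    in  N , λ i → bound i (cauchy (α i) ε 0<ε)

-- Approximations outside a given list

approximates : ∀ {k C N b w} (α : Vector ℝ k) (p : Vec ℤ k) q .{{_ : ℕ.NonZero q}} .c →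
  w ≡ ℤ.+ 1 ℚ./ q → 0ℚ ℚ.< w → 0ℚ ℚ.≤ b → b ℚ.+ w ℚ.< C ℚ.* w →
  (∀ i m → N ℕ.≤ m → ℚ.∣ seq (α i) m ℚ.- lookup p i ℚ./ q ∣ ℚ.≤ b) →
  Approximates (fromℚ C) α (mkFraction p q c)
-- `w`, which is 1/q, doubles as the uniform gap demanded by `_<_`.
approximates {C = C} {N} {b} {w} α p q c refl 0<w 0≤b gap close = w , 0<w , N , λ m N≤m →
  ℚₚ.≤-<-trans (ℚₚ.+-monoˡ-≤ w (seq-⊔≤ _ m 0≤b (λ i → close i m N≤m))) gap

newApproximation : ∀ {n C N M b w ε fs} (α : Vector ℝ (suc n)) (p : Vec ℤ (suc n)) q .{{_ : ℕ.NonZero q}} .c →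
  w ≡ ℤ.+ 1 ℚ./ q → 0ℚ ℚ.< w → 0ℚ ℚ.≤ b → b ℚ.+ w ℚ.< C ℚ.* w →
  (∀ i m → N ℕ.≤ m → ℚ.∣ seq (α i) m ℚ.- lookup p i ℚ./ q ∣ ℚ.≤ b) →
  sum (λ i → (lookup p i ℚ./ q) ℚ.* (lookup p i ℚ./ q)) ≡ 1ℚ →
  All (Separated α ε M) fs → M ℕ.≤ N → (∀ i → ℚ.∣ seq (α i) N ℚ.- lookup p i ℚ./ q ∣ ℚ.< ε) →
  ∃ λ r → (Sphere n ⟦ r ⟧ × Approximates (fromℚ C) α r) × r ∉ fs
newApproximation {n} {C} {N} α p q c w≡ 0<w 0≤b gap close on-sphere seps M≤N near =
  mkFraction p q c ,
  (seq≡⇒≈ {x = foldr _+_ 0ℝ (map (λ x → x * x) ⟦ mkFraction p q c ⟧)} {y = 1ℝ}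
     (λ m → trans (seq-sum (map (λ x → x * x) ⟦ mkFraction p q c ⟧) m) on-sphere) ,
   approximates {C = C} {N} α p q c w≡ 0<w 0≤b gap close) ,
  -- At index N the new point is within ε of α in every coordinate, whereas each member of the list
  -- is off by at least ε in some coordinate.
  λ r∈fs → let i , apart = All.lookup seps r∈fs in apart N M≤N (near i)

module _ {n S T N M : ℕ} {fs : List (Fraction (suc n))} {ε θ : ℚ} (α : Vector ℝ (suc n))
  (TTθ≡1 : nat T ℚ.* nat T ℚ.* θ ≡ 1ℚ) (0≤θ : 0ℚ ℚ.≤ θ) (S≤T : S ℕ.≤ T)
  (0<ε : 0ℚ ℚ.< ε) (T-large : (1ℚ ℚ.+ 1ℚ ℚ.+ 1ℚ) ℚ.* nat S ℚ.< nat T ℚ.* (ε ℚ.* ε))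
  (α-near : ∀ i m → N ℕ.≤ m → ℚ.∣ seq (α i) m ℚ.- seq (α i) N ∣ ℚ.≤ θ)
  (approx : RationalApproximation S (λ i → seq (α i) N) T)
  (terms : LowestTerms (RationalApproximation.p approx) (RationalApproximation.q approx)) where

  private
    open LowestTerms terms using (num; den; coprime)
    open Reduced approx terms

    1/den : ℚ
    1/den = ℤ.+ 1 ℚ./ den

    0<1/den : 0ℚ ℚ.< 1/den
    0<1/den = ℚₚ.≰⇒> λ w≤0 → <-≤⇒⊥ 0<1
      (subst₂ ℚ._≤_ (trans (/-* (ℤ.+ 1) den) ι-1) (ℚₚ.*-zeroʳ (nat den)) (*-monoˡ (0≤nat den) w≤0))

    -- Origin of the constant S + 3: the error takes (S + 1)/q, the gap in `_<_` another 1/q, and a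
    -- last 1/q makes the inequality strict.
    gap : ∀ w → 0ℚ ℚ.< w → nat (suc S) ℚ.* w ℚ.+ w ℚ.< nat (3 ℕ.+ S) ℚ.* w
    gap w 0<w = by-< 0<w (trans (cong (λ k → k ℚ.* w ℚ.- (nat (suc S) ℚ.* w ℚ.+ w))
      (trans (nat-suc (2 ℕ.+ S)) (cong (1ℚ ℚ.+_) (nat-suc (suc S))))) (lemma (nat (suc S)) w))
      where
      lemma : ∀ k w → (1ℚ ℚ.+ (1ℚ ℚ.+ k)) ℚ.* w ℚ.- (k ℚ.* w ℚ.+ w) ≡ w
      lemma = solve-∀ ℚ-ring

  realApproximation : All (Separated α ε M) fs → M ℕ.≤ N →
    ∃ λ r → (Sphere n ⟦ r ⟧ × Approximates (fromℚ (nat (3 ℕ.+ S))) α r) × r ∉ fs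
  realApproximation seps M≤N =
    newApproximation {n} {nat (3 ℕ.+ S)} {N} {M} {nat (suc S) ℚ.* 1/den} {1/den} {ε} {fs} α num den coprime refl 0<1/den
      (0≤* (0≤nat (suc S)) (ℚₚ.<⇒≤ 0<1/den)) (gap 1/den 0<1/den)
      (λ i m N≤m → ∣x-value∣≤ TTθ≡1 0≤θ S≤T i (seq (α i) m) (α-near i m N≤m))
      value-on-sphere seps M≤N (∣a-value∣< 0<ε T-large)

-- The sum of three demands: n + 2 for the largest coordinate, S for comparing `a` with α, and more
-- than 3 S / ε² for closeness.
large-parameter : ∀ n S {ε} → 0ℚ ℚ.< ε →
  ∃ λ T → suc (suc n) ℕ.≤ T × S ℕ.≤ T × (1ℚ ℚ.+ 1ℚ ℚ.+ 1ℚ) ℚ.* nat S ℚ.< nat T ℚ.* (ε ℚ.* ε)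
large-parameter n S {ε} 0<ε =
  suc (suc n) ℕ.+ (S ℕ.+ t) ,
  ℕₚ.m≤m+n (suc (suc n)) (S ℕ.+ t) ,
  ℕₚ.≤-trans (ℕₚ.m≤m+n S t) (ℕₚ.m≤n+m (S ℕ.+ t) (suc (suc n))) ,
  subst₂ ℚ._<_
    (trans (swap (ε ℚ.* ε) x i) (trans (cong (x ℚ.*_) (proj₁ (proj₂ (inverse⁺ 0<εε)))) (ℚₚ.*-identityʳ x)))
    (ℚₚ.*-comm (ε ℚ.* ε) (nat (suc (suc n) ℕ.+ (S ℕ.+ t))))
    (*-monoˡ-< 0<εε (ℚₚ.<-≤-trans (proj₂ (archimedean (x ℚ.* i)))
      (nat-mono (ℕₚ.≤-trans (ℕₚ.m≤n+m t S) (ℕₚ.m≤n+m (S ℕ.+ t) (suc (suc n)))))))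
  where
  0<εε : 0ℚ ℚ.< ε ℚ.* ε
  0<εε = 0<* 0<ε 0<ε
  x i : ℚ
  x = (1ℚ ℚ.+ 1ℚ ℚ.+ 1ℚ) ℚ.* nat S
  i = proj₁ (inverse⁺ 0<εε)
  t : ℕ
  t = proj₁ (archimedean (x ℚ.* i))
  swap : ∀ e x i → e ℚ.* (x ℚ.* i) ≡ x ℚ.* (e ℚ.* i)
  swap = solve-∀ ℚ-ring

module _ (em : ExcludedMiddle 0ℓ) (n S : ℕ)
  (approximate : ∀ {a : Vector ℚ (suc n)} {T} → suc (suc n) ℕ.≤ T →
    (nat T ℚ.* nat T) ℚ.* ℚ.∣ sum (λ j → a j ℚ.* a j) ℚ.- 1ℚ ∣ ℚ.≤ 1ℚ → RationalApproximation S a T) where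

  -- The list determines ε, then ε determines T, T the precision θ, and θ the index N. `S` is fixed
  -- before all of them, so the constant does not depend on α.
  infinitelyMany : (α : Vector ℝ (suc n)) → Sphere n α → ¬ IsRationalVector α →
    InfinitelyMany λ r → Sphere n ⟦ r ⟧ × Approximates (fromℚ (nat (3 ℕ.+ S))) α r
  infinitelyMany α α∈Sⁿ irr fs = from (irrational⇒separated em α irr fs)
    where
    New : Set
    New = ∃ λ r → (Sphere n ⟦ r ⟧ × Approximates (fromℚ (nat (3 ℕ.+ S))) α r) × r ∉ fs
    from : (∃ λ ε → 0ℚ ℚ.< ε × ∃ λ M → All (Separated α ε M) fs) → New
    from (ε , 0<ε , M , seps) = from-parameter (large-parameter n S 0<ε)
      where
      from-parameter : (∃ λ T → suc (suc n) ℕ.≤ T × S ℕ.≤ T × (1ℚ ℚ.+ 1ℚ ℚ.+ 1ℚ) ℚ.* nat S ℚ.< nat T ℚ.* (ε ℚ.* ε)) → New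
      -- θ will be 1/T², the precision at which `near` holds for a term of α.
      from-parameter (T , n+2≤T , S≤T , T-large) = from-precision (inverse⁺ (0<* 0<T 0<T))
        where
        0<T : 0ℚ ℚ.< nat T
        0<T = 0<nat (ℕₚ.≤-trans (s≤s z≤n) n+2≤T)
        from-precision : (∃ λ θ → nat T ℚ.* nat T ℚ.* θ ≡ 1ℚ × 0ℚ ℚ.< θ) → New
        from-precision (θ , TTθ≡1 , 0<θ) = from-index (uniform-cauchy em α θ 0<θ) (α∈Sⁿ θ 0<θ)
          where
          norm² : ℝ
          norm² = foldr _+_ 0ℝ (map (λ x → x * x) α)
          from-index : (∃ λ N → ∀ i k m → N ℕ.≤ k → N ℕ.≤ m → ℚ.∣ seq (α i) k ℚ.- seq (α i) m ∣ ℚ.< θ) →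
            (∃ λ N → ∀ m → N ℕ.≤ m → ℚ.∣ seq norm² m ℚ.- 1ℚ ∣ ℚ.< θ) → New
          from-index (N₁ , cauchy-N₁) (N₂ , sphere-N₂) =
            realApproximation {S = S} α TTθ≡1 (ℚₚ.<⇒≤ 0<θ) S≤T 0<ε T-large
              (λ i m N≤m → ℚₚ.<⇒≤ (cauchy-N₁ i m N (ℕₚ.≤-trans N₁≤N N≤m) N₁≤N)) approx terms
              seps (ℕₚ.m≤m⊔n M (N₁ ℕ.⊔ N₂))
            where
            N : ℕ
            -- The term at N serves as `a`: M secures the separation, N₁ closeness to the later
            -- terms, N₂ closeness to the sphere.
            N = M ℕ.⊔ (N₁ ℕ.⊔ N₂)
            N₁≤N : N₁ ℕ.≤ N
            N₁≤N = ℕₚ.≤-trans (ℕₚ.m≤m⊔n N₁ N₂) (ℕₚ.m≤n⊔m M (N₁ ℕ.⊔ N₂))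
            N₂≤N : N₂ ℕ.≤ N
            N₂≤N = ℕₚ.≤-trans (ℕₚ.m≤n⊔m N₁ N₂) (ℕₚ.m≤n⊔m M (N₁ ℕ.⊔ N₂))
            a : Vector ℚ (suc n)
            a i = seq (α i) N
            near : (nat T ℚ.* nat T) ℚ.* ℚ.∣ sum (λ j → a j ℚ.* a j) ℚ.- 1ℚ ∣ ℚ.≤ 1ℚ
            near = subst₂ ℚ._≤_
              (cong (λ s → nat T ℚ.* nat T ℚ.* ℚ.∣ s ℚ.- 1ℚ ∣) (seq-sum (map (λ x → x * x) α) N)) TTθ≡1
              (*-monoˡ (ℚₚ.<⇒≤ (0<* 0<T 0<T)) (ℚₚ.<⇒≤ (sphere-N₂ N N₂≤N)))
            approx : RationalApproximation S a T
            approx = approximate n+2≤T near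
            terms : LowestTerms (RationalApproximation.p approx) (RationalApproximation.q approx)
            terms = lowestTerms em (RationalApproximation.q approx) (RationalApproximation.p approx)
              (RationalApproximation.q approx) (RationalApproximation.0<q approx) ℕₚ.≤-refl

theorem1p1 : ExcludedMiddle 0ℓ →
    (n : ℕ) → ∃ λ (C : ℝ) → (1ℝ ≤ C) ×
    ((α : Vector ℝ (suc n)) → Sphere n α → ¬ IsRationalVector α →
    InfinitelyMany λ r → Sphere n ⟦ r ⟧ × Approximates C α r)
theorem1p1 em n =
  fromℚ (nat (3 ℕ.+ bound em n)) , fromℚ-mono-≤ (1≤nat {3 ℕ.+ bound em n} (s≤s z≤n)) ,
  infinitelyMany em n (bound em n) (approximate em n)
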